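{- For every $n\geq1$, $\Phi_1$ is a bijection from $\mathcal{T}_n$ to the set of permutations of $\{1,\ldots,n\}$. Moreover, if $\sigma=\Phi_1(T)$, then $cr(T)$ equals the number of occurrences of the pattern 2-31 in $\sigma$.
   Context: A Ferrers diagram is a finite set of unit cells of $\mathbb{Z}^2$ forming left-justified rows whose lengths weakly decrease from top to bottom, considered up to translation; its boundary edges are the unit edges on its Southeast border path. A tree-like tableau is a Ferrers diagram in which each cell is empty or pointed, such that: (1) the top-left cell is pointed; (2) every non-root pointed cell has either a pointed cell above it in its column or a pointed cell to its left in its row, but not both; (3) every row and column contains a pointed cell. Its size $n$ is its number of points (half-perimeter minus 1); $\mathcal{T}_n$ is the set of those of size $n$; the boundary edges of $T\in\mathcal{T}_n$ are labelled $e_0(T),\ldots,e_n(T)$ from Southwest to Northeast. A crossing is an empty cell with a pointed cell above it in its column and a pointed cell to its left in its row; $cr(T)$ is their number. The special point of $T$ is the rightmost among pointed cells that are lowest in their column. $\mathrm{Insertpoint}(T,e)$: let $T'$ be obtained by inserting at $e$ a column (if $e$ is the right end of a row $r$: add a cell at the end of $r$ and every row above) or a row (if $e$ is the bottom of a column $c$: add a cell at the bottom of $c$ and every column to its left), with only the lowest cell of the new column (resp. rightmost cell of the new row) pointed. If $e$ lies Northeast of the special point of $T$ along the border path, the result is $T'$; otherwise add the ribbon of empty cells (connected, no $2\times2$ square, keeping a Ferrers diagram) from the cell immediately right of the new point to the cell immediately below the special point of $T$ (nothing if $e$ is the bottom edge of the special cell). Each $T\in\mathcal{T}_n$ has a unique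 insertion history $T_1,\ldots,T_n=T$ with $T_1$ the unique tableau of size 1 and $T_i=\mathrm{Insertpoint}(T_{i-1},e^i)$. Define $a_1(T)=0$ and, for $2\le i\le n$, $a_i(T)=j$ where $T_i=\mathrm{Insertpoint}(T_{i-1},e_j(T_{i-1}))$; thus $0\le a_i(T)\le i-1$. $\Phi_1(T)=\sigma$ is defined by: for $i=n,n-1,\ldots,1$, write $\{1,\ldots,n\}\setminus\{\sigma(i+1),\ldots,\sigma(n)\}=\{x_0<x_1<\cdots<x_{i-1}\}$ and set $\sigma(i)=x_{a_i(T)}$. An occurrence of 2-31 in a permutation $\sigma$ of $\{1,\ldots,n\}$ is a pair $(i,j)$ with $1\le i<j<n$ and $\sigma(j+1)<\sigma(i)<\sigma(j)$. -}

module Defs where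

open import Data.Bool using (Bool; true; false; not; _∧_; if_then_else_)
open import Data.Nat using (ℕ; zero; suc; _+_; _∸_; _≤_; _<_; _<ᵇ_; _≤ᵇ_; _≡ᵇ_)
open import Data.List using (List; []; _∷_; _++_; length; map; reverse; replicate;
  upTo; concatMap; zip; filterᵇ; foldl)
open import Data.Bool.ListAction using (any)
open import Data.Nat.ListAction using (sum)
open import Data.Maybe using (Maybe; just; nothing; _>>=_)
open import Data.Product using (_×_; _,_; Σ; ∃)
open import Data.Sum using (_⊎_)
open import Relation.Nullary using (¬_)
open import Relation.Binary.PropositionalEquality using (_≡_)
open import Data.List.Relation.Binary.Permutation.Propositional using (_↭_)

lookupD : {A : Set} → List A → ℕ → A → A
lookupD []       _       d = d
lookupD (x ∷ xs) zero    d = x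
lookupD (x ∷ xs) (suc i) d = lookupD xs i d

lookupM : {A : Set} → List A → ℕ → Maybe A
lookupM []       _       = nothing
lookupM (x ∷ xs) zero    = just x
lookupM (x ∷ xs) (suc i) = lookupM xs i

insertN : {A : Set} → List A → ℕ → A → List A
insertN xs       zero    v = v ∷ xs
insertN []       (suc i) v = v ∷ []
insertN (x ∷ xs) (suc i) v = x ∷ insertN xs i v

removeN : {A : Set} → List A → ℕ → List A
removeN []       _       = []
removeN (x ∷ xs) zero    = xs
removeN (x ∷ xs) (suc i) = x ∷ removeN xs i

modifyN : {A : Set} → List A → ℕ → (A → A) → List A
modifyN []       _       f = []
modifyN (x ∷ xs) zero    f = f x ∷ xs
modifyN (x ∷ xs) (suc i) f = x ∷ modifyN xs i f

range : ℕ → ℕ → List ℕ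
range a b = map (a +_) (upTo (b ∸ a))

countᵇ : {A : Set} → (A → Bool) → List A → ℕ
countᵇ p xs = length (filterᵇ p xs)

-- Raw (pointed) Ferrers diagrams.
-- A diagram is the list of its rows from top to bottom; row i is a
-- left-justified list of cells, `true` = pointed, `false` = empty.
-- Cell (i , j) = row i (from the top, 0-based), column j (0-based).

Raw : Set
Raw = List (List Bool)

rowLen : Raw → ℕ → ℕ
rowLen T i = length (lookupD T i [])

numRows : Raw → ℕ
numRows T = length T

numCols : Raw → ℕ
numCols T = rowLen T 0

pt : Raw → ℕ → ℕ → Bool
pt T i j = lookupD (lookupD T i []) j false

Pointed : Raw → ℕ → ℕ → Set
Pointed T i j = pt T i j ≡ true

colHeight : Raw → ℕ → ℕ
colHeight T c = countᵇ (λ row → c <ᵇ length row) T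

IsFerrers : Raw → Set
IsFerrers T = (∀ i → i < numRows T → 0 < rowLen T i)
            × (∀ i → rowLen T (suc i) ≤ rowLen T i)

PointAbove : Raw → ℕ → ℕ → Set
PointAbove T i j = ∃ λ i' → i' < i × Pointed T i' j

PointLeft : Raw → ℕ → ℕ → Set
PointLeft T i j = ∃ λ j' → j' < j × Pointed T i j'

IsTreeLike : Raw → Set
IsTreeLike T =
    IsFerrers T
  × Pointed T 0 0
  × (∀ i j → Pointed T i j → ¬ (i ≡ 0 × j ≡ 0) →
       (PointAbove T i j ⊎ PointLeft T i j) × ¬ (PointAbove T i j × PointLeft T i j))
  × (∀ i → i < numRows T → ∃ λ j → Pointed T i j)
  × (∀ j → j < numCols T → ∃ λ i → Pointed T i j)

size : Raw → ℕ
size T = sum (map (countᵇ (λ b → b)) T)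

IsTLT : ℕ → Raw → Set
IsTLT n T = IsTreeLike T × size T ≡ n

TLT : ℕ → Set
TLT n = Σ Raw (IsTLT n)

isCrossing : Raw → ℕ → ℕ → Bool
isCrossing T i j = not (pt T i j)
                 ∧ any (λ i' → pt T i' j) (upTo i)
                 ∧ any (λ j' → pt T i j') (upTo j)

cells : Raw → List (ℕ × ℕ)
cells T = concatMap (λ i → map (λ j → (i , j)) (upTo (rowLen T i))) (upTo (numRows T))

cr : Raw → ℕ
cr T = countᵇ (λ { (i , j) → isCrossing T i j }) (cells T)

-- Boundary edges, listed from Southwest to Northeast.
-- colBottom c = bottom edge of column c ; rowEnd r = right edge of row r.

data Edge : Set where
  colBottom : ℕ → Edge
  rowEnd    : ℕ → Edge

-- argument: (row index , row length) pairs, bottom row first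
edgesAux : ℕ → List (ℕ × ℕ) → List Edge
edgesAux prev []             = []
edgesAux prev ((r , l) ∷ rs) = map colBottom (range prev l) ++ (rowEnd r ∷ edgesAux l rs)

edges : Raw → List Edge
edges T = edgesAux 0 (reverse (zip (upTo (numRows T)) (map length T)))

-- Special point: rightmost pointed cell among those that are the bottom
-- cell of their column.  We return the index s of its bottom edge in
-- the list of boundary edges (e_s = colBottom c).

specialAux : Raw → ℕ → List Edge → Maybe ℕ → Maybe ℕ
specialAux T k []                  acc = acc
specialAux T k (colBottom c ∷ es) acc =
  specialAux T (suc k) es (if pt T (colHeight T c ∸ 1) c then just k else acc)
specialAux T k (rowEnd r ∷ es)    acc = specialAux T (suc k) es acc

specialIndex : Raw → Maybe ℕ
specialIndex T = specialAux T 0 (edges T) nothing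

padTo : ℕ → List Bool → List Bool
padTo t row = row ++ replicate (t ∸ length row) false

insertColumn : Raw → ℕ → Raw
insertColumn T r = go 0 T
  where
  c = rowLen T r
  go : ℕ → Raw → Raw
  go i []           = []
  go i (row ∷ rows) =
    (if i <ᵇ r then insertN row c false
     else if i ≡ᵇ r then insertN row c true
     else row) ∷ go (suc i) rows

insertRow : Raw → ℕ → Raw
insertRow T c = insertN T (colHeight T c) (replicate c false ++ (true ∷ []))

-- add the ribbon, in the already-inserted tableau T', between the new point
-- at (r0 , c0) (rightmost cell of row r0) and the special point at (r1 , c1)
-- (bottom cell of column c1): row r1+1 is filled up to column c1, and every
-- row r with r1+1 < r ≤ r0 is filled up to length (length of row r-1) + 1.
addRibbon : Raw → ℕ → ℕ → ℕ → Raw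
addRibbon T' r0 r1 c1 = go 0 T'
  where
  go : ℕ → Raw → Raw
  go i []           = []
  go i (row ∷ rows) =
    (if i ≡ᵇ suc r1 then padTo (suc c1) row
     else if (suc r1 <ᵇ i) ∧ (i ≤ᵇ r0) then padTo (suc (rowLen T' (i ∸ 1))) row
     else row) ∷ go (suc i) rows

insertpoint : Raw → ℕ → Maybe Raw
insertpoint T j = lookupM (edges T) j >>= λ e → specialIndex T >>= λ s →
  lookupM (edges T) s >>= λ es → just (result e s es)
  where
  -- special point of T : column c1 , row colHeight c1 - 1
  result : Edge → ℕ → Edge → Raw
  result (rowEnd r) s (colBottom c1) =
    let T'  = insertColumn T r
        cn  = rowLen T r
        r1  = colHeight T c1 ∸ 1
        c1' = if (r1 ≤ᵇ r) ∧ (cn ≤ᵇ c1) then suc c1 else c1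
    in if s <ᵇ j then T' else addRibbon T' r r1 c1'
  result (colBottom c) s (colBottom c1) =
    let T'  = insertRow T c
        h   = colHeight T c
        r1  = colHeight T c1 ∸ 1
        r1' = if h ≤ᵇ r1 then suc r1 else r1
    in if s <ᵇ j then T' else addRibbon T' h r1' c1
  result e s (rowEnd _) = T   -- impossible: s always indexes a column-bottom edge

T₁ : Raw
T₁ = (true ∷ []) ∷ []

history : List ℕ → Maybe Raw
history []       = nothing
history (_ ∷ as) = foldl (λ m a → m >>= λ T → insertpoint T a) (just T₁) as

-- valid codes of length n : 0 ≤ aᵢ ≤ i - 1  (here 0-based: a[k] ≤ k)
ValidCode : ℕ → List ℕ → Set
ValidCode n a = length a ≡ n × (∀ k → k < n → lookupD a k 0 ≤ k)

-- From codes to permutations: for i = n, …, 1, σ(i) = x_{aᵢ} where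
-- x₀ < … < x_{i-1} are the values not yet used.

decodeAux : List ℕ → List ℕ → List ℕ   -- reversed code, remaining values (sorted)
decodeAux []       rem = []
decodeAux (a ∷ as) rem = lookupD rem a 0 ∷ decodeAux as (removeN rem a)

decode : ℕ → List ℕ → List ℕ
decode n a = reverse (decodeAux (reverse a) (range 1 (suc n)))

-- Φ₁ as a relation: Φ₁ n T σ holds iff the insertion code (a₁,…,aₙ) of T
-- (i.e. the code whose insertion history produces T) is sent to σ.
Φ₁ : ℕ → Raw → List ℕ → Set
Φ₁ n T σ = ∃ λ a → ValidCode n a × history a ≡ just T × σ ≡ decode n a

IsPerm : ℕ → List ℕ → Set
IsPerm n σ = σ ↭ range 1 (suc n)

-- occurrences of 2-31: pairs 1 ≤ i < j < n with σ(j+1) < σ(i) < σ(j)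
-- (0-based positions in the list)
occ231 : List ℕ → ℕ
occ231 σ = countᵇ (λ { (i , j) → (s (suc j) <ᵇ s i) ∧ (s i <ᵇ s j) })
                  (concatMap (λ j → map (λ i → (i , j)) (upTo j)) (upTo (length σ ∸ 1)))
  where
  s : ℕ → ℕ
  s k = lookupD σ k 0

{-# OPTIONS --safe #-}

-- The border of a tableau is read as a word in N and E, so that inserting at an edge is a local
-- rewriting of the word and adding a ribbon turns a factor E u N into N u E. The point inserted last
-- is the special point, and its bottom edge has the index at which it was inserted. Hence the last
-- insertion can be undone in exactly one way: the new point has a point above it or a point to its
-- left according to the kind of edge, and the ribbon, if any, ends below the first point met on the
-- border. This makes insertion codes, and so permutations, correspond to tableaux. All cells of a
-- ribbon are crossings and no other crossings appear or vanish, so cr(T) is the sum of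
-- max(0, aᵢ - aᵢ₊₁), which also counts the occurrences of 2-31 by the position i + 1 of their 1.
module Submission where

open import Defs
open import Data.Bool using (Bool; true; false; not; _∧_; if_then_else_)
open import Data.Bool.ListAction using (any)
open import Data.Bool.Properties using (∧-comm; ∧-zeroʳ; T-≡)
open import Data.Empty using (⊥; ⊥-elim)
open import Data.List hiding (last; and; or; any; all; sum; lookup; head; tail)
open import Data.List.Properties
open import Data.List.Membership.Propositional using (_∈_)
open import Data.List.Relation.Binary.Permutation.Propositional
  using (_↭_; ↭-refl; ↭-sym; ↭-trans; prep; swap)
open import Data.List.Relation.Binary.Permutation.Propositional.Properties
  using (↭-length; ↭-reverse; filter-↭; drop-∷; ∈-resp-↭; All-resp-↭)
open import Data.List.Relation.Unary.All as All using (All; []; _∷_)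
open import Data.List.Relation.Unary.AllPairs using (AllPairs; []; _∷_)
import Data.List.Relation.Unary.AllPairs.Properties as AllPairs
open import Data.List.Relation.Unary.Any using (here; there)
open import Data.Maybe using (just; nothing; _>>=_)
open import Data.Maybe.Properties using (just-injective)
open import Data.Nat
open import Data.Nat.ListAction using (sum)
open import Data.Nat.Properties
open import Algebra.Properties.CommutativeSemigroup +-commutativeSemigroup using (x∙yz≈y∙xz; interchange)
open import Data.Product using (_×_; _,_; ∃; ∃₂; proj₁; proj₂)
open import Data.Sum as Sum using (_⊎_; inj₁; inj₂)
open import Data.Unit using (⊤; tt)
open import Function using (_∘_; id; flip)
open import Function.Bundles using (Equivalence)
open import Relation.Binary.PropositionalEquality hiding ([_])
open import Relation.Nullary using (¬_; yes; no; contradiction)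

-- The border and the points are kept apart: a word, and an unbounded matrix that is `false` outside
-- the shape. A ribbon then changes only the word, an insertion acts on the matrix by reindexing,
-- and being a crossing depends on the matrix alone, so that `cr` becomes a sum over a shape.
-- Coordinates are not stored but read off the word around a step, which spares most case
-- distinctions about shifted indices. The word starts in the Northeast because the definition
-- numbers edges from the Southwest: the index of an edge is the length of the suffix after it, and
-- an insertion leaves this suffix alone. The obstacle in undoing an insertion is that the end of a
-- ribbon is not marked. It is forced because a ribbon lies outside the smaller tableau: a longer
-- ribbon would contain the point below which a shorter one ends. `Insertion` is a relation on words
-- and matrices, so that injectivity and surjectivity become comparisons of factorizations of words;
-- `insertpoint` is matched with it only afterwards.

private variable
  A B : Set

-- Boolean comparisons of natural numbers

<ᵇ-true : ∀ {m n} → m < n → (m <ᵇ n) ≡ true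
<ᵇ-true m<n = Equivalence.to T-≡ (<⇒<ᵇ m<n)

<ᵇ-false : ∀ {m n} → n ≤ m → (m <ᵇ n) ≡ false
<ᵇ-false {m} {n} n≤m with m <ᵇ n in eq
... | true  = contradiction (<ᵇ⇒< m n (Equivalence.from T-≡ eq)) (≤⇒≯ n≤m)
... | false = refl

≤ᵇ-true : ∀ {m n} → m ≤ n → (m ≤ᵇ n) ≡ true
≤ᵇ-true z≤n = refl
≤ᵇ-true m≤n@(s≤s _) = <ᵇ-true m≤n

≤ᵇ-false : ∀ {m n} → n < m → (m ≤ᵇ n) ≡ false
≤ᵇ-false (s≤s n≤m) = <ᵇ-false n≤m

≡ᵇ-refl : ∀ n → (n ≡ᵇ n) ≡ true
≡ᵇ-refl zero    = refl
≡ᵇ-refl (suc n) = ≡ᵇ-refl n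

≡ᵇ-true⇒≡ : ∀ m n → (m ≡ᵇ n) ≡ true → m ≡ n
≡ᵇ-true⇒≡ m n eq = ≡ᵇ⇒≡ m n (Equivalence.from T-≡ eq)

≡ᵇ-false : ∀ {m n} → m ≢ n → (m ≡ᵇ n) ≡ false
≡ᵇ-false {m} {n} m≢n with m ≡ᵇ n in eq
... | true  = contradiction (≡ᵇ-true⇒≡ m n eq) m≢n
... | false = refl

bool-ext : ∀ {a b} → (a ≡ true → b ≡ true) → (b ≡ true → a ≡ true) → a ≡ b
bool-ext {true}  {true}  _ _ = refl
bool-ext {true}  {false} f _ = sym (f refl)
bool-ext {false} {true}  _ g = g refl
bool-ext {false} {false} _ _ = refl

true≢false : ∀ {b} → b ≡ true → b ≡ false → ⊥
true≢false refl ()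

-- Finite sums and counting

indicator : Bool → ℕ
indicator b = if b then 1 else 0

sumTo : ℕ → (ℕ → ℕ) → ℕ
sumTo zero    f = 0
sumTo (suc n) f = f 0 + sumTo n (f ∘ suc)

sumTo-cong : ∀ n {f g : ℕ → ℕ} → (∀ i → i < n → f i ≡ g i) → sumTo n f ≡ sumTo n g
sumTo-cong zero    f≗g = refl
sumTo-cong (suc n) f≗g =
  cong₂ _+_ (f≗g 0 z<s) (sumTo-cong n (λ i i<n → f≗g (suc i) (s<s i<n)))

sumTo-last : ∀ n f → sumTo (suc n) f ≡ f n + sumTo n f
sumTo-last zero    f = refl
sumTo-last (suc n) f = begin
  f 0 + sumTo (suc n) (f ∘ suc)        ≡⟨ cong (f 0 +_) (sumTo-last n (f ∘ suc)) ⟩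
  f 0 + (f (suc n) + sumTo n (f ∘ suc)) ≡⟨ +-assoc (f 0) _ _ ⟨
  f 0 + f (suc n) + sumTo n (f ∘ suc)   ≡⟨ cong (_+ sumTo n (f ∘ suc)) (+-comm (f 0) _) ⟩
  f (suc n) + f 0 + sumTo n (f ∘ suc)   ≡⟨ +-assoc (f (suc n)) _ _ ⟩
  f (suc n) + sumTo (suc n) f ∎
  where open ≡-Reasoning

countᵇ-∷ : ∀ (p : A → Bool) x xs → countᵇ p (x ∷ xs) ≡ indicator (p x) + countᵇ p xs
countᵇ-∷ p x xs with p x
... | true  = refl
... | false = refl

countᵇ-++ : ∀ (p : A → Bool) xs ys → countᵇ p (xs ++ ys) ≡ countᵇ p xs + countᵇ p ys
countᵇ-++ p []       ys = refl
countᵇ-++ p (x ∷ xs) ys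
  rewrite countᵇ-∷ p x (xs ++ ys) | countᵇ-∷ p x xs | countᵇ-++ p xs ys =
  sym (+-assoc (indicator (p x)) _ _)

countᵇ-↭ : ∀ (p : A → Bool) {xs ys} → xs ↭ ys → countᵇ p xs ≡ countᵇ p ys
countᵇ-↭ p xs↭ys = ↭-length (filter-↭ _ xs↭ys)

countᵇ-none : ∀ (p : A → Bool) {xs} → All (λ x → p x ≡ false) xs → countᵇ p xs ≡ 0
countᵇ-none p []           = refl
countᵇ-none p (_∷_ {x} {xs} e es) rewrite countᵇ-∷ p x xs | e = countᵇ-none p es

countᵇ-applyUpTo : ∀ (p : A → Bool) f n → countᵇ p (applyUpTo f n) ≡ sumTo n (indicator ∘ p ∘ f)
countᵇ-applyUpTo p f zero    = refl
countᵇ-applyUpTo p f (suc n)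
  rewrite countᵇ-∷ p (f 0) (applyUpTo (f ∘ suc) n) | countᵇ-applyUpTo p (f ∘ suc) n = refl

countᵇ-map-upTo : ∀ (p : A → Bool) f n → countᵇ p (map f (upTo n)) ≡ sumTo n (indicator ∘ p ∘ f)
countᵇ-map-upTo p f n = trans (cong (countᵇ p) (map-upTo f n)) (countᵇ-applyUpTo p f n)

countᵇ-concatMap : ∀ (p : A → Bool) (F : ℕ → List A) n →
  countᵇ p (concatMap F (upTo n)) ≡ sumTo n (countᵇ p ∘ F)
countᵇ-concatMap p F = go id
  where
  go : ∀ k n → countᵇ p (concatMap F (applyUpTo k n)) ≡ sumTo n (countᵇ p ∘ F ∘ k)
  go k zero    = refl
  go k (suc n) = trans (countᵇ-++ p (F (k 0)) _) (cong (countᵇ p (F (k 0)) +_) (go (k ∘ suc) n))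

countᵇ-lookupD : ∀ (p : A → Bool) d xs →
  countᵇ p xs ≡ sumTo (length xs) (λ i → indicator (p (lookupD xs i d)))
countᵇ-lookupD p d []       = refl
countᵇ-lookupD p d (x ∷ xs) =
  trans (countᵇ-∷ p x xs) (cong (indicator (p x) +_) (countᵇ-lookupD p d xs))

-- Codes and permutations

lookupD-++ˡ : ∀ (xs {ys} : List A) k d → k < length xs → lookupD (xs ++ ys) k d ≡ lookupD xs k d
lookupD-++ˡ (x ∷ xs) zero    d _         = refl
lookupD-++ˡ (x ∷ xs) (suc k) d (s≤s k<n) = lookupD-++ˡ xs k d k<n

lookupD-length : ∀ (xs : List A) y {ys} d → lookupD (xs ++ y ∷ ys) (length xs) d ≡ y
lookupD-length []       y d = refl
lookupD-length (x ∷ xs) y d = lookupD-length xs y d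

-- Codes are read from the last entry to the first, as `decodeAux` does.
data Code : ℕ → List ℕ → Set where
  []  : Code 0 []
  _∷_ : ∀ {m a as} → a ≤ m → Code m as → Code (suc m) (a ∷ as)

ValidCode⇒Code : ∀ {n} as → ValidCode n (reverse as) → Code n as
ValidCode⇒Code []       (refl , _) = []
ValidCode⇒Code (a ∷ as) (refl , bounds)
  rewrite unfold-reverse a as | length-++-sucʳ (reverse as) a [] | ++-identityʳ (reverse as) =
  ≤-trans (≤-reflexive (sym (lookupD-length (reverse as) a 0))) (bounds _ ≤-refl)
  ∷ ValidCode⇒Code as (refl , λ k k<n →
      subst (_≤ k) (lookupD-++ˡ (reverse as) k 0 k<n) (bounds k (m<n⇒m<1+n k<n)))

Code⇒ValidCode : ∀ {n as} → Code n as → ValidCode n (reverse as)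
Code⇒ValidCode {as = []} [] = refl , λ _ ()
Code⇒ValidCode {suc m} {a ∷ as} (a≤m ∷ c)
  rewrite unfold-reverse a as with Code⇒ValidCode c
... | len , bounds =
  trans (length-++-sucʳ (reverse as) a []) (cong suc (trans (cong length (++-identityʳ (reverse as))) len)) ,
  bounds′
  where
  bounds′ : ∀ k → k < suc m → lookupD (reverse as ++ a ∷ []) k 0 ≤ k
  bounds′ k k<1+m with m<1+n⇒m<n∨m≡n k<1+m
  ... | inj₁ k<m = subst (_≤ k) (sym (lookupD-++ˡ (reverse as) k 0 (subst (k <_) (sym len) k<m))) (bounds k k<m)
  ... | inj₂ refl = subst (_≤ k) (sym (trans (cong (λ l → lookupD (reverse as ++ a ∷ []) l 0) (sym len)) (lookupD-length (reverse as) a 0))) a≤m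

length-removeN : ∀ (xs : List A) {m} k → length xs ≡ suc m → k ≤ m → length (removeN xs k) ≡ m
length-removeN (x ∷ xs)         zero    refl _         = refl
length-removeN (x ∷ xs) {suc m} (suc k) eq   (s≤s k≤m) = cong suc (length-removeN xs k (suc-injective eq) k≤m)

lookupD∷removeN-↭ : ∀ (xs : List A) k d → k < length xs → lookupD xs k d ∷ removeN xs k ↭ xs
lookupD∷removeN-↭ (x ∷ xs) zero    d _         = ↭-refl
lookupD∷removeN-↭ (x ∷ xs) (suc k) d (s≤s k<n) =
  ↭-trans (swap _ x ↭-refl) (prep x (lookupD∷removeN-↭ xs k d k<n))

decodeAux-↭ : ∀ {m as} rem → length rem ≡ m → Code m as → decodeAux as rem ↭ rem
decodeAux-↭ []  _  []        = ↭-refl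
decodeAux-↭ {suc m} {a ∷ as} rem eq (a≤m ∷ c) =
  ↭-trans (prep _ (decodeAux-↭ (removeN rem a) (length-removeN rem a eq a≤m) c))
          (lookupD∷removeN-↭ rem a 0 (subst (a <_) (sym eq) (s≤s a≤m)))

∈⇒lookupD : ∀ {x : A} {xs} d → x ∈ xs → ∃ λ k → k < length xs × lookupD xs k d ≡ x
∈⇒lookupD d (here refl)  = 0 , z<s , refl
∈⇒lookupD d (there x∈xs) with ∈⇒lookupD d x∈xs
... | k , k<n , eq = suc k , s≤s k<n , eq

-- The position in `rem` of the head of `τ` is the code entry, and the tail of `τ` permutes what
-- remains once that position is removed.
decodeAux-surjective : ∀ τ rem {m} → length rem ≡ m → τ ↭ rem → ∃ λ as → Code m as × decodeAux as rem ≡ τ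
decodeAux-surjective [] rem refl τ↭rem with ↭-length τ↭rem
decodeAux-surjective [] [] refl τ↭rem | _ = [] , [] , refl
decodeAux-surjective (x ∷ τ) rem {m} eq τ↭rem with ∈⇒lookupD 0 (∈-resp-↭ τ↭rem (here refl))
decodeAux-surjective (x ∷ τ) []  {m} eq τ↭rem | a , () , _
decodeAux-surjective (x ∷ τ) rem@(_ ∷ _) {suc m} eq τ↭rem | a , a<n , refl
  with decodeAux-surjective τ (removeN rem a) (length-removeN rem a eq a≤m)
         (drop-∷ (↭-trans τ↭rem (↭-sym (lookupD∷removeN-↭ rem a 0 a<n))))
  where a≤m = s≤s⁻¹ (subst (a <_) eq a<n)
... | as , c , refl = a ∷ as , s≤s⁻¹ (subst (a <_) eq a<n) ∷ c , refl

-- Sorted lists and injectivity of the decoding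

Sorted : List ℕ → Set
Sorted = AllPairs _<_

All-lookupD : ∀ {P : A → Set} {xs} k d → All P xs → k < length xs → P (lookupD xs k d)
All-lookupD zero    d (p ∷ _)  _         = p
All-lookupD (suc k) d (_ ∷ ps) (s≤s k<n) = All-lookupD k d ps k<n

All-removeN : ∀ {P : A → Set} {xs} k → All P xs → All P (removeN xs k)
All-removeN k       []       = []
All-removeN zero    (_ ∷ ps) = ps
All-removeN (suc k) (p ∷ ps) = p ∷ All-removeN k ps

Sorted-removeN : ∀ {xs} k → Sorted xs → Sorted (removeN xs k)
Sorted-removeN k       []       = []
Sorted-removeN zero    (_ ∷ s)  = s
Sorted-removeN (suc k) (l ∷ s)  = All-removeN k l ∷ Sorted-removeN k s

lookupD-injective : ∀ {xs} → Sorted xs → ∀ j k → j < length xs → k < length xs →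
  lookupD xs j 0 ≡ lookupD xs k 0 → j ≡ k
lookupD-injective (_ ∷ _) zero    zero    _ _ _ = refl
lookupD-injective (l ∷ _) zero    (suc k) _ (s≤s k<n) eq = contradiction eq (<⇒≢ (All-lookupD k 0 l k<n))
lookupD-injective (l ∷ _) (suc j) zero    (s≤s j<n) _ eq = contradiction (sym eq) (<⇒≢ (All-lookupD j 0 l j<n))
lookupD-injective (_ ∷ s) (suc j) (suc k) (s≤s j<n) (s≤s k<n) eq = cong suc (lookupD-injective s j k j<n k<n eq)

decodeAux-injective : ∀ {m as bs} rem → length rem ≡ m → Sorted rem → Code m as → Code m bs →
  decodeAux as rem ≡ decodeAux bs rem → as ≡ bs
decodeAux-injective rem len s []        []        _  = refl
decodeAux-injective {as = a ∷ _} {b ∷ _} rem len s (a≤m ∷ c) (b≤m ∷ d) eq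
  with lookupD-injective s a b (subst (a <_) (sym len) (s≤s a≤m)) (subst (b <_) (sym len) (s≤s b≤m)) (∷-injectiveˡ eq)
... | refl = cong (a ∷_) (decodeAux-injective (removeN rem a) (length-removeN rem a len a≤m)
                           (Sorted-removeN a s) c d (∷-injectiveʳ eq))

-- Occurrences of 2-31 and descents of the code

between : ℕ → ℕ → ℕ → Bool
between y x z = (y <ᵇ z) ∧ (z <ᵇ x)

countᵇ-below : ∀ {xs} k → Sorted xs → k < length xs → countᵇ (_<ᵇ lookupD xs k 0) xs ≡ k
countᵇ-below {x ∷ xs} zero (l ∷ _) _
  rewrite countᵇ-∷ (_<ᵇ x) x xs | <ᵇ-false (≤-refl {x}) =
  countᵇ-none _ (All.map (<ᵇ-false ∘ <⇒≤) l)
countᵇ-below {x ∷ xs} (suc k) (l ∷ s) (s≤s k<n)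
  rewrite countᵇ-∷ (_<ᵇ lookupD xs k 0) x xs | <ᵇ-true (All-lookupD k 0 l k<n) =
  cong suc (countᵇ-below k s k<n)

countᵇ-cong-All : ∀ {p q : A → Bool} {xs} → All (λ x → p x ≡ q x) xs → countᵇ p xs ≡ countᵇ q xs
countᵇ-cong-All [] = refl
countᵇ-cong-All {p = p} {q} (_∷_ {x} {xs} e es)
  rewrite countᵇ-∷ p x xs | countᵇ-∷ q x xs | e = cong (indicator (q x) +_) (countᵇ-cong-All es)

-- Once entry `a` is removed, the entries above it are those of index at least `a`, and the entries
-- below the new entry `b` are those of index less than `b`. So the indices from `a` to `b ∸ 1` are
-- counted, none if `b ≤ a`.
countᵇ-between : ∀ {xs m} a b → Sorted xs → length xs ≡ suc m → a ≤ m → b < m →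
  countᵇ (between (lookupD xs a 0) (lookupD (removeN xs a) b 0)) (removeN xs a) ≡ b ∸ a
countᵇ-between {x ∷ xs} zero b (l ∷ s) refl _ b<m =
  trans (countᵇ-cong-All (All.map (λ x<z → cong₂ _∧_ (<ᵇ-true x<z) refl) l)) (countᵇ-below b s b<m)
countᵇ-between {x ∷ xs} {suc m} (suc a) zero (l ∷ s) eq (s≤s a≤m) _
  rewrite countᵇ-∷ (between (lookupD xs a 0) x) x (removeN xs a)
        | <ᵇ-false (≤-refl {x}) | ∧-zeroʳ (lookupD xs a 0 <ᵇ x) =
  countᵇ-none _ (All.map (λ x<z → trans (cong₂ _∧_ refl (<ᵇ-false (<⇒≤ x<z))) (∧-zeroʳ _)) (All-removeN a l))
countᵇ-between {x ∷ xs} {suc m} (suc a) (suc b) (l ∷ s) eq (s≤s a≤m) (s≤s b<m)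
  rewrite countᵇ-∷ (between (lookupD xs a 0) (lookupD (removeN xs a) b 0)) x (removeN xs a)
        | <ᵇ-false (<⇒≤ (All-lookupD a 0 l (≤-trans (s≤s a≤m) (≤-reflexive (sym (suc-injective eq)))))) =
  countᵇ-between a b s (suc-injective eq) a≤m b<m

descents : List ℕ → ℕ
descents (a ∷ b ∷ as) = (b ∸ a) + descents (b ∷ as)
descents _            = 0

-- On the reversed permutation, `y` is σ(j+1), `x` is σ(j), and `τ` lists the candidates for σ(i).
occ231ʳ : List ℕ → ℕ
occ231ʳ (y ∷ x ∷ τ) = countᵇ (between y x) τ + occ231ʳ (x ∷ τ)
occ231ʳ _           = 0

occ231ʳ-decodeAux : ∀ {m as} rem → length rem ≡ m → Sorted rem → Code m as → occ231ʳ (decodeAux as rem) ≡ descents as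
occ231ʳ-decodeAux rem len s []       = refl
occ231ʳ-decodeAux rem len s (_ ∷ []) = refl
occ231ʳ-decodeAux {as = a ∷ b ∷ as} rem len s (a≤m ∷ c@(b≤m ∷ c′)) = cong₂ _+_
  (begin
    countᵇ (between y x) (decodeAux as (removeN rem′ b))
      ≡⟨ countᵇ-↭ _ (decodeAux-↭ _ (length-removeN rem′ b len′ b≤m) c′) ⟩
    countᵇ (between y x) (removeN rem′ b)
      -- `x` does not lie strictly below itself, so counting it as well is free and restores the
      -- full list `rem′`.
      ≡⟨ cong (_+ countᵇ (between y x) (removeN rem′ b))
           (cong indicator (trans (cong ((y <ᵇ x) ∧_) (<ᵇ-false (≤-refl {x}))) (∧-zeroʳ _))) ⟨
    indicator (between y x x) + countᵇ (between y x) (removeN rem′ b)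
      ≡⟨ countᵇ-∷ (between y x) x _ ⟨
    countᵇ (between y x) (x ∷ removeN rem′ b)
      ≡⟨ countᵇ-↭ _ (lookupD∷removeN-↭ rem′ b 0 (subst (b <_) (sym len′) (s≤s b≤m))) ⟩
    countᵇ (between y x) rem′
      ≡⟨ countᵇ-between a b s len a≤m (s≤s b≤m) ⟩
    b ∸ a ∎)
  (occ231ʳ-decodeAux rem′ len′ (Sorted-removeN a s) c)
  where
  open ≡-Reasoning
  rem′ = removeN rem a
  len′ = length-removeN rem a len a≤m
  y = lookupD rem a 0
  x = lookupD rem′ b 0

occ231-sum : ∀ σ → occ231 σ ≡ sumTo (length σ ∸ 1) λ j → sumTo j λ i →
  indicator (between (lookupD σ (suc j) 0) (lookupD σ j 0) (lookupD σ i 0))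
occ231-sum σ = trans (countᵇ-concatMap _ _ (length σ ∸ 1))
  (sumTo-cong (length σ ∸ 1) λ j _ → countᵇ-map-upTo _ _ j)

lookupD-init : ∀ (xs : List A) x y k d → k ≤ length xs →
  lookupD (xs ++ x ∷ y ∷ []) k d ≡ lookupD (xs ++ x ∷ []) k d
lookupD-init []       x y zero    d _         = refl
lookupD-init (z ∷ xs) x y zero    d _         = refl
lookupD-init (z ∷ xs) x y (suc k) d (s≤s k≤n) = lookupD-init xs x y k d k≤n

-- Appending `y` adds a single new position j, that of `x`. The pairs with smaller j never look at
-- `y`.
occ231-snoc : ∀ ρ x y → occ231 (ρ ++ x ∷ y ∷ []) ≡ countᵇ (between y x) ρ + occ231 (ρ ++ x ∷ [])
occ231-snoc ρ x y
  rewrite occ231-sum (ρ ++ x ∷ y ∷ []) | occ231-sum (ρ ++ x ∷ [])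
        | length-++ ρ {x ∷ y ∷ []} | length-++ ρ {x ∷ []}
        | +-suc (length ρ) 1 | +-comm (length ρ) 1 =
  trans (sumTo-last (length ρ) _) (cong₂ _+_ last-j earlier-j)
  where
  σ = ρ ++ x ∷ y ∷ []
  ρx = ρ ++ x ∷ []
  open ≡-Reasoning
  at-y : lookupD σ (suc (length ρ)) 0 ≡ y
  at-y = trans (cong₂ (λ l k → lookupD l k 0) (sym (++-assoc ρ (x ∷ []) (y ∷ [])))
                  (sym (trans (length-++ ρ) (+-comm _ 1))))
               (lookupD-length ρx y 0)
  last-j : _ ≡ countᵇ (between y x) ρ
  last-j = begin
    sumTo (length ρ) (λ i → indicator (between (lookupD σ (suc (length ρ)) 0) (lookupD σ (length ρ) 0) (lookupD σ i 0)))
      ≡⟨ sumTo-cong (length ρ) (λ i i<n → cong indicator (trans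
           (cong₂ (λ u v → between u v (lookupD σ i 0)) at-y (lookupD-length ρ x 0))
           (cong (between y x) (lookupD-++ˡ ρ i 0 i<n)))) ⟩
    sumTo (length ρ) (λ i → indicator (between y x (lookupD ρ i 0)))
      ≡⟨ countᵇ-lookupD (between y x) 0 ρ ⟨
    countᵇ (between y x) ρ ∎
  earlier-j : _ ≡ _
  earlier-j = sumTo-cong (length ρ) λ j j<n → sumTo-cong j λ i i<j → cong indicator
    (cong₂ _∧_ (cong₂ _<ᵇ_ (same (suc j) j<n) (same i (<⇒≤ (<-trans i<j j<n))))
               (cong₂ _<ᵇ_ (same i (<⇒≤ (<-trans i<j j<n))) (same j (<⇒≤ j<n))))
    where
    same : ∀ k → k ≤ length ρ → lookupD σ k 0 ≡ lookupD ρx k 0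
    same k = lookupD-init ρ x y k 0

occ231-reverse : ∀ τ → occ231 (reverse τ) ≡ occ231ʳ τ
occ231-reverse []          = refl
occ231-reverse (y ∷ [])    = refl
occ231-reverse (y ∷ x ∷ τ) = begin
  occ231 (reverse (y ∷ x ∷ τ))
    ≡⟨ cong occ231 (trans (reverse-++ (y ∷ x ∷ []) τ) refl) ⟩
  occ231 (reverse τ ++ x ∷ y ∷ [])
    ≡⟨ occ231-snoc (reverse τ) x y ⟩
  countᵇ (between y x) (reverse τ) + occ231 (reverse τ ++ x ∷ [])
    ≡⟨ cong₂ _+_ (countᵇ-↭ _ (↭-reverse τ)) (cong occ231 (sym (unfold-reverse x τ))) ⟩
  countᵇ (between y x) τ + occ231 (reverse (x ∷ τ))
    ≡⟨ cong (countᵇ (between y x) τ +_) (occ231-reverse (x ∷ τ)) ⟩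
  countᵇ (between y x) τ + occ231ʳ (x ∷ τ) ∎
  where open ≡-Reasoning

range-Sorted : ∀ n → Sorted (range 1 (suc n))
range-Sorted n rewrite map-upTo (1 +_) n = AllPairs.applyUpTo⁺₁ _ n (λ i<j _ → s<s i<j)

range-length : ∀ n → length (range 1 (suc n)) ≡ n
range-length n = trans (length-map _ (upTo n)) (length-upTo n)

-- Border words

data Step : Set where
  N E : Step

-- The border is read from Northeast to Southwest, so that rows come from top to bottom.
Word : Set
Word = List Step

-- The coordinates of a step `e` in `p ++ e ∷ q` are `nN p` and `nE q`: if `e` is `N`, it ends row
-- `nN p`, of length `nE q`; if `e` is `E`, it is the bottom of column `nE q`, of height `nN p`.
nN nE : Word → ℕ
nN []      = 0
nN (N ∷ v) = suc (nN v)
nN (E ∷ v) = nN v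
nE []      = 0
nE (N ∷ v) = nE v
nE (E ∷ v) = suc (nE v)

nN-++ : ∀ p {q} → nN (p ++ q) ≡ nN p + nN q
nN-++ []      = refl
nN-++ (N ∷ p) = cong suc (nN-++ p)
nN-++ (E ∷ p) = nN-++ p

nE-++ : ∀ p {q} → nE (p ++ q) ≡ nE p + nE q
nE-++ []      = refl
nE-++ (N ∷ p) = nE-++ p
nE-++ (E ∷ p) = cong suc (nE-++ p)

-- Row lengths, with value 0 below the last row as for `rowLen`.
lenAt : Word → ℕ → ℕ
lenAt []      x       = 0
lenAt (N ∷ v) zero    = nE v
lenAt (N ∷ v) (suc x) = lenAt v x
lenAt (E ∷ v) x       = lenAt v x

lenAt≤nE : ∀ v x → lenAt v x ≤ nE v
lenAt≤nE []      x       = z≤n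
lenAt≤nE (N ∷ v) zero    = ≤-refl
lenAt≤nE (N ∷ v) (suc x) = lenAt≤nE v x
lenAt≤nE (E ∷ v) x       = m≤n⇒m≤1+n (lenAt≤nE v x)

lenAt-antitone : ∀ v x → lenAt v (suc x) ≤ lenAt v x
lenAt-antitone []      x       = z≤n
lenAt-antitone (N ∷ v) zero    = lenAt≤nE v 0
lenAt-antitone (N ∷ v) (suc x) = lenAt-antitone v x
lenAt-antitone (E ∷ v) x       = lenAt-antitone v x

lenAt-++ˡ : ∀ p {q} x → x < nN p → lenAt (p ++ q) x ≡ lenAt p x + nE q
lenAt-++ˡ (N ∷ p) zero    _         = nE-++ p
lenAt-++ˡ (N ∷ p) (suc x) (s≤s x<n) = lenAt-++ˡ p x x<n
lenAt-++ˡ (E ∷ p) x       x<n       = lenAt-++ˡ p x x<n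

lenAt-++ʳ : ∀ p {q} k → lenAt (p ++ q) (nN p + k) ≡ lenAt q k
lenAt-++ʳ []      k = refl
lenAt-++ʳ (N ∷ p) k = lenAt-++ʳ p k
lenAt-++ʳ (E ∷ p) k = lenAt-++ʳ p k

lenAt-++ʳ₀ : ∀ p {q} → lenAt (p ++ q) (nN p) ≡ lenAt q 0
lenAt-++ʳ₀ p {q} = subst (λ x → lenAt (p ++ q) x ≡ lenAt q 0) (+-identityʳ (nN p)) (lenAt-++ʳ p 0)

lenAt>0⇒<nN : ∀ v x {y} → y < lenAt v x → x < nN v
lenAt>0⇒<nN (N ∷ v) zero    _ = z<s
lenAt>0⇒<nN (N ∷ v) (suc x) l = s<s (lenAt>0⇒<nN v x l)
lenAt>0⇒<nN (E ∷ v) x       l = lenAt>0⇒<nN v x l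

data Locate (a : ℕ) : ℕ → Set where
  before : ∀ {x} → x < a → Locate a x
  after  : ∀ k → Locate a (a + k)

locate : ∀ a x → Locate a x
locate zero    x       = after x
locate (suc a) zero    = before z<s
locate (suc a) (suc x) with locate a x
... | before x<a = before (s<s x<a)
... | after k    = after k

-- Insertion of a row or a column in a matrix

-- The increasing map that skips `i`: after an insertion at `i`, old indices have the form
-- `pin i x`.
pin : ℕ → ℕ → ℕ
pin zero    x       = suc x
pin (suc i) zero    = zero
pin (suc i) (suc x) = suc (pin i x)

data PinView (i : ℕ) : ℕ → Set where
  at     : PinView i i
  pinned : ∀ x → PinView i (pin i x)

pinView : ∀ i x → PinView i x
pinView zero    zero    = at
pinView zero    (suc x) = pinned x
pinView (suc i) zero    = pinned zero
pinView (suc i) (suc x) with pinView i x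
... | at       = at
... | pinned y = pinned (suc y)

pin-< : ∀ {i x} → x < i → pin i x ≡ x
pin-< {suc i} {zero}  _         = refl
pin-< {suc i} {suc x} (s≤s x<i) = cong suc (pin-< x<i)

pin-≥ : ∀ {i x} → i ≤ x → pin i x ≡ suc x
pin-≥ {zero}          _         = refl
pin-≥ {suc i} {suc x} (s≤s i≤x) = cong suc (pin-≥ i≤x)

pin-mono-< : ∀ i {x y} → x < y → pin i x < pin i y
pin-mono-< zero    x<y                 = s<s x<y
pin-mono-< (suc i) {zero}  {suc y} _   = z<s
pin-mono-< (suc i) {suc x} {suc y} (s≤s x<y) = s<s (pin-mono-< i x<y)

pin-cancel-< : ∀ i {x y} → pin i x < pin i y → x < y
pin-cancel-< zero    (s≤s x<y)           = x<y
pin-cancel-< (suc i) {zero}  {suc y} _   = z<s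
pin-cancel-< (suc i) {suc x} {suc y} (s≤s x<y) = s<s (pin-cancel-< i x<y)

<pin⇒≤ : ∀ {i x} → i < pin i x → i ≤ x
<pin⇒≤ {zero}          _         = z≤n
<pin⇒≤ {suc i} {suc x} (s≤s i<x) = s≤s (<pin⇒≤ i<x)

x≤pin : ∀ i x → x ≤ pin i x
x≤pin zero    x       = n≤1+n x
x≤pin (suc i) zero    = z≤n
x≤pin (suc i) (suc x) = s≤s (x≤pin i x)

pin≤suc : ∀ i x → pin i x ≤ suc x
pin≤suc zero    x       = ≤-refl
pin≤suc (suc i) zero    = z≤n
pin≤suc (suc i) (suc x) = s≤s (pin≤suc i x)

pin<suc⇒< : ∀ {i m x} → i ≤ m → pin i x < suc m → x < m
pin<suc⇒< {zero}          _         (s≤s x<m) = x<m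
pin<suc⇒< {suc i} {suc m} {zero}  _ _         = z<s
pin<suc⇒< {suc i} {suc m} {suc x} (s≤s i≤m) (s≤s l) = s<s (pin<suc⇒< i≤m l)

insAt : ℕ → A → (ℕ → A) → ℕ → A
insAt zero    a f zero    = a
insAt zero    a f (suc x) = f x
insAt (suc i) a f zero    = f 0
insAt (suc i) a f (suc x) = insAt i a (f ∘ suc) x

insAt-at : ∀ i {a : A} {f} → insAt i a f i ≡ a
insAt-at zero    = refl
insAt-at (suc i) = insAt-at i

insAt-pin : ∀ i x {a : A} {f} → insAt i a f (pin i x) ≡ f x
insAt-pin zero    x       = refl
insAt-pin (suc i) zero    = refl
insAt-pin (suc i) (suc x) = insAt-pin i x

insAt-< : ∀ {i x} {a : A} {f} → x < i → insAt i a f x ≡ f x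
insAt-< {i = i} {x} {a} {f} x<i = trans (cong (insAt i a f) (sym (pin-< x<i))) (insAt-pin i x)

insAt-> : ∀ {i x} {a : A} {f} → i ≤ x → insAt i a f (suc x) ≡ f x
insAt-> {i = i} {x} {a} {f} i≤x = trans (cong (insAt i a f) (sym (pin-≥ i≤x))) (insAt-pin i x)

Mat : Set
Mat = ℕ → ℕ → Bool

infix 4 _≗₂_
_≗₂_ : Mat → Mat → Set
P ≗₂ Q = ∀ x y → P x y ≡ Q x y

-- The inserted line runs through the whole unbounded matrix, so the operation does not have to know
-- the shape.
insRow : ℕ → ℕ → Mat → Mat
insRow i c P = insAt i (_≡ᵇ c) P

insCol : ℕ → ℕ → Mat → Mat
insCol c i P x = insAt c (x ≡ᵇ i) (P x)

insRow-at : ∀ i {c P} y → insRow i c P i y ≡ (y ≡ᵇ c)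
insRow-at i y = cong-app (insAt-at i) y

insRow-pin : ∀ i {c P} x y → insRow i c P (pin i x) y ≡ P x y
insRow-pin i x y = cong-app (insAt-pin i x) y

-- Transposition exchanges the two kinds of insertion. Through it, what is proved for rows about
-- parents and crossings carries over to columns.
insCol-flip : ∀ c i P → flip (insCol c i P) ≗₂ insRow c i (flip P)
insCol-flip c i P y x with pinView c y
... | at       = trans (insAt-at c) (sym (insRow-at c x))
... | pinned y = trans (insAt-pin c y) (sym (insRow-pin c y x))

Above Left : Mat → ℕ → ℕ → Set
Above P x y = ∃ λ x′ → x′ < x × P x′ y ≡ true
Left  P x y = ∃ λ y′ → y′ < y × P x y′ ≡ true

Parent : Mat → Set
Parent P = ∀ x y → P x y ≡ true → ¬ (x ≡ 0 × y ≡ 0) →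
  (Above P x y ⊎ Left P x y) × ¬ (Above P x y × Left P x y)

Above-resp : ∀ {P Q} → P ≗₂ Q → ∀ {x y} → Above P x y → Above Q x y
Above-resp P≗Q (x′ , x′<x , p) = x′ , x′<x , trans (sym (P≗Q _ _)) p

Left-resp : ∀ {P Q} → P ≗₂ Q → ∀ {x y} → Left P x y → Left Q x y
Left-resp P≗Q (y′ , y′<y , p) = y′ , y′<y , trans (sym (P≗Q _ _)) p

≗₂-sym : ∀ {P Q} → P ≗₂ Q → Q ≗₂ P
≗₂-sym P≗Q x y = sym (P≗Q x y)

Parent-resp : ∀ {P Q} → P ≗₂ Q → Parent P → Parent Q
Parent-resp P≗Q par x y q nr with par x y (trans (P≗Q x y) q) nr
... | one , notBoth =
  Sum.map (Above-resp P≗Q) (Left-resp P≗Q) one ,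
  λ (a , l) → notBoth (Above-resp (≗₂-sym P≗Q) a , Left-resp (≗₂-sym P≗Q) l)

Parent-flip : ∀ {P} → Parent P → Parent (flip P)
Parent-flip par y x p nr with par x y p (λ (a , b) → nr (b , a))
... | one , notBoth = Sum.swap one , λ (a , l) → notBoth (l , a)

-- The hypothesis is what a column provides when a row is inserted at its bottom edge: some point
-- above the new one. It stands in for all information about the shape.
module _ {P : Mat} {i c : ℕ} (new : Above P i c) where

  private P′ = insRow i c P

  0<row : 0 < i
  0<row = ≤-trans z<s (proj₁ (proj₂ new))

  Above-insRow : ∀ {x y} → Above P x y → Above P′ (pin i x) y
  Above-insRow (x′ , x′<x , p) = pin i x′ , pin-mono-< i x′<x , trans (insRow-pin i x′ _) p

  -- A pointed cell below the new point has, in its column, also the points above the new one.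
  Above-insRow⁻ : ∀ {x y} → Above P′ (pin i x) y → Above P x y
  Above-insRow⁻ (x′ , x′<x , p) with pinView i x′
  ... | pinned z = z , pin-cancel-< i x′<x , trans (sym (insRow-pin i z _)) p
  Above-insRow⁻ {y = y} (_ , i<x , p) | at with ≡ᵇ-true⇒≡ y c (trans (sym (insRow-at i y)) p)
  ... | refl = let z , z<i , q = new in z , <-≤-trans z<i (<pin⇒≤ i<x) , q

  Left-insRow : ∀ {x y} → Left P x y → Left P′ (pin i x) y
  Left-insRow (y′ , y′<y , p) = y′ , y′<y , trans (insRow-pin i _ y′) p

  Left-insRow⁻ : ∀ {x y} → Left P′ (pin i x) y → Left P x y
  Left-insRow⁻ (y′ , y′<y , p) = y′ , y′<y , trans (sym (insRow-pin i _ y′)) p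

  Above-new : Above P′ i c
  Above-new = let x , x<i , p = new in x , x<i , trans (cong-app (insAt-< x<i) c) p

  ¬Left-new : ∀ {y} → y ≤ c → ¬ Left P′ i y
  ¬Left-new y≤c (y′ , y′<y , p) = <⇒≢ (<-≤-trans y′<y y≤c) (≡ᵇ-true⇒≡ y′ c (trans (sym (insRow-at i y′)) p))

  root-insRow : ∀ y → P′ 0 y ≡ P 0 y
  root-insRow y = cong-app (insAt-< 0<row) y

  -- The new point has a point above it by `new` and none to its left, its row being otherwise
  -- empty. Every old cell has a point above, or to the left, exactly when it had one before.
  Parent-insRow : Parent P → Parent P′
  Parent-insRow par x y p nr with pinView i x
  ... | at with ≡ᵇ-true⇒≡ y c (trans (sym (insRow-at i y)) p)
  ...   | refl = inj₁ Above-new , ¬Left-new ≤-refl ∘ proj₂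
  Parent-insRow par _ y p nr | pinned x with par x y (trans (sym (insRow-pin i x y)) p)
                                               (λ { (refl , refl) → nr (pin-< 0<row , refl) })
  ... | one , notBoth = Sum.map Above-insRow Left-insRow one ,
                        λ (a , l) → notBoth (Above-insRow⁻ a , Left-insRow⁻ l)

  Parent-insRow⁻ : Parent P′ → Parent P
  Parent-insRow⁻ par x y p nr with par (pin i x) y (trans (insRow-pin i x y) p)
                                     (λ { (e , refl) → nr (n≤0⇒n≡0 (subst (x ≤_) e (x≤pin i x)) , refl) })
  ... | one , notBoth = Sum.map Above-insRow⁻ Left-insRow⁻ one ,
                        λ (a , l) → notBoth (Above-insRow a , Left-insRow l)

-- Crossings

-- Copied from `isCrossing`, with which it agrees by computation on `pt T`; the shape does not occur
-- in it.
cross : Mat → ℕ → ℕ → Bool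
cross P x y = not (P x y) ∧ any (λ x′ → P x′ y) (upTo x) ∧ any (λ y′ → P x y′) (upTo y)

any-applyUpTo⁻ : ∀ (p : A → Bool) f n → any p (applyUpTo f n) ≡ true → ∃ λ i → i < n × p (f i) ≡ true
any-applyUpTo⁻ p f (suc n) eq with p (f 0) in e
... | true  = 0 , z<s , e
... | false = let i , i<n , q = any-applyUpTo⁻ p (f ∘ suc) n eq in suc i , s<s i<n , q

any-applyUpTo⁺ : ∀ (p : A → Bool) f n i → i < n → p (f i) ≡ true → any p (applyUpTo f n) ≡ true
any-applyUpTo⁺ p f (suc n) zero    _         eq rewrite eq = refl
any-applyUpTo⁺ p f (suc n) (suc i) (s≤s i<n) eq with p (f 0)
... | true  = refl
... | false = any-applyUpTo⁺ p (f ∘ suc) n i i<n eq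

any-Above⁻ : ∀ P x y → any (λ x′ → P x′ y) (upTo x) ≡ true → Above P x y
any-Above⁻ P x y = any-applyUpTo⁻ _ id x

any-Above⁺ : ∀ P x y → Above P x y → any (λ x′ → P x′ y) (upTo x) ≡ true
any-Above⁺ P x y (x′ , x′<x , p) = any-applyUpTo⁺ (λ x′ → P x′ y) id x x′ x′<x p

any-Above-≡ : ∀ P Q {x y x′ y′} → (Above P x y → Above Q x′ y′) → (Above Q x′ y′ → Above P x y) →
  any (λ z → P z y) (upTo x) ≡ any (λ z → Q z y′) (upTo x′)
any-Above-≡ P Q f g = bool-ext (any-Above⁺ Q _ _ ∘ f ∘ any-Above⁻ P _ _) (any-Above⁺ P _ _ ∘ g ∘ any-Above⁻ Q _ _)

cross-≡ : ∀ P Q {x y x′ y′} → P x y ≡ Q x′ y′ →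
  (Above P x y → Above Q x′ y′) → (Above Q x′ y′ → Above P x y) →
  (Left P x y → Left Q x′ y′) → (Left Q x′ y′ → Left P x y) → cross P x y ≡ cross Q x′ y′
cross-≡ P Q e f g h k = cong₂ _∧_ (cong not e)
  (cong₂ _∧_ (any-Above-≡ P Q f g) (any-Above-≡ (flip P) (flip Q) h k))

cross-cong : ∀ {P Q} → P ≗₂ Q → cross P ≗₂ cross Q
cross-cong {P} {Q} e x y = cross-≡ P Q (e x y) (Above-resp e) (Above-resp (≗₂-sym e)) (Left-resp e) (Left-resp (≗₂-sym e))

cross-flip : ∀ P x y → cross (flip P) y x ≡ cross P x y
cross-flip P x y = cong (not (P x y) ∧_) (∧-comm (any (λ y′ → P x y′) (upTo y)) _)

cross-false : ∀ P {x y} → ¬ Left P x y → cross P x y ≡ false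
cross-false P {x} {y} ¬left with any (λ y′ → P x y′) (upTo y) in e
... | true  = contradiction (any-Above⁻ (flip P) y x e) ¬left
... | false = trans (cong (not (P x y) ∧_) (∧-zeroʳ _)) (∧-zeroʳ _)

cross-true : ∀ P {x y} → P x y ≡ false → Above P x y → Left P x y → cross P x y ≡ true
cross-true P {x} {y} e a l
  rewrite e | any-Above⁺ P x y a | any-Above⁺ (flip P) y x l = refl

-- Only column `c` gains a point, and the cells below that point already had a point above them by
-- `new`.
cross-insRow : ∀ {P i c} → Above P i c → ∀ x y → cross (insRow i c P) (pin i x) y ≡ cross P x y
cross-insRow {P} {i} {c} new x y = cross-≡ (insRow i c P) P (insRow-pin i x y)
  (Above-insRow⁻ new) (Above-insRow new) (Left-insRow⁻ new) (Left-insRow new)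

cross-insCol : ∀ {P i c} → Left P i c → ∀ x y → cross (insCol c i P) x (pin c y) ≡ cross P x y
cross-insCol {P} {i} {c} new x y = begin
  cross (insCol c i P) x (pin c y)        ≡⟨ cross-flip (insCol c i P) x (pin c y) ⟨
  cross (flip (insCol c i P)) (pin c y) x ≡⟨ cross-cong (insCol-flip c i P) (pin c y) x ⟩
  cross (insRow c i (flip P)) (pin c y) x ≡⟨ cross-insRow {flip P} new y x ⟩
  cross (flip P) y x                      ≡⟨ cross-flip P x y ⟩
  cross P x y                             ∎
  where open ≡-Reasoning

cross-insRow-new : ∀ {P i c} → Above P i c → ∀ {y} → y ≤ c → cross (insRow i c P) i y ≡ false
cross-insRow-new {P} {i} {c} new y≤c = cross-false (insRow i c P) (¬Left-new new y≤c)

cross-insCol-new : ∀ {P i c} → Left P i c → ∀ {x} → x ≤ i → cross (insCol c i P) x c ≡ false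
cross-insCol-new {P} {i} {c} new {x} x≤i = begin
  cross (insCol c i P) x c        ≡⟨ cross-flip (insCol c i P) x c ⟨
  cross (flip (insCol c i P)) c x ≡⟨ cross-cong (insCol-flip c i P) c x ⟩
  cross (insRow c i (flip P)) c x ≡⟨ cross-insRow-new {flip P} new x≤i ⟩
  false                           ∎
  where open ≡-Reasoning

-- Sums over the cells of a shape

sumV : Word → (ℕ → ℕ → ℕ) → ℕ
sumV v f = sumTo (nN v) λ x → sumTo (lenAt v x) (f x)

sumTo-pin : ∀ i m F → i ≤ m → sumTo (suc m) F ≡ F i + sumTo m (F ∘ pin i)
sumTo-pin zero    m       F _         = refl
sumTo-pin (suc i) (suc m) F (s≤s i≤m) = begin
  F 0 + sumTo (suc m) (F ∘ suc)                       ≡⟨ cong (F 0 +_) (sumTo-pin i m (F ∘ suc) i≤m) ⟩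
  F 0 + (F (suc i) + sumTo m (F ∘ suc ∘ pin i))       ≡⟨ x∙yz≈y∙xz (F 0) (F (suc i)) (sumTo m (F ∘ suc ∘ pin i)) ⟩
  F (suc i) + (F 0 + sumTo m (F ∘ suc ∘ pin i))       ∎
  where
  open ≡-Reasoning

sumTo-zero : ∀ n {f} → (∀ i → i < n → f i ≡ 0) → sumTo n f ≡ 0
sumTo-zero zero    _ = refl
sumTo-zero (suc n) z = cong₂ _+_ (z 0 z<s) (sumTo-zero n (λ i i<n → z (suc i) (s<s i<n)))

sumTo-indicator : ∀ n i → i < n → sumTo n (λ x → indicator (x ≡ᵇ i)) ≡ 1
sumTo-indicator (suc n) zero    _         = cong suc (sumTo-zero n (λ _ _ → refl))
sumTo-indicator (suc n) (suc i) (s≤s i<n) = sumTo-indicator n i i<n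

sumV-cong : ∀ v {f g} → (∀ x y → y < lenAt v x → f x y ≡ g x y) → sumV v f ≡ sumV v g
sumV-cong v e = sumTo-cong (nN v) (λ x _ → sumTo-cong (lenAt v x) (e x))

-- The two words bound shapes that differ in one corner cell, at row `nN p` and column `nE q`.
sumV-flip : ∀ p {q} f → sumV (p ++ N ∷ E ∷ q) f ≡ f (nN p) (nE q) + sumV (p ++ E ∷ N ∷ q) f
sumV-flip []      {q} f = trans (cong (_+ sumV q (f ∘ suc)) (sumTo-last (nE q) (f 0))) (+-assoc (f 0 (nE q)) _ _)
sumV-flip (E ∷ p) f = sumV-flip p f
sumV-flip (N ∷ p) {q} f rewrite nE-++ p {N ∷ E ∷ q} | nE-++ p {E ∷ N ∷ q} | sumV-flip p {q} (f ∘ suc) =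
  x∙yz≈y∙xz (sumTo (nE p + suc (nE q)) (f 0)) (f (suc (nN p)) (nE q)) (sumV (p ++ E ∷ N ∷ q) (f ∘ suc))

nN-insert : ∀ p q → nN (p ++ N ∷ E ∷ q) ≡ suc (nN (p ++ E ∷ q))
nN-insert p q rewrite nN-++ p {N ∷ E ∷ q} | nN-++ p {E ∷ q} = +-suc (nN p) (nN q)

nE-insert : ∀ p q → nE (p ++ N ∷ E ∷ q) ≡ suc (nE (p ++ N ∷ q))
nE-insert p q rewrite nE-++ p {N ∷ E ∷ q} | nE-++ p {N ∷ q} = +-suc (nE p) (nE q)

nE-insertE : ∀ p q → nE (p ++ N ∷ E ∷ q) ≡ nE (p ++ E ∷ q)
nE-insertE p q rewrite nE-++ p {N ∷ E ∷ q} | nE-++ p {E ∷ q} = refl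

nN-insertN : ∀ p q → nN (p ++ N ∷ E ∷ q) ≡ nN (p ++ N ∷ q)
nN-insertN p q rewrite nN-++ p {N ∷ E ∷ q} | nN-++ p {N ∷ q} = refl

nN≤ : ∀ p q → nN p ≤ nN (p ++ q)
nN≤ p q = subst (nN p ≤_) (sym (nN-++ p)) (m≤m+n (nN p) (nN q))

nE≤ : ∀ p q → nE q ≤ nE (p ++ q)
nE≤ p q = subst (nE q ≤_) (sym (nE-++ p)) (m≤n+m (nE q) (nE p))

lenAt-corner : ∀ p q → lenAt (p ++ N ∷ q) (nN p) ≡ nE q
lenAt-corner p q = lenAt-++ʳ₀ p

lenAt-insRow : ∀ p q x → lenAt (p ++ N ∷ E ∷ q) (pin (nN p) x) ≡ lenAt (p ++ E ∷ q) x
lenAt-insRow p q x with locate (nN p) x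
... | before x<i rewrite pin-< x<i = trans (lenAt-++ˡ p x x<i) (sym (lenAt-++ˡ p x x<i))
... | after k rewrite pin-≥ (m≤m+n (nN p) k) | sym (+-suc (nN p) k) =
  trans (lenAt-++ʳ p (suc k)) (sym (lenAt-++ʳ p k))

lenAt-insCol-≤ : ∀ p q {x} → x ≤ nN p → lenAt (p ++ N ∷ E ∷ q) x ≡ suc (lenAt (p ++ N ∷ q) x)
lenAt-insCol-≤ p q {x} x≤i with m≤n⇒m<n∨m≡n x≤i
... | inj₁ x<i = trans (lenAt-++ˡ p x x<i) (trans (+-suc _ (nE q)) (cong suc (sym (lenAt-++ˡ p x x<i))))
... | inj₂ refl = trans (lenAt-++ʳ₀ p) (cong suc (sym (lenAt-++ʳ₀ p)))

lenAt-insCol-> : ∀ p q k → lenAt (p ++ N ∷ E ∷ q) (nN p + suc k) ≡ lenAt (p ++ N ∷ q) (nN p + suc k)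
lenAt-insCol-> p q k = trans (lenAt-++ʳ p (suc k)) (sym (lenAt-++ʳ p (suc k)))

sumV-insRow : ∀ p q f → sumV (p ++ N ∷ E ∷ q) f ≡ sumTo (suc (nE q)) (f (nN p)) + sumV (p ++ E ∷ q) (f ∘ pin (nN p))
sumV-insRow p q f rewrite nN-insert p q =
  trans (sumTo-pin (nN p) (nN (p ++ E ∷ q)) (λ x → sumTo (lenAt (p ++ N ∷ E ∷ q) x) (f x)) (nN≤ p (E ∷ q)))
    (cong₂ _+_ (cong (λ l → sumTo l (f (nN p))) (lenAt-corner p (E ∷ q)))
      (sumTo-cong (nN (p ++ E ∷ q)) λ x _ → cong (λ l → sumTo l (f (pin (nN p) x))) (lenAt-insRow p q x)))

-- The new column meets the rows 0 to `nN p`. The rows below it are too short to reach column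
-- `nE q`, so `pin` is the identity on their cells.
sumV-insCol : ∀ p q f → sumV (p ++ N ∷ E ∷ q) f ≡
  sumTo (suc (nN p)) (λ x → f x (nE q)) + sumV (p ++ N ∷ q) (λ x → f x ∘ pin (nE q))
sumV-insCol [] q f = begin
  sumTo (suc c) (f 0) + sumV q (f ∘ suc)
    ≡⟨ cong₂ _+_ (sumTo-pin c c (f 0) ≤-refl)
         (sumV-cong q λ x y y<l → cong (f (suc x)) (sym (pin-< (<-≤-trans y<l (lenAt≤nE q x))))) ⟩
  (f 0 c + sumTo c (f 0 ∘ pin c)) + sumV q (λ x → f (suc x) ∘ pin c)
    ≡⟨ cong (λ z → z + sumTo c (f 0 ∘ pin c) + sumV q (λ x → f (suc x) ∘ pin c)) (+-identityʳ (f 0 c)) ⟨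
  (f 0 c + 0 + sumTo c (f 0 ∘ pin c)) + sumV q (λ x → f (suc x) ∘ pin c)
    ≡⟨ +-assoc (f 0 c + 0) _ _ ⟩
  (f 0 c + 0) + (sumTo c (f 0 ∘ pin c) + sumV q (λ x → f (suc x) ∘ pin c)) ∎
  where
  open ≡-Reasoning
  c = nE q
sumV-insCol (E ∷ p) q f = sumV-insCol p q f
sumV-insCol (N ∷ p) q f rewrite nE-insert p q = begin
  sumTo (suc l) (f 0) + sumV (p ++ N ∷ E ∷ q) (f ∘ suc)
    ≡⟨ cong₂ _+_ (sumTo-pin c l (f 0) (nE≤ p (N ∷ q))) (sumV-insCol p q (f ∘ suc)) ⟩
  (f 0 c + sumTo l (f 0 ∘ pin c)) + (sumTo (suc (nN p)) (λ x → f (suc x) c) + sumV (p ++ N ∷ q) (λ x → f (suc x) ∘ pin c))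
    ≡⟨ interchange (f 0 c) (sumTo l (f 0 ∘ pin c)) (sumTo (suc (nN p)) (λ x → f (suc x) c)) (sumV (p ++ N ∷ q) (λ x → f (suc x) ∘ pin c)) ⟩
  (f 0 c + sumTo (suc (nN p)) (λ x → f (suc x) c)) + (sumTo l (f 0 ∘ pin c) + sumV (p ++ N ∷ q) (λ x → f (suc x) ∘ pin c)) ∎
  where
  open ≡-Reasoning
  c = nE q
  l = nE (p ++ N ∷ q)

-- Tree-like tableaux as words with a matrix of points

-- The Ferrers condition is carried by the word: its row lengths decrease, and `rows` together with
-- `inside` makes them positive.
record TL (v : Word) (P : Mat) : Set where
  field
    inside : ∀ x y → P x y ≡ true → y < lenAt v x
    root   : P 0 0 ≡ true
    parent : Parent P
    rows   : ∀ x → x < nN v → ∃ λ y → P x y ≡ true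
    cols   : ∀ y → y < nE v → ∃ λ x → P x y ≡ true
open TL

TL-resp : ∀ {v P Q} → P ≗₂ Q → TL v P → TL v Q
TL-resp P≗Q t = record
  { inside = λ x y q → t .inside x y (trans (P≗Q x y) q)
  ; root   = trans (sym (P≗Q 0 0)) (t .root)
  ; parent = Parent-resp P≗Q (t .parent)
  ; rows   = λ x x<n → let y , p = t .rows x x<n in y , trans (sym (P≗Q x y)) p
  ; cols   = λ y y<n → let x , p = t .cols y y<n in x , trans (sym (P≗Q x y)) p
  }

outside : ∀ {v P} → TL v P → ∀ {x y} → lenAt v x ≤ y → P x y ≡ false
outside {P = P} t {x} {y} l with P x y in e
... | true  = contradiction (t .inside x y e) (≤⇒≯ l)
... | false = refl

-- The column contains a point, and only the `nN p` rows above the edge reach this column. In this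
-- way condition (3) supplies the hypothesis `new` of the insertion lemmas.
above-bottom : ∀ p {q P} → TL (p ++ E ∷ q) P → Above P (nN p) (nE q)
above-bottom p {q} t with t .cols (nE q) (nE≤ p (E ∷ q))
... | x , e with locate (nN p) x
...   | before x<i = x , x<i , e
...   | after k    = contradiction (≤-trans (t .inside _ _ e) (≤-trans (≤-reflexive (lenAt-++ʳ p k)) (lenAt≤nE q k))) 1+n≰n

left-end : ∀ p {q P} → TL (p ++ N ∷ q) P → Left P (nN p) (nE q)
left-end p {q} t with t .rows (nN p) (≤-trans (≤-reflexive (sym (+-comm (nN p) 1))) (subst (nN p + 1 ≤_) (sym (nN-++ p)) (+-monoʳ-≤ (nN p) (s≤s z≤n))))
... | y , e = y , subst (y <_) (lenAt-corner p q) (t .inside _ _ e) , e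

TL-insRow : ∀ p {q P} → TL (p ++ E ∷ q) P → TL (p ++ N ∷ E ∷ q) (insRow (nN p) (nE q) P)
TL-insRow p {q} {P} t = record
  { inside = inside′
  ; root   = trans (root-insRow new 0) (t .root)
  ; parent = Parent-insRow new (t .parent)
  ; rows   = rows′
  ; cols   = λ y y<n → let x , e = t .cols y (subst (y <_) (nE-insertE p q) y<n) in
                       pin (nN p) x , trans (insRow-pin (nN p) x y) e
  }
  where
  new = above-bottom p t
  inside′ : ∀ x y → insRow (nN p) (nE q) P x y ≡ true → y < lenAt (p ++ N ∷ E ∷ q) x
  inside′ x y e with pinView (nN p) x
  ... | at rewrite ≡ᵇ-true⇒≡ y (nE q) (trans (sym (insRow-at (nN p) y)) e) =
    ≤-reflexive (sym (lenAt-corner p (E ∷ q)))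
  ... | pinned x′ = subst (y <_) (sym (lenAt-insRow p q x′)) (t .inside x′ y (trans (sym (insRow-pin (nN p) x′ y)) e))
  rows′ : ∀ x → x < nN (p ++ N ∷ E ∷ q) → ∃ λ y → insRow (nN p) (nE q) P x y ≡ true
  rows′ x x<n with pinView (nN p) x
  ... | at = nE q , trans (insRow-at (nN p) (nE q)) (≡ᵇ-refl (nE q))
  ... | pinned x′ = let y , e = t .rows x′ (pin<suc⇒< (nN≤ p (E ∷ q)) (subst (pin (nN p) x′ <_) (nN-insert p q) x<n)) in
                    y , trans (insRow-pin (nN p) x′ y) e

TL-insCol : ∀ p {q P} → TL (p ++ N ∷ q) P → TL (p ++ N ∷ E ∷ q) (insCol (nE q) (nN p) P)
TL-insCol p {q} {P} t = record
  { inside = inside′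
  ; root   = trans (insAt-< (0<row {flip P} new)) (t .root)
  ; parent = Parent-resp (λ x y → sym (insCol-flip c i P y x)) (Parent-flip (Parent-insRow {flip P} new (Parent-flip (t .parent))))
  ; rows   = λ x x<n → let y , e = t .rows x (subst (x <_) (nN-insertN p q) x<n) in
                       pin c y , trans (insAt-pin c y) e
  ; cols   = cols′
  }
  where
  i = nN p
  c = nE q
  new = left-end p t
  inside′ : ∀ x y → insCol c i P x y ≡ true → y < lenAt (p ++ N ∷ E ∷ q) x
  inside′ x y e with pinView c y
  ... | at rewrite ≡ᵇ-true⇒≡ x i (trans (sym (insAt-at c)) e) = ≤-reflexive (sym (lenAt-corner p (E ∷ q)))
  ... | pinned z with t .inside x z (trans (sym (insAt-pin c z)) e) | locate (suc i) x
  ...   | z<l | before (s≤s x≤i) = subst (pin c z <_) (sym (lenAt-insCol-≤ p q x≤i)) (s≤s (≤-trans (pin≤suc c z) z<l))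
  ...   | z<l | after k rewrite sym (+-suc i k) | pin-< (<-≤-trans z<l (≤-trans (≤-reflexive (lenAt-++ʳ p {N ∷ q} (suc k))) (lenAt≤nE q k))) =
    subst (z <_) (sym (lenAt-insCol-> p q k)) z<l
  cols′ : ∀ y → y < nE (p ++ N ∷ E ∷ q) → ∃ λ x → insCol c i P x y ≡ true
  cols′ y y<n with pinView c y
  ... | at = i , trans (insAt-at c) (≡ᵇ-refl i)
  ... | pinned z = let x , e = t .cols z (pin<suc⇒< (nE≤ p (N ∷ q)) (subst (pin c z <_) (nE-insert p q) y<n)) in
                   x , trans (insAt-pin c z) e

crossings points : Word → Mat → ℕ
crossings v P = sumV v (λ x y → indicator (cross P x y))
points    v P = sumV v (λ x y → indicator (P x y))

-- An edge `E` receives a row and an edge `N` a column. In both cases the step is replaced by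
-- `N ∷ E` and the new point is the corner at row `i` and column `c`, which lets the two cases share
-- one word.
insPt : Step → ℕ → ℕ → Mat → Mat
insPt E i c P = insRow i c P
insPt N i c P = insCol c i P

TL-insPt : ∀ p e {q P} → TL (p ++ e ∷ q) P → TL (p ++ N ∷ E ∷ q) (insPt e (nN p) (nE q) P)
TL-insPt p E = TL-insRow p
TL-insPt p N = TL-insCol p

insPt-at : ∀ e i c {P} → insPt e i c P i c ≡ true
insPt-at E i c = trans (insRow-at i c) (≡ᵇ-refl c)
insPt-at N i c = trans (insAt-at c) (≡ᵇ-refl i)

-- A cell above the new point keeps its row. Its column is the number of `E` in the word after it,
-- which grows by one exactly when a column is inserted.
insPt-old : ∀ e t {i q P x} → x < i → insPt e i (nE q) P x (nE (t ++ N ∷ E ∷ q)) ≡ P x (nE (t ++ e ∷ q))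
insPt-old E t {q = q} {P} {x} x<i = trans (cong-app (insAt-< x<i) _) (cong (P x) (nE-insertE t q))
insPt-old N t {i} {q} {P} {x} x<i =
  trans (cong (insCol (nE q) i P x) (nE-insert t q)) (insAt-> (nE≤ t (N ∷ q)))

-- An inserted row has no point to the left of its last cell and an inserted column no point above
-- its lowest cell, so neither contains a crossing; old cells keep their status.
crossings-insPt : ∀ p e {q P} → TL (p ++ e ∷ q) P →
  crossings (p ++ N ∷ E ∷ q) (insPt e (nN p) (nE q) P) ≡ crossings (p ++ e ∷ q) P
crossings-insPt p E {q} {P} t = trans (sumV-insRow p q _) (cong₂ _+_
  (sumTo-zero (suc (nE q)) (λ y y≤c → cong indicator (cross-insRow-new new (s≤s⁻¹ y≤c))))
  (sumV-cong (p ++ E ∷ q) (λ x y _ → cong indicator (cross-insRow new x y))))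
  where new = above-bottom p t
crossings-insPt p N {q} {P} t = trans (sumV-insCol p q _) (cong₂ _+_
  (sumTo-zero (suc (nN p)) (λ x x≤i → cong indicator (cross-insCol-new {P} new (s≤s⁻¹ x≤i))))
  (sumV-cong (p ++ N ∷ q) (λ x y _ → cong indicator (cross-insCol {P} new x y))))
  where new = left-end p t

points-insPt : ∀ p e {q} P → points (p ++ N ∷ E ∷ q) (insPt e (nN p) (nE q) P) ≡ suc (points (p ++ e ∷ q) P)
points-insPt p E {q} P = trans (sumV-insRow p q _) (cong₂ _+_
  (trans (sumTo-cong (suc (nE q)) (λ y _ → cong indicator (insRow-at (nN p) {nE q} {P} y))) (sumTo-indicator (suc (nE q)) (nE q) ≤-refl))
  (sumV-cong (p ++ E ∷ q) (λ x y _ → cong indicator (insRow-pin (nN p) x y))))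
points-insPt p N {q} P = trans (sumV-insCol p q _) (cong₂ _+_
  (trans (sumTo-cong (suc (nN p)) (λ x _ → cong indicator (insAt-at (nE q) {x ≡ᵇ nN p} {P x}))) (sumTo-indicator (suc (nN p)) (nN p) ≤-refl))
  (sumV-cong (p ++ N ∷ q) (λ x y _ → cong indicator (insAt-pin (nE q) y))))

-- Deletion of a corner

-- The corner ends its row and has no point to its left, so it is the only point of the row.
-- Deleting the row leaves a point in the column of the corner because of the point above.
TL-delRow : ∀ p {q P} → TL (p ++ N ∷ E ∷ q) P → P (nN p) (nE q) ≡ true →
  Above P (nN p) (nE q) → ¬ Left P (nN p) (nE q) →
  P ≗₂ insRow (nN p) (nE q) (P ∘ pin (nN p)) × TL (p ++ E ∷ q) (P ∘ pin (nN p))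
TL-delRow p {q} {P} t hit above ¬left = P≗ , record
  { inside = λ x y e → subst (y <_) (lenAt-insRow p q x) (t .inside _ _ e)
  ; root   = trans (cong (λ x → P x 0) (pin-< (≤-trans z<s (proj₁ (proj₂ above))))) (t .root)
  ; parent = Parent-insRow⁻ above′ (Parent-resp P≗ (t .parent))
  ; rows   = λ x x<n → t .rows (pin i x) (subst (pin i x <_) (sym (nN-insert p q))
                                (<-≤-trans (pin-mono-< i x<n) (pin≤suc i _)))
  ; cols   = cols′
  }
  where
  i = nN p
  c = nE q
  row : ∀ y → P i y ≡ true → y ≡ c
  row y e with m<1+n⇒m<n∨m≡n (subst (y <_) (lenAt-corner p (E ∷ q)) (t .inside i y e))
  ... | inj₁ y<c = contradiction (y , y<c , e) ¬left
  ... | inj₂ y≡c = y≡c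
  P≗ : P ≗₂ insRow i c (P ∘ pin i)
  P≗ x y with pinView i x
  ... | pinned z = sym (insRow-pin i z y)
  ... | at = trans (bool-ext (λ e → trans (cong (_≡ᵇ c) (row y e)) (≡ᵇ-refl c))
                             (λ e → subst (λ z → P i z ≡ true) (sym (≡ᵇ-true⇒≡ y c e)) hit))
                   (sym (insRow-at i y))
  above′ : Above (P ∘ pin i) i c
  above′ = let x , x<i , e = above in x , x<i , trans (cong (λ z → P z c) (pin-< x<i)) e
  cols′ : ∀ y → y < nE (p ++ E ∷ q) → ∃ λ x → P (pin i x) y ≡ true
  cols′ y y<n with t .cols y (subst (y <_) (sym (nE-insertE p q)) y<n)
  ... | x , e with pinView i x
  ...   | pinned z = z , e
  ...   | at with refl ← row y e = let x , _ , e′ = above′ in x , e′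

TL-delCol : ∀ p {q P} → TL (p ++ N ∷ E ∷ q) P → P (nN p) (nE q) ≡ true →
  Left P (nN p) (nE q) → ¬ Above P (nN p) (nE q) →
  P ≗₂ insCol (nE q) (nN p) (λ x → P x ∘ pin (nE q)) × TL (p ++ N ∷ q) (λ x → P x ∘ pin (nE q))
TL-delCol p {q} {P} t hit left ¬above = P≗ , record
  { inside = inside′
  ; root   = trans (cong (P 0) (pin-< (≤-trans z<s (proj₁ (proj₂ left))))) (t .root)
  ; parent = Parent-flip (Parent-insRow⁻ {flip Q} left′ (Parent-resp (insCol-flip c i Q)
               (Parent-flip (Parent-resp P≗ (t .parent)))))
  ; rows   = rows′
  ; cols   = λ y y<n → t .cols (pin c y) (subst (pin c y <_) (sym (nE-insert p q))
                                (<-≤-trans (pin-mono-< c y<n) (pin≤suc c _)))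
  }
  where
  i = nN p
  c = nE q
  Q : Mat
  Q x = P x ∘ pin c
  col : ∀ x → P x c ≡ true → x ≡ i
  col x e with locate (suc i) x
  ... | after k = contradiction (≤-trans (t .inside _ c e)
                    (subst (λ z → lenAt (p ++ N ∷ E ∷ q) z ≤ c) (+-suc i k)
                      (≤-trans (≤-reflexive (lenAt-++ʳ p (suc k))) (lenAt≤nE q k)))) 1+n≰n
  ... | before x≤i with m<1+n⇒m<n∨m≡n x≤i
  ...   | inj₁ x<i = contradiction (x , x<i , e) ¬above
  ...   | inj₂ x≡i = x≡i
  P≗ : P ≗₂ insCol c i Q
  P≗ x y with pinView c y
  ... | pinned z = sym (insAt-pin c z)
  ... | at = trans (bool-ext (λ e → trans (cong (_≡ᵇ i) (col x e)) (≡ᵇ-refl i))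
                             (λ e → subst (λ z → P z c ≡ true) (sym (≡ᵇ-true⇒≡ x i e)) hit))
                   (sym (insAt-at c))
  left′ : Left Q i c
  left′ = let y , y<c , e = left in y , y<c , trans (cong (P i) (pin-< y<c)) e
  rows′ : ∀ x → x < nN (p ++ N ∷ q) → ∃ λ y → Q x y ≡ true
  rows′ x x<n with t .rows x (subst (x <_) (sym (nN-insertN p q)) x<n)
  ... | y , e with pinView c y
  ...   | pinned z = z , e
  ...   | at with refl ← col x e = let y , _ , e′ = left′ in y , e′
  inside′ : ∀ x y → Q x y ≡ true → y < lenAt (p ++ N ∷ q) x
  inside′ x y e with t .inside x (pin c y) e | locate (suc i) x
  ... | l | after k rewrite sym (+-suc i k) = ≤-<-trans (x≤pin c y) (subst (pin c y <_) (lenAt-insCol-> p q k) l)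
  ... | l | before (s≤s x≤i) = pin<suc⇒< c≤ (subst (pin c y <_) (lenAt-insCol-≤ p q x≤i) l)
    where
    c≤ : c ≤ lenAt (p ++ N ∷ q) x
    c≤ with m≤n⇒m<n∨m≡n x≤i
    ... | inj₁ x<i = subst (c ≤_) (sym (lenAt-++ˡ p x x<i)) (m≤n+m c _)
    ... | inj₂ refl = ≤-reflexive (sym (lenAt-++ʳ₀ p))

-- Adding and removing a ribbon

lenAt-flip : ∀ p q x → x ≢ nN p → lenAt (p ++ N ∷ E ∷ q) x ≡ lenAt (p ++ E ∷ N ∷ q) x
lenAt-flip p q x x≢i with locate (nN p) x
... | before x<i    = trans (lenAt-++ˡ p x x<i) (sym (lenAt-++ˡ p x x<i))
... | after zero    = contradiction (+-identityʳ (nN p)) x≢i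
... | after (suc k) = trans (lenAt-++ʳ p (suc k)) (sym (lenAt-++ʳ p (suc k)))

nN-flip : ∀ p q → nN (p ++ N ∷ E ∷ q) ≡ nN (p ++ E ∷ N ∷ q)
nN-flip p q = trans (nN-++ p) (sym (nN-++ p))

nE-flip : ∀ p q → nE (p ++ N ∷ E ∷ q) ≡ nE (p ++ E ∷ N ∷ q)
nE-flip p q = trans (nE-++ p) (sym (nE-++ p))

TL-flip : ∀ p {q P} → TL (p ++ E ∷ N ∷ q) P → TL (p ++ N ∷ E ∷ q) P
TL-flip p {q} t = record
  { inside = inside′
  ; root   = t .root
  ; parent = t .parent
  ; rows   = λ x x<n → t .rows x (subst (x <_) (nN-flip p q) x<n)
  ; cols   = λ y y<n → t .cols y (subst (y <_) (nE-flip p q) y<n)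
  }
  where
  inside′ : ∀ x y → _ → _
  inside′ x y e with x ≟ nN p
  ... | no x≢i = subst (y <_) (sym (lenAt-flip p q x x≢i)) (t .inside x y e)
  ... | yes refl = subst (y <_) (sym (lenAt-++ʳ₀ p)) (m≤n⇒m≤1+n (subst (y <_) (lenAt-++ʳ₀ p) (t .inside x y e)))

TL-unflip : ∀ p {q P} → P (nN p) (nE q) ≡ false → TL (p ++ N ∷ E ∷ q) P → TL (p ++ E ∷ N ∷ q) P
TL-unflip p {q} {P} empty t = record
  { inside = inside′
  ; root   = t .root
  ; parent = t .parent
  ; rows   = λ x x<n → t .rows x (subst (x <_) (sym (nN-flip p q)) x<n)
  ; cols   = λ y y<n → t .cols y (subst (y <_) (sym (nE-flip p q)) y<n)
  }
  where
  inside′ : ∀ x y → P x y ≡ true → y < lenAt (p ++ E ∷ N ∷ q) x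
  inside′ x y e with x ≟ nN p
  ... | no x≢i = subst (y <_) (lenAt-flip p q x x≢i) (t .inside x y e)
  ... | yes refl with m<1+n⇒m<n∨m≡n (subst (y <_) (lenAt-++ʳ₀ p) (t .inside x y e))
  ...   | inj₁ y<c  = subst (y <_) (sym (lenAt-++ʳ₀ p)) y<c
  ...   | inj₂ refl = ⊥-elim (true≢false e empty)

-- The column of the added cell has a point above it and its row a point to its left, since every
-- row and column of the smaller tableau contains a point. The other cells keep their status because
-- the matrix is unchanged.
crossings-flip : ∀ p {q P} → P (nN p) (nE q) ≡ false → TL (p ++ E ∷ N ∷ q) P →
  crossings (p ++ N ∷ E ∷ q) P ≡ suc (crossings (p ++ E ∷ N ∷ q) P)
crossings-flip p {q} {P} empty t = trans (sumV-flip p _) (cong (λ b → indicator b + crossings (p ++ E ∷ N ∷ q) P)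
  (cross-true P empty (above-bottom p t) left))
  where
  left : Left P (nN p) (nE q)
  left = let y , e = t .rows (nN p) (subst (nN p <_) (sym (nN-++ p)) (m<m+n (nN p) z<s)) in
         y , subst (y <_) (lenAt-++ʳ₀ p) (t .inside _ y e) , e

points-flip : ∀ p {q P} → P (nN p) (nE q) ≡ false → points (p ++ N ∷ E ∷ q) P ≡ points (p ++ E ∷ N ∷ q) P
points-flip p {q} {P} empty = trans (sumV-flip p _) (cong (λ b → indicator b + points (p ++ E ∷ N ∷ q) P) empty)

-- `Flips P k v w`: w arises from v by adding k unpointed cells one by one, each at an inner corner of the border.
data Flips (P : Mat) : ℕ → Word → Word → Set where
  done       : ∀ {v} → Flips P 0 v v
  flip-first : ∀ {k p q w} → P (nN p) (nE q) ≡ false → Flips P k (p ++ N ∷ E ∷ q) w → Flips P (suc k) (p ++ E ∷ N ∷ q) w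
  flip-last  : ∀ {k v p q} → P (nN p) (nE q) ≡ false → Flips P k v (p ++ E ∷ N ∷ q) → Flips P (suc k) v (p ++ N ∷ E ∷ q)

Flips-N : ∀ {P k v w} → Flips (P ∘ suc) k v w → Flips P k (N ∷ v) (N ∷ w)
Flips-N done                       = done
Flips-N (flip-first {p = p} e f)   = flip-first {p = N ∷ p} e (Flips-N f)
Flips-N (flip-last {p = p} e f)    = flip-last {p = N ∷ p} e (Flips-N f)

Flips-E : ∀ {P k v w} → Flips P k v w → Flips P k (E ∷ v) (E ∷ w)
Flips-E done                       = done
Flips-E (flip-first {p = p} e f)   = flip-first {p = E ∷ p} e (Flips-E f)
Flips-E (flip-last {p = p} e f)    = flip-last {p = E ∷ p} e (Flips-E f)

-- A prefix moves the remaining rows down but not their columns, which are counted by what follows.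
Flips-++ : ∀ b {P k v w} → Flips (P ∘ (nN b +_)) k v w → Flips P k (b ++ v) (b ++ w)
Flips-++ []      f = f
Flips-++ (N ∷ b) f = Flips-N (Flips-++ b f)
Flips-++ (E ∷ b) f = Flips-E (Flips-++ b f)

TL-Flips : ∀ {P k v w} → Flips P k v w → TL v P → TL w P
TL-Flips done                     t = t
TL-Flips (flip-first {p = p} _ f) t = TL-Flips f (TL-flip p t)
TL-Flips (flip-last {p = p} _ f)  t = TL-flip p (TL-Flips f t)

TL-Flips⁻ : ∀ {P k v w} → Flips P k v w → TL w P → TL v P
TL-Flips⁻ done                     t = t
TL-Flips⁻ (flip-first {p = p} e f) t = TL-unflip p e (TL-Flips⁻ f t)
TL-Flips⁻ (flip-last {p = p} e f)  t = TL-Flips⁻ f (TL-unflip p e t)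

crossings-Flips : ∀ {P k v w} → Flips P k v w → TL v P → crossings w P ≡ k + crossings v P
crossings-Flips done t = refl
crossings-Flips {k = suc k} (flip-first {p = p} e f) t =
  trans (crossings-Flips f (TL-flip p t)) (trans (cong (k +_) (crossings-flip p e t)) (+-suc k _))
crossings-Flips (flip-last {p = p} e f)  t = trans (crossings-flip p e (TL-Flips f t)) (cong suc (crossings-Flips f t))

points-Flips : ∀ {P k v w} → Flips P k v w → points w P ≡ points v P
points-Flips done = refl
points-Flips (flip-first {p = p} e f) = trans (points-Flips f) (points-flip p e)
points-Flips (flip-last {p = p} e f)  = trans (points-flip p e) (points-Flips f)

-- The cells between the borders E u N w and N u E w: at the bottoms of the columns of N u E,
-- and to the right of the rows of E u.
record EmptyRibbon (P : Mat) (u w : Word) : Set where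
  field
    columns : ∀ p q → u ≡ p ++ E ∷ q → P (nN p) (nE (q ++ E ∷ w)) ≡ false
    end     : P (nN u) (nE w) ≡ false
    rightOf : ∀ p q → u ≡ p ++ N ∷ q → P (nN p) (nE (q ++ N ∷ w)) ≡ false
open EmptyRibbon

EmptyRibbon-N : ∀ {P u w} → EmptyRibbon P (N ∷ u) w → EmptyRibbon (P ∘ suc) u w
EmptyRibbon-N r = record
  { columns = λ p q e → r .columns (N ∷ p) q (cong (N ∷_) e)
  ; end     = r .end
  ; rightOf = λ p q e → r .rightOf (N ∷ p) q (cong (N ∷_) e)
  }

EmptyRibbon-E : ∀ {P u w} → EmptyRibbon P (E ∷ u) w → EmptyRibbon P u w
EmptyRibbon-E r = record
  { columns = λ p q e → r .columns (E ∷ p) q (cong (E ∷_) e)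
  ; end     = r .end
  ; rightOf = λ p q e → r .rightOf (E ∷ p) q (cong (E ∷_) e)
  }

-- Every intermediate shape must be a Ferrers diagram. If `u` starts with `N`, the first cell of the
-- ribbon has to precede the others; if it starts with `E`, it has to follow them. Hence `Flips`
-- grows at both ends.
ribbon-Flips : ∀ u {w P} → EmptyRibbon P u w → Flips P (suc (length u)) (E ∷ u ++ N ∷ w) (N ∷ u ++ E ∷ w)
ribbon-Flips []      r = flip-last {p = []} (r .end) done
ribbon-Flips (N ∷ u) r = flip-first {p = []} (r .rightOf [] u refl) (Flips-N (ribbon-Flips u (EmptyRibbon-N r)))
ribbon-Flips (E ∷ u) r = flip-last {p = []} (r .columns [] u refl) (Flips-E (ribbon-Flips u (EmptyRibbon-E r)))

-- The cells of the ribbon lie beyond the border of the tableau to which it is added, where there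
-- are no points.
outside-ribbon : ∀ b u {w P} → TL (b ++ E ∷ u ++ N ∷ w) P → EmptyRibbon (P ∘ (nN b +_)) u w
outside-ribbon b u {w} {P} t = record
  { columns = λ p q e → outside t (subst (λ z → lenAt (b ++ E ∷ z ++ N ∷ w) (nN b + nN p) ≤ nE (q ++ E ∷ w)) (sym e) (columns′ p q))
  ; end     = outside t (≤-reflexive (trans (lenAt-++ʳ b (nN u)) (lenAt-++ʳ₀ u)))
  ; rightOf = λ p q e → outside t (subst (λ z → lenAt (b ++ E ∷ z ++ N ∷ w) (nN b + nN p) ≤ nE (q ++ N ∷ w)) (sym e) (rightOf′ p q))
  }
  where
  open ≤-Reasoning
  columns′ : ∀ p q → lenAt (b ++ E ∷ (p ++ E ∷ q) ++ N ∷ w) (nN b + nN p) ≤ nE (q ++ E ∷ w)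
  columns′ p q = begin
    lenAt (b ++ E ∷ (p ++ E ∷ q) ++ N ∷ w) (nN b + nN p) ≡⟨ lenAt-++ʳ b (nN p) ⟩
    lenAt ((p ++ E ∷ q) ++ N ∷ w) (nN p) ≡⟨ cong (λ z → lenAt z (nN p)) (++-assoc p (E ∷ q) (N ∷ w)) ⟩
    lenAt (p ++ E ∷ q ++ N ∷ w) (nN p)   ≡⟨ lenAt-++ʳ₀ p ⟩
    lenAt (q ++ N ∷ w) 0                 ≤⟨ lenAt≤nE (q ++ N ∷ w) 0 ⟩
    nE (q ++ N ∷ w)                      ≡⟨ nE-++ q ⟩
    nE q + nE w                          ≤⟨ +-monoʳ-≤ (nE q) (n≤1+n (nE w)) ⟩
    nE q + suc (nE w)                    ≡⟨ nE-++ q ⟨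
    nE (q ++ E ∷ w)                      ∎
  rightOf′ : ∀ p q → lenAt (b ++ E ∷ (p ++ N ∷ q) ++ N ∷ w) (nN b + nN p) ≤ nE (q ++ N ∷ w)
  rightOf′ p q = begin
    lenAt (b ++ E ∷ (p ++ N ∷ q) ++ N ∷ w) (nN b + nN p) ≡⟨ lenAt-++ʳ b (nN p) ⟩
    lenAt ((p ++ N ∷ q) ++ N ∷ w) (nN p) ≡⟨ cong (λ z → lenAt z (nN p)) (++-assoc p (N ∷ q) (N ∷ w)) ⟩
    lenAt (p ++ N ∷ q ++ N ∷ w) (nN p)   ≡⟨ lenAt-++ʳ₀ p ⟩
    nE (q ++ N ∷ w)                      ∎

-- The special point and the insertion

-- Row `nN p ∸ 1` holds the lowest cell of the column; by `bottom-row` the subtraction is never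
-- truncated in a tableau.
NoHit : Mat → Word → Word → Set
NoHit P b w = ∀ p q → b ≡ p ++ E ∷ q → P (nN p ∸ 1) (nE (q ++ w)) ≡ false

-- In the word b E w, the step E is the bottom edge of the special point.
record Special (P : Mat) (b w : Word) : Set where
  constructor special
  field
    hit   : P (nN b ∸ 1) (nE w) ≡ true
    noHit : NoHit P b (E ∷ w)
open Special

-- `NoHit` inspects only the columns of `p`, so `plain` also covers the insertion at the bottom edge
-- of the special cell itself, where the ribbon is empty.
data Insertion : Word → Mat → ℕ → Word → Mat → Set where
  plain  : ∀ {P} p e q → NoHit P p (e ∷ q) →
    Insertion (p ++ e ∷ q) P (length q) (p ++ N ∷ E ∷ q) (insPt e (nN p) (nE q) P)
  ribbon : ∀ {P} b u e q → Special P b (u ++ e ∷ q) →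
    Insertion (b ++ E ∷ u ++ e ∷ q) P (length q) (b ++ N ∷ u ++ E ∷ E ∷ q) (insPt e (nN (b ++ E ∷ u)) (nE q) P)

++-split : ∀ (b : List A) {r} s {x t} → b ++ r ≡ s ++ x ∷ t →
  (∃ λ t′ → b ≡ s ++ x ∷ t′ × t ≡ t′ ++ r) ⊎ (∃ λ s′ → s ≡ b ++ s′ × r ≡ s′ ++ x ∷ t)
++-split []      s       e = inj₂ (s , refl , e)
++-split (y ∷ b) []      e with refl , refl ← ∷-injective e = inj₁ (b , refl , refl)
++-split (y ∷ b) (z ∷ s) e with refl , e′ ← ∷-injective e with ++-split b s e′
... | inj₁ (t′ , refl , e₂) = inj₁ (t′ , refl , e₂)
... | inj₂ (s′ , refl , e₂) = inj₂ (s′ , refl , e₂)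

TL-insPt-++ : ∀ b u e {q P} → TL (b ++ E ∷ u ++ e ∷ q) P →
  TL (b ++ E ∷ u ++ N ∷ E ∷ q) (insPt e (nN (b ++ E ∷ u)) (nE q) P)
TL-insPt-++ b u e {q} {P} t = subst (λ v → TL v (insPt e (nN (b ++ E ∷ u)) (nE q) P)) (++-assoc b (E ∷ u) (N ∷ E ∷ q))
  (TL-insPt (b ++ E ∷ u) e (subst (λ v → TL v P) (sym (++-assoc b (E ∷ u) (e ∷ q))) t))

insertion-ribbon : ∀ b u e {q P} → TL (b ++ E ∷ u ++ e ∷ q) P →
  Flips (insPt e (nN (b ++ E ∷ u)) (nE q) P) (suc (length u)) (b ++ E ∷ u ++ N ∷ E ∷ q) (b ++ N ∷ u ++ E ∷ E ∷ q)
insertion-ribbon b u e t = Flips-++ b (ribbon-Flips u (outside-ribbon b u (TL-insPt-++ b u e t)))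

TL-Insertion : ∀ {v P j w Q} → Insertion v P j w Q → TL v P → TL w Q
TL-Insertion (plain p e q _)    t = TL-insPt p e t
TL-Insertion (ribbon b u e q _) t = TL-Flips (insertion-ribbon b u e t) (TL-insPt-++ b u e t)

bottom-row : ∀ b {w P} → TL (b ++ E ∷ w) P → nN b ∸ 1 < nN b
bottom-row b t with nN b | above-bottom b t
... | suc n | _ = ≤-refl

NoHit-insPt : ∀ p e {q P} → TL (p ++ e ∷ q) P → NoHit P p (e ∷ q) → NoHit (insPt e (nN p) (nE q) P) p (N ∷ E ∷ q)
NoHit-insPt p e {q} {P} t nh s t′ refl =
  trans (insPt-old e t′ (<-≤-trans (bottom-row s (subst (λ v → TL v P) (++-assoc s (E ∷ t′) (e ∷ q)) t)) (nN≤ s (E ∷ t′))))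
        (nh s t′ refl)

nN-∷ʳN : ∀ p → nN (p ++ N ∷ []) ≡ suc (nN p)
nN-∷ʳN p = trans (nN-++ p) (+-comm (nN p) 1)

Special-plain : ∀ p e {q P} → TL (p ++ e ∷ q) P → NoHit P p (e ∷ q) →
  Special (insPt e (nN p) (nE q) P) (p ++ N ∷ []) q
Special-plain p e {q} {P} t nh =
  special (trans (cong (λ x → Q (x ∸ 1) (nE q)) (nN-∷ʳN p)) (insPt-at e (nN p) (nE q))) noHit′
  where
  Q = insPt e (nN p) (nE q) P
  noHit′ : NoHit Q (p ++ N ∷ []) (E ∷ q)
  noHit′ s r eq with ++-split p s eq
  ... | inj₁ (r′ , p≡ , refl) = trans (cong (λ z → Q (nN s ∸ 1) (nE z)) (++-assoc r′ (N ∷ []) (E ∷ q)))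
                                      (NoHit-insPt p e t nh s r′ p≡)
  ... | inj₂ ([]     , _ , ())
  ... | inj₂ (_ ∷ [] , _ , ())
  ... | inj₂ (_ ∷ _ ∷ _ , _ , ())
-- The columns Northeast of the new point are of three kinds: those of `b`, whose bottoms had no
-- point already; those of `u`, which now end in a ribbon cell; and the last `E`, the ribbon cell
-- right of the new point.
Special-ribbon : ∀ b u e {q P} → TL (b ++ E ∷ u ++ e ∷ q) P → Special P b (u ++ e ∷ q) →
  Special (insPt e (nN (b ++ E ∷ u)) (nE q) P) (b ++ N ∷ u ++ E ∷ []) q
Special-ribbon b u e {q} {P} t sp =
  special (trans (cong (λ x → Q x (nE q)) row) (insPt-at e (nN (b ++ E ∷ u)) (nE q))) noHit′
  where
  Q = insPt e (nN (b ++ E ∷ u)) (nE q) P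
  rib = outside-ribbon b u (TL-insPt-++ b u e t)
  row : nN (b ++ N ∷ u ++ E ∷ []) ∸ 1 ≡ nN (b ++ E ∷ u)
  row rewrite nN-++ b {N ∷ u ++ E ∷ []} | nN-++ u {E ∷ []} | +-identityʳ (nN u) | nN-++ b {E ∷ u} | +-suc (nN b) (nN u) = refl
  noHit′ : NoHit Q (b ++ N ∷ u ++ E ∷ []) (E ∷ q)
  noHit′ s r eq with ++-split b s eq
  ... | inj₁ (r′ , refl , refl) = trans (cong (Q (nN s ∸ 1)) columns≡)
          (trans (insPt-old e (r′ ++ E ∷ u) s-row) (trans (cong (λ z → P (nN s ∸ 1) (nE z)) (++-assoc r′ (E ∷ u) (e ∷ q))) (sp .noHit s r′ refl)))
    where
    s-row : nN s ∸ 1 < nN (b ++ E ∷ u)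
    s-row = <-≤-trans (bottom-row s (subst (λ v → TL v P) (++-assoc s (E ∷ r′) _) t))
                      (≤-trans (nN≤ s (E ∷ r′)) (nN≤ b (E ∷ u)))
    columns≡ : nE ((r′ ++ N ∷ u ++ E ∷ []) ++ E ∷ q) ≡ nE ((r′ ++ E ∷ u) ++ N ∷ E ∷ q)
    columns≡ rewrite nE-++ (r′ ++ N ∷ u ++ E ∷ []) {E ∷ q} | nE-++ r′ {N ∷ u ++ E ∷ []} | nE-++ u {E ∷ []}
                   | nE-++ (r′ ++ E ∷ u) {N ∷ E ∷ q} | nE-++ r′ {E ∷ u} | +-comm (nE u) 1 = refl
  ... | inj₂ ([] , _ , ())
  ... | inj₂ (E ∷ _ , _ , ())
  ... | inj₂ (N ∷ s′ , refl , eq′) with ++-split u s′ (∷-injectiveʳ eq′)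
  ...   | inj₁ (r′ , u≡ , refl) = trans (cong₂ Q (row′ s′) (cong nE (++-assoc r′ (E ∷ []) (E ∷ q)))) (rib .columns s′ r′ u≡)
    where
    row′ : ∀ s′ → nN (b ++ N ∷ s′) ∸ 1 ≡ nN b + nN s′
    row′ s′ rewrite nN-++ b {N ∷ s′} | +-suc (nN b) (nN s′) = refl
  ...   | inj₂ ([] , refl , refl) = trans (cong (λ x → Q x (suc (nE q))) row′) (rib .end)
    where
    row′ : nN (b ++ N ∷ u ++ []) ∸ 1 ≡ nN b + nN u
    row′ rewrite ++-identityʳ u | nN-++ b {N ∷ u} | +-suc (nN b) (nN u) = refl
  ...   | inj₂ (_ ∷ [] , _ , ())
  ...   | inj₂ (_ ∷ _ ∷ _ , _ , ())

ribbon-word : ∀ b u q → b ++ N ∷ u ++ E ∷ E ∷ q ≡ (b ++ N ∷ u ++ E ∷ []) ++ E ∷ q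
ribbon-word b u q = trans (cong (λ z → b ++ N ∷ z) (sym (++-assoc u (E ∷ []) (E ∷ q)))) (sym (++-assoc b _ (E ∷ q)))

Special-Insertion : ∀ {v P j w Q} → Insertion v P j w Q → TL v P →
  ∃₂ λ b q → w ≡ b ++ E ∷ q × length q ≡ j × Special Q b q
Special-Insertion (plain p e q nh) t =
  p ++ N ∷ [] , q , sym (++-assoc p (N ∷ []) (E ∷ q)) , refl , Special-plain p e t nh
Special-Insertion (ribbon b u e q sp) t =
  b ++ N ∷ u ++ E ∷ [] , q , ribbon-word b u q , refl , Special-ribbon b u e t sp

points-Insertion : ∀ {v P j w Q} → Insertion v P j w Q → TL v P → points w Q ≡ suc (points v P)
points-Insertion {P = P} (plain p e q _) t = points-insPt p e P
points-Insertion {P = P} (ribbon b u e q _) t = trans (points-Flips (insertion-ribbon b u e t))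
  (trans (cong (λ v → points v Q) (sym (++-assoc b (E ∷ u) (N ∷ E ∷ q))))
    (trans (points-insPt (b ++ E ∷ u) e P) (cong (λ v → suc (points v P)) (++-assoc b (E ∷ u) (e ∷ q)))))
  where Q = insPt e (nN (b ++ E ∷ u)) (nE q) P

length-Insertion : ∀ {v P j w Q} → Insertion v P j w Q → length w ≡ suc (length v)
length-Insertion (plain p e q _) rewrite length-++ p {N ∷ E ∷ q} | length-++ p {e ∷ q} = +-suc (length p) _
length-Insertion (ribbon b u e q _)
  rewrite length-++ b {N ∷ u ++ E ∷ E ∷ q} | length-++ b {E ∷ u ++ e ∷ q} | length-++ u {E ∷ E ∷ q} | length-++ u {e ∷ q}
        | +-suc (length u) (suc (length q)) = +-suc (length b) _

Special-unique : ∀ {P b w b′ w′} → Special P b w → Special P b′ w′ → b ++ E ∷ w ≡ b′ ++ E ∷ w′ → b ≡ b′ × w ≡ w′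
Special-unique {b = b} {w} {b′} {w′} s s′ eq with ++-split b b′ eq
... | inj₁ (t , refl , refl) = ⊥-elim (true≢false (s′ .hit) (s .noHit b′ t refl))
... | inj₂ ([] , refl , refl) = sym (++-identityʳ b) , refl
... | inj₂ (_ ∷ t , refl , refl) = ⊥-elim (true≢false (s .hit) (s′ .noHit b t refl))

-- The index of the special point is s = |w|; a ribbon has s - j cells.
crossings-Insertion : ∀ {v P j w Q b r} → Insertion v P j w Q → TL v P → v ≡ b ++ E ∷ r → Special P b r →
  crossings w Q ≡ (length r ∸ j) + crossings v P
crossings-Insertion {P = P} {b = b} {r} (plain p e q nh) t eq sp =
  trans (crossings-insPt p e t) (cong (_+ crossings (p ++ e ∷ q) P) (sym (m≤n⇒m∸n≡0 r≤q)))
  where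
  r≤q : length r ≤ length q
  -- By `NoHit` the special edge is not in `p`, so it is `e` or lies in `q`, and the truncated
  -- difference is 0.
  r≤q with ++-split p b eq
  ... | inj₁ (t′ , refl , refl) = ⊥-elim (true≢false (sp .hit) (nh b t′ refl))
  ... | inj₂ ([] , refl , e₂) = ≤-reflexive (cong length (sym (∷-injectiveʳ e₂)))
  ... | inj₂ (_ ∷ s , refl , e₂) = ≤-trans (≤-trans (n≤1+n _) (length-++-≤ʳ (E ∷ r) {s})) (≤-reflexive (cong length (sym (∷-injectiveʳ e₂))))
crossings-Insertion {P = P} {r = r} (ribbon b u e q sp′) t eq sp
  with refl , refl ← Special-unique sp′ sp eq = begin
  crossings (b ++ N ∷ u ++ E ∷ E ∷ q) Q
    ≡⟨ crossings-Flips (insertion-ribbon b u e t) (TL-insPt-++ b u e t) ⟩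
  suc (length u) + crossings (b ++ E ∷ u ++ N ∷ E ∷ q) Q
    ≡⟨ cong₂ _+_ len (cong (λ v → crossings v Q) (sym (++-assoc b (E ∷ u) (N ∷ E ∷ q)))) ⟩
  (length (u ++ e ∷ q) ∸ length q) + crossings ((b ++ E ∷ u) ++ N ∷ E ∷ q) Q
    ≡⟨ cong ((length (u ++ e ∷ q) ∸ length q) +_) (trans
         (crossings-insPt (b ++ E ∷ u) e (subst (λ v → TL v P) (sym (++-assoc b (E ∷ u) (e ∷ q))) t))
         (cong (λ v → crossings v P) (++-assoc b (E ∷ u) (e ∷ q)))) ⟩
  (length (u ++ e ∷ q) ∸ length q) + crossings (b ++ E ∷ u ++ e ∷ q) P ∎
  where
  open ≡-Reasoning
  Q = insPt e (nN (b ++ E ∷ u)) (nE q) P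
  len : suc (length u) ≡ length (u ++ e ∷ q) ∸ length q
  len rewrite length-++ u {e ∷ q} | +-suc (length u) (length q) = sym (m+n∸n≡m (suc (length u)) (length q))

-- Injectivity of the insertion

Special-resp : ∀ {P Q b w} → P ≗₂ Q → Special P b w → Special Q b w
Special-resp e sp = special (trans (sym (e _ _)) (sp .hit)) (λ p q eq → trans (sym (e _ _)) (sp .noHit p q eq))

insRow-injective : ∀ i c {P P′} → insRow i c P ≗₂ insRow i c P′ → P ≗₂ P′
insRow-injective i c {P} {P′} e x y =
  trans (sym (insRow-pin i {c} {P} x y)) (trans (e (pin i x) y) (insRow-pin i {c} {P′} x y))

insCol-injective : ∀ i c {P P′} → insCol c i P ≗₂ insCol c i P′ → P ≗₂ P′
insCol-injective i c {P} {P′} e x y =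
  trans (sym (insAt-pin c y {x ≡ᵇ i} {P x})) (trans (e x (pin c y)) (insAt-pin c y {x ≡ᵇ i} {P′ x}))

-- The new point of a row insertion has a point above it; that of a column insertion has none.
¬insRow≗insCol : ∀ {i c P P′} → Above P i c → Left P′ i c → ¬ (insRow i c P ≗₂ insCol c i P′)
¬insRow≗insCol {i} {c} {P} {P′} above left e =
  ¬Left-new {flip P′} left ≤-refl
    (Above-resp (λ x y → trans (e x y) (insCol-flip c i P′ y x)) (Above-new {P} above))

insPt-injective : ∀ p e p′ e′ {q P P′} → nN p ≡ nN p′ → TL (p ++ e ∷ q) P → TL (p′ ++ e′ ∷ q) P′ →
  insPt e (nN p) (nE q) P ≗₂ insPt e′ (nN p′) (nE q) P′ → e ≡ e′ × P ≗₂ P′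
insPt-injective p E p′ E {q} i≡ t t′ eq rewrite i≡ = refl , insRow-injective (nN p′) (nE q) eq
insPt-injective p N p′ N {q} i≡ t t′ eq rewrite i≡ = refl , insCol-injective (nN p′) (nE q) eq
insPt-injective p E p′ N {q} {P} {P′} i≡ t t′ eq =
  contradiction (subst (λ i → insRow i (nE q) P ≗₂ _) i≡ eq)
    (¬insRow≗insCol (subst (λ i → Above P i (nE q)) i≡ (above-bottom p t)) (left-end p′ t′))
insPt-injective p N p′ E {q} {P} {P′} i≡ t t′ eq =
  contradiction (≗₂-sym (subst (λ i → insCol (nE q) i P ≗₂ _) i≡ eq))
    (¬insRow≗insCol (above-bottom p′ t′) (subst (λ i → Left P i (nE q)) i≡ (left-end p t)))

-- A ribbon ends at the first place, seen from the new point, where it can.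
ribbon-end : ∀ b u₁ u₂ e {q P} → TL (b ++ E ∷ (u₁ ++ N ∷ u₂) ++ e ∷ q) P →
  ¬ Special P (b ++ N ∷ u₁) (u₂ ++ e ∷ q)
ribbon-end b u₁ u₂ e {q} {P} t sp = true≢false (sp .hit) (outside t (≤-reflexive (begin
  lenAt (b ++ E ∷ (u₁ ++ N ∷ u₂) ++ e ∷ q) (nN (b ++ N ∷ u₁) ∸ 1)
    ≡⟨ cong₂ (λ w x → lenAt (b ++ E ∷ w) x) (++-assoc u₁ (N ∷ u₂) (e ∷ q)) row ⟩
  lenAt (b ++ E ∷ u₁ ++ N ∷ u₂ ++ e ∷ q) (nN b + nN u₁)
    ≡⟨ lenAt-++ʳ b (nN u₁) ⟩
  lenAt (u₁ ++ N ∷ u₂ ++ e ∷ q) (nN u₁)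
    ≡⟨ lenAt-++ʳ₀ u₁ ⟩
  nE (u₂ ++ e ∷ q) ∎)))
  where
  open ≡-Reasoning
  row : nN (b ++ N ∷ u₁) ∸ 1 ≡ nN b + nN u₁
  row rewrite nN-++ b {N ∷ u₁} | +-suc (nN b) (nN u₁) = refl

nN-swap : ∀ b u → nN (b ++ N ∷ u) ≡ suc (nN (b ++ E ∷ u))
nN-swap b u = trans (nN-++ b) (trans (+-suc (nN b) (nN u)) (cong suc (sym (nN-++ b))))

∷ʳ-ribbon : ∀ b u → b ++ N ∷ u ++ E ∷ [] ≡ (b ++ N ∷ u) ++ E ∷ []
∷ʳ-ribbon b u = sym (++-assoc b (N ∷ u) (E ∷ []))

-- The letter before the bottom edge of the special point separates the constructors: `N` after
-- `plain`, `E` after `ribbon`. Of two ribbons with different starts, the longer one would contain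
-- the old special point that belongs to the shorter one, against `ribbon-end`.
Insertion-injective : ∀ {v P j w Q v′ P′ j′ w′ Q′} → Insertion v P j w Q → Insertion v′ P′ j′ w′ Q′ →
  TL v P → TL v′ P′ → w ≡ w′ → Q ≗₂ Q′ → v ≡ v′ × j ≡ j′ × P ≗₂ P′
Insertion-injective (plain p e q nh) (plain p′ e′ q′ nh′) t t′ w≡ Q≗
  with Special-unique (Special-resp Q≗ (Special-plain p e t nh)) (Special-plain p′ e′ t′ nh′)
         (trans (++-assoc p _ _) (trans w≡ (sym (++-assoc p′ _ _))))
... | b≡ , refl with refl ← ∷ʳ-injectiveˡ p p′ b≡ with refl , P≗ ← insPt-injective p e p e′ refl t t′ Q≗ =
  refl , refl , P≗
Insertion-injective (plain p e q nh) (ribbon b′ u′ e′ q′ sp′) t t′ w≡ Q≗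
  with Special-unique (Special-resp Q≗ (Special-plain p e t nh)) (Special-ribbon b′ u′ e′ t′ sp′)
         (trans (++-assoc p _ _) (trans w≡ (ribbon-word b′ u′ q′)))
... | b≡ , refl with () ← ∷ʳ-injectiveʳ p (b′ ++ N ∷ u′) (trans b≡ (∷ʳ-ribbon b′ u′))
Insertion-injective (ribbon b u e q sp) (plain p′ e′ q′ nh′) t t′ w≡ Q≗
  with Special-unique (Special-resp Q≗ (Special-ribbon b u e t sp)) (Special-plain p′ e′ t′ nh′)
         (trans (sym (ribbon-word b u q)) (trans w≡ (sym (++-assoc p′ _ _))))
... | b≡ , refl with () ← ∷ʳ-injectiveʳ (b ++ N ∷ u) p′ (trans (sym (∷ʳ-ribbon b u)) b≡)
Insertion-injective {P = P} {P′ = P′} (ribbon b u e q sp) (ribbon b′ u′ e′ q′ sp′) t t′ w≡ Q≗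
  with Special-unique (Special-resp Q≗ (Special-ribbon b u e t sp)) (Special-ribbon b′ u′ e′ t′ sp′)
         (trans (sym (ribbon-word b u q)) (trans w≡ (ribbon-word b′ u′ q′)))
... | b≡ , refl
  with bu≡ ← ∷ʳ-injectiveˡ (b ++ N ∷ u) (b′ ++ N ∷ u′) (trans (sym (∷ʳ-ribbon b u)) (trans b≡ (∷ʳ-ribbon b′ u′)))
  with refl , P≗ ← insPt-injective (b ++ E ∷ u) e (b′ ++ E ∷ u′) e′ {q} {P} {P′}
         (suc-injective (trans (sym (nN-swap b u)) (trans (cong nN bu≡) (nN-swap b′ u′))))
         (subst (λ v → TL v P) (sym (++-assoc b (E ∷ u) (e ∷ q))) t)
         (subst (λ v → TL v P′) (sym (++-assoc b′ (E ∷ u′) (e′ ∷ q))) t′) Q≗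
  with ++-split b b′ bu≡
... | inj₂ ([] , refl , refl) = cong (λ z → z ++ E ∷ u ++ e ∷ q) (sym (++-identityʳ b)) , refl , P≗
... | inj₂ (_ ∷ u₁ , refl , refl) = contradiction (Special-resp (≗₂-sym P≗) sp′) (ribbon-end b u₁ u′ e t)
... | inj₁ (u₁ , refl , refl) = contradiction (Special-resp P≗ sp) (ribbon-end b′ u₁ u e t′)

-- Every tableau with at least two points arises by insertion

_≟ˢ_ : (x y : Step) → x ≡ y ⊎ x ≢ y
N ≟ˢ N = inj₁ refl
N ≟ˢ E = inj₂ λ ()
E ≟ˢ N = inj₂ λ ()
E ≟ˢ E = inj₁ refl

-- `H` sees the parts of the word on both sides of an occurrence of the letter. It is used with `E`
-- for bottom points and with `N` for possible ends of a ribbon.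
NoSplit : Step → (Word → Word → Bool) → Word → Set
NoSplit x H v = ∀ p q → v ≡ p ++ x ∷ q → H p q ≡ false

NoSplit-∷ : ∀ {x H y v} → (y ≡ x → H [] v ≡ false) → NoSplit x (λ p → H (y ∷ p)) v → NoSplit x H (y ∷ v)
NoSplit-∷ none₀ none []      q eq with refl , refl ← ∷-injective eq = none₀ refl
NoSplit-∷ none₀ none (_ ∷ p) q eq with refl , eq′ ← ∷-injective eq = none p q eq′

firstSplit : ∀ x H v → NoSplit x H v ⊎
  ∃₂ λ b r → v ≡ b ++ x ∷ r × H b r ≡ true × NoSplit x (λ p q → H p (q ++ x ∷ r)) b
firstSplit x H [] = inj₁ λ { [] _ () ; (_ ∷ _) _ () }
firstSplit x H (y ∷ v) with y ≟ˢ x | firstSplit x (λ p → H (y ∷ p)) v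
... | inj₂ y≢x | inj₁ none = inj₁ (NoSplit-∷ (λ y≡x → contradiction y≡x y≢x) none)
... | inj₂ y≢x | inj₂ (b , r , eq , h , none) = inj₂ (y ∷ b , r , cong (y ∷_) eq , h , NoSplit-∷ (λ y≡x → contradiction y≡x y≢x) none)
... | inj₁ refl | rest with H [] v in h₀
...   | true = inj₂ ([] , v , refl , h₀ , λ { [] _ () ; (_ ∷ _) _ () })
...   | false with rest
...     | inj₁ none = inj₁ (NoSplit-∷ (λ _ → h₀) none)
...     | inj₂ (b , r , eq , h , none) = inj₂ (y ∷ b , r , cong (y ∷_) eq , h ,
            NoSplit-∷ (λ _ → trans (cong (H []) (sym eq)) h₀) none)

lastSplit : ∀ x H v → NoSplit x H v ⊎
  ∃₂ λ b r → v ≡ b ++ x ∷ r × H b r ≡ true × NoSplit x (λ p q → H (b ++ x ∷ p) q) r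
lastSplit x H [] = inj₁ λ { [] _ () ; (_ ∷ _) _ () }
lastSplit x H (y ∷ v) with lastSplit x (λ p → H (y ∷ p)) v | y ≟ˢ x
... | inj₂ (b , r , eq , h , none) | _ = inj₂ (y ∷ b , r , cong (y ∷_) eq , h , none)
... | inj₁ none | inj₂ y≢x = inj₁ (NoSplit-∷ (λ y≡x → contradiction y≡x y≢x) none)
... | inj₁ none | inj₁ refl with H [] v in h₀
...   | true  = inj₂ ([] , v , refl , h₀ , none)
...   | false = inj₁ (NoSplit-∷ (λ _ → h₀) none)

columnSplit : ∀ v y → y < nE v → ∃₂ λ p q → v ≡ p ++ E ∷ q × nE q ≡ y
columnSplit (N ∷ v) y l = let p , q , e , n = columnSplit v y l in N ∷ p , q , cong (N ∷_) e , n
columnSplit (E ∷ v) y l with m<1+n⇒m<n∨m≡n l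
... | inj₁ l′   = let p , q , e , n = columnSplit v y l′ in E ∷ p , q , cong (E ∷_) e , n
... | inj₂ refl = [] , v , refl , refl

-- A point of the last row is the lowest cell of its column, so some column has a pointed bottom;
-- the first such column in the word is the special one.
TL-special : ∀ {v P} → TL v P → ∃₂ λ b w → v ≡ b ++ E ∷ w × Special P b w
TL-special {v} {P} t with firstSplit E (λ b w → P (nN b ∸ 1) (nE w)) v
... | inj₂ (b , w , eq , hit , noHit) = b , w , eq , special hit noHit
... | inj₁ none = ⊥-elim (bottom (nN v) refl)
  where
  bottom : ∀ m → nN v ≡ m → ⊥
  bottom zero    eq = n≮0 (subst (0 <_) eq (lenAt>0⇒<nN v 0 (t .inside 0 0 (t .root))))
  bottom (suc m) eq with t .rows m (≤-reflexive (sym eq))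
  ... | y , e with columnSplit v y (<-≤-trans (t .inside m y e) (lenAt≤nE v m))
  ...   | p , q , refl , refl with locate (nN p) m
  ...     | after k = <⇒≱ (t .inside _ _ e) (≤-trans (≤-reflexive (lenAt-++ʳ p k)) (lenAt≤nE q k))
  ...     | before m<p = true≢false e (trans (cong (λ x → P x (nE q)) (cong (_∸ 1) (sym p≡))) (none p q refl))
    where
    p≡ : nN p ≡ suc m
    p≡ = ≤-antisym (≤-trans (nN≤ p (E ∷ q)) (≤-reflexive eq)) m<p

contract : ∀ p {q Q} → TL (p ++ N ∷ E ∷ q) Q → Q (nN p) (nE q) ≡ true → ¬ (nN p ≡ 0 × nE q ≡ 0) →
  ∃₂ λ e P → TL (p ++ e ∷ q) P × Q ≗₂ insPt e (nN p) (nE q) P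
contract p t hit nr with t .parent _ _ hit nr
... | inj₁ above , notBoth = let Q≗ , t′ = TL-delRow p t hit above (λ l → notBoth (above , l)) in E , _ , t′ , Q≗
... | inj₂ left  , notBoth = let Q≗ , t′ = TL-delCol p t hit left (λ a → notBoth (a , left)) in N , _ , t′ , Q≗

NoHit-insPt⁻ : ∀ p e {q P Q} → TL (p ++ e ∷ q) P → Q ≗₂ insPt e (nN p) (nE q) P →
  NoHit Q p (N ∷ E ∷ q) → NoHit P p (e ∷ q)
NoHit-insPt⁻ p e {q} {P} t Q≗ nh s r refl =
  trans (sym (insPt-old e r (<-≤-trans (bottom-row s (subst (λ v → TL v P) (++-assoc s (E ∷ r) (e ∷ q)) t)) (nN≤ s (E ∷ r)))))
        (trans (sym (Q≗ _ _)) (nh s r refl))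

-- The first `E` is the bottom of the rightmost column, and `h` is the height of that column.
firstE : ∀ b → ∃₂ λ h r → b ++ E ∷ [] ≡ replicate h N ++ E ∷ r
firstE []      = 0 , [] , refl
firstE (E ∷ b) = 0 , b ++ E ∷ [] , refl
firstE (N ∷ b) = let h , r , e = firstE b in suc h , r , cong (N ∷_) e

nN-replicate : ∀ h → nN (replicate h N) ≡ h
nN-replicate zero    = refl
nN-replicate (suc h) = cong suc (nN-replicate h)

nE-replicate : ∀ h → nE (replicate h N) ≡ 0
nE-replicate zero    = refl
nE-replicate (suc h) = nE-replicate h

replicate-split : ∀ {x h} → suc x < h → ∃ λ r → replicate h N ≡ replicate (suc x) N ++ N ∷ r × nE r ≡ 0
replicate-split {zero}  {suc zero} (s≤s ())
replicate-split {zero}  {suc (suc h)} _ = replicate h N , refl , nE-replicate h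
replicate-split {suc x} {suc h} (s≤s l) = let r , e , n = replicate-split {x} {h} l in r , cong (N ∷_) e , n

-- In the word p N q E w: would a ribbon along q and starting at E w end below a point if it stopped at this N?
belowPoint : Mat → Word → Word → Word → Bool
belowPoint Q w p q = (0 <ᵇ nN p) ∧ Q (nN p ∸ 1) (nE (q ++ w))

-- Otherwise the last column would contain no point.
ribbon-exists : ∀ b {w Q} → TL (b ++ E ∷ E ∷ w) Q → NoHit Q (b ++ E ∷ []) (E ∷ w) →
  ¬ NoSplit N (belowPoint Q (E ∷ w)) b
ribbon-exists b {w} {Q} t nh none with firstE b
... | h , r , eq = ⊥-elim (absurd (above-bottom (replicate h N) t′))
  where
  word≡ : b ++ E ∷ E ∷ w ≡ replicate h N ++ E ∷ r ++ E ∷ w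
  word≡ = trans (sym (++-assoc b (E ∷ []) (E ∷ w))) (trans (cong (_++ E ∷ w) eq) (++-assoc (replicate h N) (E ∷ r) (E ∷ w)))
  t′ = subst (λ v → TL v Q) word≡ t
  absurd : ¬ Above Q (nN (replicate h N)) (nE (r ++ E ∷ w))
  absurd (x , x<h , e) rewrite nN-replicate h with m≤n⇒m<n∨m≡n x<h
  -- The rightmost column has a point in some row x < h. If x = h - 1, it is a bottom point
  -- Northeast of the special one; otherwise the ribbon could have stopped at the end of row x + 1.
  ... | inj₂ refl = true≢false (trans (cong (λ z → Q z (nE (r ++ E ∷ w))) (nN-replicate x)) e) (nh (replicate h N) r eq)
  ... | inj₁ 1+x<h with replicate-split {x} {h} 1+x<h
  ...   | z , eq′ , z≡0
    with ++-split b (replicate (suc x) N) (trans eq (trans (cong (_++ E ∷ r) eq′) (++-assoc (replicate (suc x) N) (N ∷ z) (E ∷ r))))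
  ...     | inj₂ ([] , _ , ())
  ...     | inj₂ (_ ∷ [] , _ , ())
  ...     | inj₂ (_ ∷ _ ∷ _ , _ , ())
  ...     | inj₁ (z′ , b≡ , z″) = true≢false e
              (trans (cong₂ Q (sym (nN-replicate x)) columns≡) (none (replicate (suc x) N) z′ b≡))
    where
    columns≡ : nE (r ++ E ∷ w) ≡ nE (z′ ++ E ∷ w)
    columns≡ rewrite nE-++ r {E ∷ w} | nE-++ z′ {E ∷ w} | +-suc (nE r) (nE w) | +-suc (nE z′) (nE w) =
      cong (_+ nE w) (begin
        suc (nE r)            ≡⟨ cong (_+ suc (nE r)) z≡0 ⟨
        nE z + suc (nE r)     ≡⟨ nE-++ z ⟨
        nE (z ++ E ∷ r)       ≡⟨ cong nE z″ ⟩
        nE (z′ ++ E ∷ [])     ≡⟨ nE-++ z′ ⟩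
        nE z′ + 1             ≡⟨ +-comm (nE z′) 1 ⟩
        suc (nE z′)           ∎) where open ≡-Reasoning

starts-N : ∀ p {q P} → TL (p ++ N ∷ q) P → nN p ≡ 0 → p ≡ []
starts-N []      t _ = refl
starts-N (E ∷ p) t _ with above-bottom [] t
... | _ , () , _

no-empty-rows : ∀ p {q P} → TL (p ++ q) P → nE q ≡ 0 → q ≡ []
no-empty-rows p {[]}    t _ = refl
no-empty-rows p {N ∷ q} t e with left-end p t
... | _ , y<c , _ = contradiction (subst (_ <_) e y<c) n≮0

-- If `N` precedes the bottom edge of the special point, that point is a corner and is removed at
-- once. If `E` does, there is a cell to its right, and the ribbon is taken off first. The bound on
-- the length excludes the tableau with one cell, whose point is the root.
Insertion-surjective : ∀ {w Q} → TL w Q → 2 < length w →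
  ∃₂ λ v P → ∃₂ λ j Q′ → TL v P × Insertion v P j w Q′ × Q ≗₂ Q′
Insertion-surjective {w} {Q} t 2<len with TL-special t
... | b , r , refl , sp with initLast b
... | [] = contradiction (above-bottom [] t) λ ()
... | p ∷ʳ′ N with contract p t′ (trans (cong (λ x → Q (x ∸ 1) (nE r)) (sym (nN-∷ʳN p))) (sp .hit)) nonRoot
  where
  t′ : TL (p ++ N ∷ E ∷ r) Q
  t′ = subst (λ v → TL v Q) (++-assoc p (N ∷ []) (E ∷ r)) t
  nonRoot : ¬ (nN p ≡ 0 × nE r ≡ 0)
  nonRoot (p≡0 , r≡0)
    with refl ← starts-N p t′ p≡0
    with refl ← no-empty-rows (N ∷ E ∷ []) t′ r≡0 = <-irrefl refl 2<len
...   | e , P , tP , Q≗ = p ++ e ∷ r , P , length r , insPt e (nN p) (nE r) P , tP ,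
          subst (λ w → Insertion (p ++ e ∷ r) P (length r) w (insPt e (nN p) (nE r) P)) (sym (++-assoc p (N ∷ []) (E ∷ r)))
            (plain p e r (NoHit-insPt⁻ p e tP Q≗ noHit′)) , Q≗
  where
  noHit′ : NoHit Q p (N ∷ E ∷ r)
  noHit′ s z refl = trans (cong (λ z → Q (nN s ∸ 1) (nE z)) (sym (++-assoc z (N ∷ []) (E ∷ r))))
                          (sp .noHit s (z ++ N ∷ []) (++-assoc s (E ∷ z) (N ∷ [])))
Insertion-surjective {w} {Q} t 2<len | b , r , refl , sp | p ∷ʳ′ E
  with lastSplit N (belowPoint Q (E ∷ r)) p
... | inj₁ none = contradiction none
        (ribbon-exists p (subst (λ v → TL v Q) (++-assoc p (E ∷ []) (E ∷ r)) t) (sp .noHit))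
... | inj₂ (b , u , refl , below , none)
  with contract (b ++ E ∷ u) t′ hit′ (λ (i≡0 , _) → <⇒≢ (<-≤-trans 0<b (nN≤ b (E ∷ u))) (sym i≡0))
  where
  prefix : ∀ s → nN (b ++ N ∷ s) ∸ 1 ≡ nN b + nN s
  prefix s = trans (cong (_∸ 1) (nN-++ b)) (cong (_∸ 1) (+-suc (nN b) (nN s)))
  0<b : 0 < nN b
  0<b = positive below
    where
    positive : ∀ {n y} → (0 <ᵇ n) ∧ y ≡ true → 0 < n
    positive {suc _} _ = z<s
  -- A ribbon cell at the bottom of its column has no point because it lies Northeast of the special
  -- point; one with another ribbon cell below it has none because `lastSplit` passed it over.
  rib : EmptyRibbon (Q ∘ (nN b +_)) u (E ∷ r)
  rib = record
    { columns = λ { s z refl → trans (cong₂ Q (sym (prefix s)) (cong nE (sym (++-assoc z (E ∷ []) (E ∷ r)))))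
                                     (sp .noHit (b ++ N ∷ s) (z ++ E ∷ []) (trans (++-assoc b (N ∷ s ++ E ∷ z) (E ∷ []))
                                       (trans (cong (λ y → b ++ N ∷ y) (++-assoc s (E ∷ z) (E ∷ []))) (sym (++-assoc b (N ∷ s) _))))) }
    ; end     = trans (cong (λ x → Q x (suc (nE r))) (sym (prefix u))) (sp .noHit (b ++ N ∷ u) [] refl)
    ; rightOf = λ { s z refl → trans (cong₂ Q (sym (prefix s)) (trans (nE-++ z) (sym (nE-++ z)))) (notBelow s (none s z refl)) }
    }
    where
    notBelow : ∀ s {y} → (0 <ᵇ nN (b ++ N ∷ s)) ∧ Q (nN (b ++ N ∷ s) ∸ 1) y ≡ false → Q (nN (b ++ N ∷ s) ∸ 1) y ≡ false
    notBelow s e rewrite nN-++ b {N ∷ s} | +-suc (nN b) (nN s) = e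
  t′ : TL ((b ++ E ∷ u) ++ N ∷ E ∷ r) Q
  t′ = subst (λ v → TL v Q) (sym (++-assoc b (E ∷ u) (N ∷ E ∷ r)))
         (TL-Flips⁻ (Flips-++ b (ribbon-Flips u rib))
           (subst (λ v → TL v Q) (trans (cong (_++ E ∷ r) (++-assoc b (N ∷ u) (E ∷ []))) (sym (ribbon-word b u r))) t))
  hit′ : Q (nN (b ++ E ∷ u)) (nE r) ≡ true
  hit′ = trans (cong (λ x → Q x (nE r)) (sym row)) (sp .hit)
    where
    row : nN ((b ++ N ∷ u) ++ E ∷ []) ∸ 1 ≡ nN (b ++ E ∷ u)
    row rewrite nN-++ (b ++ N ∷ u) {E ∷ []} | +-identityʳ (nN (b ++ N ∷ u)) | nN-swap b u = refl
...   | e , P , tP , Q≗ = b ++ E ∷ u ++ e ∷ r , P , length r , insPt e (nN (b ++ E ∷ u)) (nE r) P , tP′ ,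
          subst (λ w → Insertion (b ++ E ∷ u ++ e ∷ r) P (length r) w (insPt e (nN (b ++ E ∷ u)) (nE r) P))
            (trans (ribbon-word b u r) (cong (_++ E ∷ r) (∷ʳ-ribbon b u)))
            (ribbon b u e r (special hit″ noHit″)) , Q≗
  where
  tP′ : TL (b ++ E ∷ u ++ e ∷ r) P
  tP′ = subst (λ v → TL v P) (++-assoc b (E ∷ u) (e ∷ r)) tP
  old : ∀ s y → nN s ≤ nN b → TL (s ++ E ∷ y) P → ∀ z → Q (nN s ∸ 1) (nE (z ++ N ∷ E ∷ r)) ≡ P (nN s ∸ 1) (nE (z ++ e ∷ r))
  old s y s≤b ts z = trans (Q≗ _ _) (insPt-old e z (<-≤-trans (bottom-row s ts) (≤-trans s≤b (nN≤ b (E ∷ u)))))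
  hit″ : P (nN b ∸ 1) (nE (u ++ e ∷ r)) ≡ true
  hit″ = trans (sym (old b _ ≤-refl tP′ u)) (trans (cong (Q (nN b ∸ 1)) (trans (nE-++ u) (sym (nE-++ u)))) (isBelow below))
    where
    isBelow : ∀ {a y} → a ∧ y ≡ true → y ≡ true
    isBelow {true} e = e
  noHit″ : NoHit P b (E ∷ u ++ e ∷ r)
  noHit″ s z refl = trans (cong (λ y → P (nN s ∸ 1) (nE y)) (sym (++-assoc z (E ∷ u) (e ∷ r))))
    (trans (sym (old s (z ++ E ∷ u ++ e ∷ r) (nN≤ s (E ∷ z)) (subst (λ v → TL v P) (++-assoc s (E ∷ z) (E ∷ u ++ e ∷ r)) tP′) (z ++ E ∷ u)))
      (trans (cong (Q (nN s ∸ 1)) columns≡)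
        (sp .noHit s (z ++ N ∷ u ++ E ∷ []) (trans (sym (∷ʳ-ribbon (s ++ E ∷ z) u)) (++-assoc s (E ∷ z) _)))))
    where
    columns≡ : nE ((z ++ E ∷ u) ++ N ∷ E ∷ r) ≡ nE ((z ++ N ∷ u ++ E ∷ []) ++ E ∷ r)
    columns≡ rewrite nE-++ (z ++ N ∷ u ++ E ∷ []) {E ∷ r} | nE-++ z {N ∷ u ++ E ∷ []} | nE-++ u {E ∷ []}
                   | nE-++ (z ++ E ∷ u) {N ∷ E ∷ r} | nE-++ z {E ∷ u} | +-comm (nE u) 1 = refl

Insertion-index : ∀ {v P j w Q} → Insertion v P j w Q → j < length v
Insertion-index (plain p e q _) = length-++-≤ʳ (e ∷ q) {p}
Insertion-index (ribbon b u e q _) = subst (λ v → length q < length v) (++-assoc b (E ∷ u) (e ∷ q)) (length-++-≤ʳ (e ∷ q) {b ++ E ∷ u})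

splitFromEnd : ∀ (v : List A) j → j < length v → ∃₂ λ p e → ∃ λ q → v ≡ p ++ e ∷ q × length q ≡ j
splitFromEnd (e ∷ v) j l with m<1+n⇒m<n∨m≡n l
... | inj₁ l′   = let p , e′ , q , eq , len = splitFromEnd v j l′ in e ∷ p , e′ , q , cong (e ∷_) eq , len
... | inj₂ refl = [] , e , v , refl , refl

Insertion-exists : ∀ {v P} → TL v P → ∀ j → j < length v → ∃₂ λ w Q → Insertion v P j w Q
Insertion-exists {v} {P} t j j<n with splitFromEnd v j j<n
... | p , e , q , refl , refl with firstSplit E (λ s z → P (nN s ∸ 1) (nE (z ++ e ∷ q))) p
...   | inj₁ noHit = _ , _ , plain p e q noHit
...   | inj₂ (b , u , refl , hit , noHit) = _ , _ ,
          subst (λ v → Insertion v P (length q) (b ++ N ∷ u ++ E ∷ E ∷ q) (insPt e (nN (b ++ E ∷ u)) (nE q) P)) (sym (++-assoc b (E ∷ u) (e ∷ q)))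
            (ribbon b u e q (special hit λ s z eq → trans (cong (λ y → P (nN s ∸ 1) (nE y)) (sym (++-assoc z (E ∷ u) (e ∷ q)))) (noHit s z eq)))

-- The diagram of a word and a matrix

toRaw : Word → Mat → Raw
toRaw v P = applyUpTo (λ x → applyUpTo (P x) (lenAt v x)) (nN v)

applyUpTo-cong : ∀ n {f g : ℕ → A} → (∀ x → x < n → f x ≡ g x) → applyUpTo f n ≡ applyUpTo g n
applyUpTo-cong zero    f≗g = refl
applyUpTo-cong (suc n) f≗g = cong₂ _∷_ (f≗g 0 z<s) (applyUpTo-cong n (λ x x<n → f≗g (suc x) (s<s x<n)))

toRaw-cong : ∀ v {P Q} → P ≗₂ Q → toRaw v P ≡ toRaw v Q
toRaw-cong v P≗Q = applyUpTo-cong (nN v) (λ x _ → applyUpTo-cong (lenAt v x) (λ y _ → P≗Q x y))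

lookupD-applyUpTo : ∀ (f : ℕ → A) n {i} d → i < n → lookupD (applyUpTo f n) i d ≡ f i
lookupD-applyUpTo f (suc n) {zero}  d _         = refl
lookupD-applyUpTo f (suc n) {suc i} d (s≤s i<n) = lookupD-applyUpTo (f ∘ suc) n d i<n

lookupD-beyond : ∀ (xs : List A) {i} d → length xs ≤ i → lookupD xs i d ≡ d
lookupD-beyond []       d _         = refl
lookupD-beyond (x ∷ xs) d (s≤s n≤i) = lookupD-beyond xs d n≤i

toRaw-rows : ∀ v P → numRows (toRaw v P) ≡ nN v
toRaw-rows v P = length-applyUpTo _ (nN v)

rowLen-toRaw : ∀ v P x → rowLen (toRaw v P) x ≡ lenAt v x
rowLen-toRaw v P x with x <? nN v
... | yes x<n = trans (cong length (lookupD-applyUpTo _ (nN v) [] x<n)) (length-applyUpTo (P x) (lenAt v x))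
... | no x≮n with lenAt v x in eq
...   | zero  = cong length (lookupD-beyond (toRaw v P) [] (subst (_≤ x) (sym (toRaw-rows v P)) (≮⇒≥ x≮n)))
...   | suc l = contradiction (lenAt>0⇒<nN v x (subst (0 <_) (sym eq) z<s)) x≮n

pt-toRaw : ∀ {v P} → TL v P → pt (toRaw v P) ≗₂ P
pt-toRaw {v} {P} t x y with x <? nN v
... | no x≮n rewrite lookupD-beyond (toRaw v P) [] (subst (_≤ x) (sym (toRaw-rows v P)) (≮⇒≥ x≮n)) =
  sym (outside t (≮⇒≥ (x≮n ∘ lenAt>0⇒<nN v x)))
... | yes x<n rewrite lookupD-applyUpTo (λ x → applyUpTo (P x) (lenAt v x)) (nN v) [] x<n with y <? lenAt v x
...   | yes y<l = lookupD-applyUpTo (P x) (lenAt v x) false y<l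
...   | no y≮l = trans (lookupD-beyond (applyUpTo (P x) (lenAt v x)) false (subst (_≤ y) (sym (length-applyUpTo (P x) (lenAt v x))) (≮⇒≥ y≮l)))
                       (sym (outside t (≮⇒≥ y≮l)))

sumTo-prefix : ∀ {a n} (b : ℕ → Bool) → a ≤ n → (∀ x → x < a → b x ≡ true) → (∀ k → b (a + k) ≡ false) →
  sumTo n (indicator ∘ b) ≡ a
sumTo-prefix {zero}  {n} b _ below above = sumTo-zero n (λ x _ → cong indicator (above x))
sumTo-prefix {suc a} {suc n} b (s≤s a≤n) below above = cong₂ _+_ (cong indicator (below 0 z<s))
  (sumTo-prefix (b ∘ suc) a≤n (λ x x<a → below (suc x) (s<s x<a)) above)

colHeight-toRaw : ∀ p q P → colHeight (toRaw (p ++ E ∷ q) P) (nE q) ≡ nN p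
colHeight-toRaw p q P = trans (countᵇ-applyUpTo _ _ (nN v))
  (sumTo-prefix (λ x → nE q <ᵇ length (applyUpTo (P x) (lenAt v x))) (nN≤ p (E ∷ q))
    (λ x x<p → <ᵇ-true (subst (nE q <_) (sym (len x)) (subst (nE q <_) (sym (lenAt-++ˡ p x x<p)) (m≤n+m _ (lenAt p x)))))
    (λ k → <ᵇ-false (subst (_≤ nE q) (sym (len (nN p + k))) (≤-trans (≤-reflexive (lenAt-++ʳ p k)) (lenAt≤nE q k)))))
  where
  v = p ++ E ∷ q
  len : ∀ x → length (applyUpTo (P x) (lenAt v x)) ≡ lenAt v x
  len x = length-applyUpTo (P x) (lenAt v x)

-- Boundary edges

rowsFrom : ℕ → Word → List (ℕ × ℕ)
rowsFrom i []      = []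
rowsFrom i (N ∷ v) = (i , nE v) ∷ rowsFrom (suc i) v
rowsFrom i (E ∷ v) = rowsFrom i v

rowsFrom-applyUpTo : ∀ i v → applyUpTo (λ x → i + x , lenAt v x) (nN v) ≡ rowsFrom i v
rowsFrom-applyUpTo i []      = refl
rowsFrom-applyUpTo i (E ∷ v) = rowsFrom-applyUpTo i v
rowsFrom-applyUpTo i (N ∷ v) = cong₂ _∷_ (cong (_, nE v) (+-identityʳ i))
  (trans (applyUpTo-cong (nN v) (λ x _ → cong (_, lenAt v x) (+-suc i x))) (rowsFrom-applyUpTo (suc i) v))

zip-applyUpTo : ∀ (f : ℕ → A) (g : ℕ → B) n → zip (applyUpTo f n) (applyUpTo g n) ≡ applyUpTo (λ x → f x , g x) n
zip-applyUpTo f g zero    = refl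
zip-applyUpTo f g (suc n) = cong ((f 0 , g 0) ∷_) (zip-applyUpTo (f ∘ suc) (g ∘ suc) n)

zip-toRaw : ∀ v P → zip (upTo (numRows (toRaw v P))) (map length (toRaw v P)) ≡ rowsFrom 0 v
zip-toRaw v P = begin
  zip (upTo (numRows (toRaw v P))) (map length (toRaw v P))
    ≡⟨ cong₂ (λ n l → zip (upTo n) l) (toRaw-rows v P) (map-applyUpTo _ length (nN v)) ⟩
  zip (upTo (nN v)) (applyUpTo (λ x → length (applyUpTo (P x) (lenAt v x))) (nN v))
    ≡⟨ zip-applyUpTo id _ (nN v) ⟩
  applyUpTo (λ x → x , length (applyUpTo (P x) (lenAt v x))) (nN v)
    ≡⟨ applyUpTo-cong (nN v) (λ x _ → cong (x ,_) (length-applyUpTo (P x) (lenAt v x))) ⟩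
  applyUpTo (λ x → x , lenAt v x) (nN v)
    ≡⟨ rowsFrom-applyUpTo 0 v ⟩
  rowsFrom 0 v ∎
  where open ≡-Reasoning

-- The edges of the steps of p in the word p ++ w, where i is the number of rows above p.
edgesOf : ℕ → Word → Word → List Edge
edgesOf i []      w = []
edgesOf i (N ∷ p) w = rowEnd i ∷ edgesOf (suc i) p w
edgesOf i (E ∷ p) w = colBottom (nE (p ++ w)) ∷ edgesOf i p w

edgesFrom : ℕ → Word → List Edge
edgesFrom i v = edgesOf i v []

edgesOf-++ : ∀ i p q w → edgesOf i (p ++ q) w ≡ edgesOf i p (q ++ w) ++ edgesOf (i + nN p) q w
edgesOf-++ i []      q w = cong (λ i → edgesOf i q w) (sym (+-identityʳ i))
edgesOf-++ i (E ∷ p) q w = cong₂ _∷_ (cong (colBottom ∘ nE) (++-assoc p q w)) (edgesOf-++ i p q w)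
edgesOf-++ i (N ∷ p) q w = cong (rowEnd i ∷_)
  (trans (edgesOf-++ (suc i) p q w) (cong (λ k → edgesOf (suc i) p (q ++ w) ++ edgesOf k q w) (sym (+-suc i (nN p)))))

length-edgesOf : ∀ i p w → length (edgesOf i p w) ≡ length p
length-edgesOf i []      w = refl
length-edgesOf i (N ∷ p) w = cong suc (length-edgesOf (suc i) p w)
length-edgesOf i (E ∷ p) w = cong suc (length-edgesOf i p w)

lastLen : ℕ → List (ℕ × ℕ) → ℕ
lastLen k []             = k
lastLen k ((_ , l) ∷ rs) = lastLen l rs

lastLen-snoc : ∀ k rs i l → lastLen k (rs ++ (i , l) ∷ []) ≡ l
lastLen-snoc k []             i l = refl
lastLen-snoc k ((_ , m) ∷ rs) i l = lastLen-snoc m rs i l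

lastLen-rowsFrom : ∀ i v → lastLen 0 (reverse (rowsFrom i v)) ≡ lenAt v 0
lastLen-rowsFrom i []      = refl
lastLen-rowsFrom i (E ∷ v) = lastLen-rowsFrom i v
lastLen-rowsFrom i (N ∷ v) = trans (cong (lastLen 0) (unfold-reverse (i , nE v) (rowsFrom (suc i) v)))
  (lastLen-snoc 0 (reverse (rowsFrom (suc i) v)) i (nE v))

edgesAux-snoc : ∀ k rs i l → edgesAux k (rs ++ (i , l) ∷ []) ≡
  (edgesAux k rs ++ map colBottom (range (lastLen k rs) l)) ++ rowEnd i ∷ []
edgesAux-snoc k []             i l = refl
edgesAux-snoc k ((j , m) ∷ rs) i l = trans (cong (λ z → map colBottom (range k m) ++ rowEnd j ∷ z) (edgesAux-snoc m rs i l))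
  (trans (sym (++-assoc (map colBottom (range k m)) (rowEnd j ∷ _) (rowEnd i ∷ [])))
    (cong (_++ rowEnd i ∷ []) (sym (++-assoc (map colBottom (range k m)) (rowEnd j ∷ edgesAux m rs) _))))

range-empty : ∀ n → range n n ≡ []
range-empty n rewrite n∸n≡0 n = refl

range-snoc : ∀ {a b} → a ≤ b → range a (suc b) ≡ range a b ++ b ∷ []
range-snoc {a} {b} a≤b rewrite +-∸-assoc 1 a≤b = begin
  map (a +_) (upTo (suc (b ∸ a)))              ≡⟨ cong (map (a +_)) (upTo-∷ʳ (b ∸ a)) ⟨
  map (a +_) (upTo (b ∸ a) ++ (b ∸ a) ∷ [])    ≡⟨ map-++ (a +_) (upTo (b ∸ a)) _ ⟩
  range a b ++ (a + (b ∸ a)) ∷ []              ≡⟨ cong (λ z → range a b ++ z ∷ []) (m+[n∸m]≡n a≤b) ⟩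
  range a b ++ b ∷ []                          ∎
  where open ≡-Reasoning

-- During the induction the word may begin with `E`, but `edgesAux` stops at the right end of the
-- top row. The second summand lists these leading columns; by `TL-width` a tableau has none.
edgesAux-rowsFrom : ∀ i v →
  edgesAux 0 (reverse (rowsFrom i v)) ++ map colBottom (range (lenAt v 0) (nE v)) ≡ reverse (edgesFrom i v)
edgesAux-rowsFrom i [] = refl
edgesAux-rowsFrom i (N ∷ v) = begin
  edgesAux 0 (reverse ((i , nE v) ∷ rs)) ++ map colBottom (range (nE v) (nE v))
    ≡⟨ cong₂ (λ a b → edgesAux 0 a ++ map colBottom b) (unfold-reverse (i , nE v) rs) (range-empty (nE v)) ⟩
  edgesAux 0 (reverse rs ++ (i , nE v) ∷ []) ++ []
    ≡⟨ ++-identityʳ _ ⟩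
  edgesAux 0 (reverse rs ++ (i , nE v) ∷ [])
    ≡⟨ edgesAux-snoc 0 (reverse rs) i (nE v) ⟩
  (edgesAux 0 (reverse rs) ++ map colBottom (range (lastLen 0 (reverse rs)) (nE v))) ++ rowEnd i ∷ []
    ≡⟨ cong (λ l → (edgesAux 0 (reverse rs) ++ map colBottom (range l (nE v))) ++ rowEnd i ∷ []) (lastLen-rowsFrom (suc i) v) ⟩
  (edgesAux 0 (reverse rs) ++ map colBottom (range (lenAt v 0) (nE v))) ++ rowEnd i ∷ []
    ≡⟨ cong (_++ rowEnd i ∷ []) (edgesAux-rowsFrom (suc i) v) ⟩
  reverse (edgesFrom (suc i) v) ++ rowEnd i ∷ []
    ≡⟨ unfold-reverse (rowEnd i) (edgesFrom (suc i) v) ⟨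
  reverse (edgesFrom i (N ∷ v)) ∎
  where
  open ≡-Reasoning
  rs = rowsFrom (suc i) v
edgesAux-rowsFrom i (E ∷ v) = begin
  es ++ map colBottom (range (lenAt v 0) (suc (nE v)))
    ≡⟨ cong (λ z → es ++ map colBottom z) (range-snoc (lenAt≤nE v 0)) ⟩
  es ++ map colBottom (range (lenAt v 0) (nE v) ++ nE v ∷ [])
    ≡⟨ cong (es ++_) (map-++ colBottom (range (lenAt v 0) (nE v)) (nE v ∷ [])) ⟩
  es ++ map colBottom (range (lenAt v 0) (nE v)) ++ colBottom (nE v) ∷ []
    ≡⟨ ++-assoc es _ _ ⟨
  (es ++ map colBottom (range (lenAt v 0) (nE v))) ++ colBottom (nE v) ∷ []
    ≡⟨ cong₂ (λ a b → a ++ colBottom (nE b) ∷ []) (edgesAux-rowsFrom i v) (sym (++-identityʳ v)) ⟩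
  reverse (edgesFrom i v) ++ colBottom (nE (v ++ [])) ∷ []
    ≡⟨ unfold-reverse (colBottom (nE (v ++ []))) (edgesFrom i v) ⟨
  reverse (edgesFrom i (E ∷ v)) ∎
  where
  open ≡-Reasoning
  es = edgesAux 0 (reverse (rowsFrom i v))

-- A word beginning with `E` would have a column of height 0, hence without a point.
TL-width : ∀ {v P} → TL v P → lenAt v 0 ≡ nE v
TL-width {[]}    t with () ← t .inside 0 0 (t .root)
TL-width {N ∷ v} t = refl
TL-width {E ∷ v} t with above-bottom [] t
... | _ , () , _

edges-toRaw : ∀ {v P} → TL v P → edges (toRaw v P) ≡ reverse (edgesFrom 0 v)
edges-toRaw {v} {P} t = begin
  edges (toRaw v P)                                 ≡⟨ cong (edgesAux 0 ∘ reverse) (zip-toRaw v P) ⟩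
  es                                                ≡⟨ ++-identityʳ es ⟨
  es ++ []                                          ≡⟨ cong (λ z → es ++ map colBottom z) (trans (cong (λ l → range l (nE v)) (TL-width t)) (range-empty (nE v))) ⟨
  es ++ map colBottom (range (lenAt v 0) (nE v))    ≡⟨ edgesAux-rowsFrom 0 v ⟩
  reverse (edgesFrom 0 v)                           ∎
  where
  open ≡-Reasoning
  es = edgesAux 0 (reverse (rowsFrom 0 v))

edgeAt : Word → Step → Word → Edge
edgeAt p N q = rowEnd (nN p)
edgeAt p E q = colBottom (nE q)

edges-split : ∀ p e q {P} → TL (p ++ e ∷ q) P → ∃ λ es → length es ≡ length q ×
  edges (toRaw (p ++ e ∷ q) P) ≡ es ++ edgeAt p e q ∷ reverse (edgesOf 0 p (e ∷ q))
edges-split p e q {P} t = reverse rest , trans (length-reverse rest) (length-edgesOf _ q []) , (begin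
  edges (toRaw (p ++ e ∷ q) P)
    ≡⟨ edges-toRaw t ⟩
  reverse (edgesFrom 0 (p ++ e ∷ q))
    ≡⟨ cong reverse (trans (edgesOf-++ 0 p (e ∷ q) []) (cong₂ (λ a b → edgesOf 0 p a ++ b) (++-identityʳ (e ∷ q)) (head e))) ⟩
  reverse (edgesOf 0 p (e ∷ q) ++ edgeAt p e q ∷ rest)
    ≡⟨ reverse-++ (edgesOf 0 p (e ∷ q)) _ ⟩
  reverse (edgeAt p e q ∷ rest) ++ reverse (edgesOf 0 p (e ∷ q))
    ≡⟨ cong (_++ reverse (edgesOf 0 p (e ∷ q))) (unfold-reverse (edgeAt p e q) rest) ⟩
  (reverse rest ++ edgeAt p e q ∷ []) ++ reverse (edgesOf 0 p (e ∷ q))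
    ≡⟨ ++-assoc (reverse rest) _ _ ⟩
  reverse rest ++ edgeAt p e q ∷ reverse (edgesOf 0 p (e ∷ q)) ∎)
  where
  open ≡-Reasoning
  rest = edgesFrom (nN p + nN (e ∷ [])) q
  head : ∀ e → edgesFrom (nN p) (e ∷ q) ≡ edgeAt p e q ∷ edgesFrom (nN p + nN (e ∷ [])) q
  head N rewrite +-comm (nN p) 1 = refl
  head E rewrite +-identityʳ (nN p) | ++-identityʳ q = refl

lookupM-length : ∀ (xs : List A) y ys → lookupM (xs ++ y ∷ ys) (length xs) ≡ just y
lookupM-length []       y ys = refl
lookupM-length (x ∷ xs) y ys = lookupM-length xs y ys

lookupM-edges : ∀ p e q {P} → TL (p ++ e ∷ q) P → lookupM (edges (toRaw (p ++ e ∷ q) P)) (length q) ≡ just (edgeAt p e q)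
lookupM-edges p e q {P} t = let es , len , eq = edges-split p e q t in
  trans (cong₂ lookupM eq (sym len)) (lookupM-length es (edgeAt p e q) _)

Miss : Raw → Edge → Set
Miss T (colBottom c) = pt T (colHeight T c ∸ 1) c ≡ false
Miss T (rowEnd r)    = ⊤

specialAux-++ : ∀ T k es es′ acc → specialAux T k (es ++ es′) acc ≡ specialAux T (length es + k) es′ (specialAux T k es acc)
specialAux-++ T k []                 es′ acc = refl
specialAux-++ T k (colBottom c ∷ es) es′ acc = trans (specialAux-++ T (suc k) es es′ _)
  (cong (λ n → specialAux T n es′ (specialAux T k (colBottom c ∷ es) acc)) (+-suc (length es) k))
specialAux-++ T k (rowEnd r ∷ es)    es′ acc = trans (specialAux-++ T (suc k) es es′ _)
  (cong (λ n → specialAux T n es′ (specialAux T k (rowEnd r ∷ es) acc)) (+-suc (length es) k))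

specialAux-Miss : ∀ T k {es} acc → All (Miss T) es → specialAux T k es acc ≡ acc
specialAux-Miss T k acc [] = refl
specialAux-Miss T k {colBottom c ∷ _} acc (m ∷ ms) rewrite m = specialAux-Miss T (suc k) acc ms
specialAux-Miss T k {rowEnd r ∷ _}    acc (_ ∷ ms) = specialAux-Miss T (suc k) acc ms

All-Miss : ∀ T i b w → (∀ p q → b ≡ p ++ E ∷ q → Miss T (colBottom (nE (q ++ w)))) → All (Miss T) (edgesOf i b w)
All-Miss T i []      w miss = []
All-Miss T i (N ∷ b) w miss = tt ∷ All-Miss T (suc i) b w (λ p q e → miss (N ∷ p) q (cong (N ∷_) e))
All-Miss T i (E ∷ b) w miss = miss [] b refl ∷ All-Miss T i b w (λ p q e → miss (E ∷ p) q (cong (E ∷_) e))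

bottom-toRaw : ∀ p q {P} → TL (p ++ E ∷ q) P →
  let T = toRaw (p ++ E ∷ q) P in pt T (colHeight T (nE q) ∸ 1) (nE q) ≡ P (nN p ∸ 1) (nE q)
bottom-toRaw p q {P} t = trans (pt-toRaw t _ (nE q)) (cong (λ h → P (h ∸ 1) (nE q)) (colHeight-toRaw p q P))

-- `specialAux` overwrites its result at every hit, and its scan is opposite to the word: what it
-- found before the special edge is lost, and the edges after it are misses.
specialIndex-toRaw : ∀ b r {P} → TL (b ++ E ∷ r) P → Special P b r → specialIndex (toRaw (b ++ E ∷ r) P) ≡ just (length r)
specialIndex-toRaw b r {P} t sp with edges-split b E r t
... | es , len , eq = begin
  specialAux T 0 (edges T) nothing
    ≡⟨ cong (λ es → specialAux T 0 es nothing) eq ⟩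
  specialAux T 0 (es ++ colBottom (nE r) ∷ above) nothing
    ≡⟨ specialAux-++ T 0 es _ nothing ⟩
  specialAux T (suc k) above (if pt T (colHeight T (nE r) ∸ 1) (nE r) then just k else specialAux T 0 es nothing)
    ≡⟨ specialAux-Miss T (suc k) _ misses ⟩
  (if pt T (colHeight T (nE r) ∸ 1) (nE r) then just k else specialAux T 0 es nothing)
    ≡⟨ cong (λ h → if h then just k else specialAux T 0 es nothing) (trans (bottom-toRaw b r t) (sp .hit)) ⟩
  just k
    ≡⟨ cong just (trans (+-identityʳ (length es)) len) ⟩
  just (length r) ∎
  where
  open ≡-Reasoning
  T = toRaw (b ++ E ∷ r) P
  above = reverse (edgesOf 0 b (E ∷ r))
  k = length es + 0
  misses : All (Miss T) above
  misses = All-resp-↭ (↭-sym (↭-reverse _)) (All-Miss T 0 b (E ∷ r) miss)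
    where
    miss : ∀ p q → b ≡ p ++ E ∷ q → Miss T (colBottom (nE (q ++ E ∷ r)))
    miss p q refl = subst (λ v → let T = toRaw v P in pt T (colHeight T (nE (q ++ E ∷ r)) ∸ 1) (nE (q ++ E ∷ r)) ≡ false)
      (sym (++-assoc p (E ∷ q) (E ∷ r)))
      (trans (bottom-toRaw p (q ++ E ∷ r) (subst (λ v → TL v P) (++-assoc p (E ∷ q) (E ∷ r)) t)) (sp .noHit p q refl))

-- The three operations on diagrams

insertN-applyUpTo : ∀ (f : ℕ → A) {n i} a → i ≤ n → insertN (applyUpTo f n) i a ≡ applyUpTo (insAt i a f) (suc n)
insertN-applyUpTo f {n}     {zero}  a _         = refl
insertN-applyUpTo f {suc n} {suc i} a (s≤s i≤n) = cong (f 0 ∷_) (insertN-applyUpTo (f ∘ suc) a i≤n)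

dropRow : Raw → Raw
dropRow []      = []
dropRow (_ ∷ T) = T

-- The local recursions of `insertColumn` and `addRibbon` cannot be named; unification finds them.
mutual
  columnRows : Raw → ℕ → ℕ → Raw → Raw
  columnRows = _

  columnRows-solved : ∀ row T r → dropRow (insertColumn (row ∷ T) r) ≡ columnRows (row ∷ T) r 1 T
  columnRows-solved row T r with row ∷ T | 1
  ... | _ | _ = refl

mutual
  ribbonRows : Raw → ℕ → ℕ → ℕ → ℕ → Raw → Raw
  ribbonRows = _

  ribbonRows-solved : ∀ row T r₀ r₁ c₁ → dropRow (addRibbon (row ∷ T) r₀ r₁ c₁) ≡ ribbonRows (row ∷ T) r₀ r₁ c₁ 1 T
  ribbonRows-solved row T r₀ r₁ c₁ with row ∷ T | 1
  ... | _ | _ = refl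

columnRow : Raw → ℕ → ℕ → List Bool → List Bool
columnRow T r x row =
  if x <ᵇ r then insertN row (rowLen T r) false
  else if x ≡ᵇ r then insertN row (rowLen T r) true
  else row

columnRows-applyUpTo : ∀ T r i F m → columnRows T r i (applyUpTo F m) ≡ applyUpTo (λ x → columnRow T r (i + x) (F x)) m
columnRows-applyUpTo T r i F zero    = refl
columnRows-applyUpTo T r i F (suc m) = cong₂ _∷_ (cong (λ j → columnRow T r j (F 0)) (sym (+-identityʳ i)))
  (trans (columnRows-applyUpTo T r (suc i) (F ∘ suc) m)
    (applyUpTo-cong m (λ x _ → cong (λ j → columnRow T r j (F (suc x))) (sym (+-suc i x)))))

ribbonRow : Raw → ℕ → ℕ → ℕ → ℕ → List Bool → List Bool
ribbonRow T r₀ r₁ c₁ x row =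
  if x ≡ᵇ suc r₁ then padTo (suc c₁) row
  else if (suc r₁ <ᵇ x) ∧ (x ≤ᵇ r₀) then padTo (suc (rowLen T (x ∸ 1))) row
  else row

ribbonRows-applyUpTo : ∀ T r₀ r₁ c₁ i F m →
  ribbonRows T r₀ r₁ c₁ i (applyUpTo F m) ≡ applyUpTo (λ x → ribbonRow T r₀ r₁ c₁ (i + x) (F x)) m
ribbonRows-applyUpTo T r₀ r₁ c₁ i F zero    = refl
ribbonRows-applyUpTo T r₀ r₁ c₁ i F (suc m) = cong₂ _∷_ (cong (λ j → ribbonRow T r₀ r₁ c₁ j (F 0)) (sym (+-identityʳ i)))
  (trans (ribbonRows-applyUpTo T r₀ r₁ c₁ (suc i) (F ∘ suc) m)
    (applyUpTo-cong m (λ x _ → cong (λ j → ribbonRow T r₀ r₁ c₁ j (F (suc x))) (sym (+-suc i x)))))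

insertColumn-toRaw : ∀ p q P → insertColumn (toRaw (p ++ N ∷ q) P) (nN p) ≡ toRaw (p ++ N ∷ E ∷ q) (insCol (nE q) (nN p) P)
insertColumn-toRaw p q P = trans (columnRows-applyUpTo T i 0 _ (nN v))
  (trans (cong (applyUpTo _) (sym (nN-insertN p q))) (applyUpTo-cong (nN w) (λ x _ → row x)))
  where
  i = nN p
  c = nE q
  v = p ++ N ∷ q
  w = p ++ N ∷ E ∷ q
  T = toRaw v P
  c≡ : rowLen T i ≡ c
  c≡ = trans (rowLen-toRaw v P i) (lenAt-corner p q)
  c≤ : ∀ {x} → x ≤ i → c ≤ lenAt v x
  c≤ {x} x≤i with m≤n⇒m<n∨m≡n x≤i
  ... | inj₁ x<i  = subst (c ≤_) (sym (lenAt-++ˡ p x x<i)) (m≤n+m c _)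
  ... | inj₂ refl = ≤-reflexive (sym (lenAt-corner p q))
  longer : ∀ x b → x ≤ i →
    insertN (applyUpTo (P x) (lenAt v x)) (rowLen T i) b ≡ applyUpTo (insAt c b (P x)) (lenAt w x)
  longer x b x≤i rewrite c≡ | lenAt-insCol-≤ p q x≤i = insertN-applyUpTo (P x) b (c≤ x≤i)
  row : ∀ x → columnRow T i x (applyUpTo (P x) (lenAt v x)) ≡ applyUpTo (insCol c i P x) (lenAt w x)
  row x with locate i x
  ... | before x<i rewrite <ᵇ-true x<i | ≡ᵇ-false (<⇒≢ x<i) = longer x false (<⇒≤ x<i)
  ... | after zero rewrite +-identityʳ i | <ᵇ-false (≤-refl {i}) | ≡ᵇ-refl i = longer i true ≤-refl
  ... | after (suc k) rewrite <ᵇ-false (m≤m+n i (suc k)) | ≡ᵇ-false (m+1+n≢m i {k}) | lenAt-insCol-> p q k =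
    applyUpTo-cong (lenAt v (i + suc k)) (λ y y<l → sym (insAt-< (<-≤-trans y<l
      (≤-trans (≤-reflexive (lenAt-++ʳ p (suc k))) (lenAt≤nE q k)))))

applyUpTo-point : ∀ c → replicate c false ++ true ∷ [] ≡ applyUpTo (_≡ᵇ c) (suc c)
applyUpTo-point zero    = refl
applyUpTo-point (suc c) = cong (false ∷_) (applyUpTo-point c)

insertRow-toRaw : ∀ p q P → insertRow (toRaw (p ++ E ∷ q) P) (nE q) ≡ toRaw (p ++ N ∷ E ∷ q) (insRow (nN p) (nE q) P)
insertRow-toRaw p q P rewrite colHeight-toRaw p q P | applyUpTo-point (nE q) =
  trans (insertN-applyUpTo _ _ (nN≤ p (E ∷ q)))
    (trans (cong (applyUpTo _) (sym (nN-insert p q))) (applyUpTo-cong (nN w) (λ x _ → row x)))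
  where
  i = nN p
  c = nE q
  v = p ++ E ∷ q
  w = p ++ N ∷ E ∷ q
  row : ∀ x → insAt i (applyUpTo (_≡ᵇ c) (suc c)) (λ x → applyUpTo (P x) (lenAt v x)) x ≡
              applyUpTo (insRow i c P x) (lenAt w x)
  row x with pinView i x
  ... | at = trans (insAt-at i) (trans (cong (applyUpTo (_≡ᵇ c)) (sym (lenAt-corner p (E ∷ q))))
                                       (applyUpTo-cong (lenAt w i) (λ y _ → sym (insRow-at i {c} {P} y))))
  ... | pinned z = trans (insAt-pin i z) (trans (cong (applyUpTo (P z)) (sym (lenAt-insRow p q z)))
                                       (applyUpTo-cong (lenAt w (pin i z)) (λ y _ → sym (insRow-pin i {c} {P} z y))))

applyUpTo-++-replicate : ∀ (f : ℕ → Bool) l d → (∀ y → l ≤ y → f y ≡ false) →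
  applyUpTo f l ++ replicate d false ≡ applyUpTo f (l + d)
applyUpTo-++-replicate f zero    zero    _     = refl
applyUpTo-++-replicate f zero    (suc d) empty =
  cong₂ _∷_ (sym (empty 0 z≤n)) (applyUpTo-++-replicate (f ∘ suc) 0 d (λ y _ → empty (suc y) z≤n))
applyUpTo-++-replicate f (suc l) d       empty =
  cong (f 0 ∷_) (applyUpTo-++-replicate (f ∘ suc) l d (λ y l≤y → empty (suc y) (s≤s l≤y)))

padTo-applyUpTo : ∀ (f : ℕ → Bool) {l t} → l ≤ t → (∀ y → l ≤ y → f y ≡ false) → padTo t (applyUpTo f l) ≡ applyUpTo f t
padTo-applyUpTo f {l} {t} l≤t empty rewrite length-applyUpTo f l =
  trans (applyUpTo-++-replicate f l (t ∸ l) empty) (cong (applyUpTo f) (m+[n∸m]≡n l≤t))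

suc-pred-> : ∀ {n} → 0 < n → suc (n ∸ 1) ≡ n
suc-pred-> {suc n} _ = refl

-- After the first row of the ribbon, each of its rows ends one cell beyond the former end of the
-- row above. This is the length that `addRibbon` prescribes, as it measures the rows of the diagram
-- before any padding.
addRibbon-toRaw : ∀ b u q {Q} → TL (b ++ E ∷ u ++ N ∷ E ∷ q) Q →
  addRibbon (toRaw (b ++ E ∷ u ++ N ∷ E ∷ q) Q) (nN (b ++ E ∷ u)) (nN b ∸ 1) (nE (u ++ N ∷ E ∷ q)) ≡
  toRaw (b ++ N ∷ u ++ E ∷ E ∷ q) Q
addRibbon-toRaw b u q {Q} t = trans (ribbonRows-applyUpTo T r₀ r₁ c₁ 0 _ (nN v))
  (trans (cong (applyUpTo _) nN≡) (applyUpTo-cong (nN w) (λ x _ → row x)))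
  where
  v = b ++ E ∷ u ++ N ∷ E ∷ q
  w = b ++ N ∷ u ++ E ∷ E ∷ q
  T = toRaw v Q
  r₀ = nN (b ++ E ∷ u)
  r₁ = nN b ∸ 1
  c₁ = nE (u ++ N ∷ E ∷ q)
  r₀≡ : r₀ ≡ nN b + nN u
  r₀≡ = nN-++ b
  1+r₁≡ : suc r₁ ≡ nN b
  1+r₁≡ = suc-pred-> (≤-trans z<s (bottom-row b t))
  nN≡ : nN v ≡ nN w
  nN≡ rewrite nN-++ b {E ∷ u ++ N ∷ E ∷ q} | nN-++ u {N ∷ E ∷ q} | nN-++ b {N ∷ u ++ E ∷ E ∷ q} | nN-++ u {E ∷ E ∷ q} =
    cong (nN b +_) (+-suc (nN u) (nN q))
  nE≡ : nE (E ∷ u ++ N ∷ E ∷ q) ≡ nE (N ∷ u ++ E ∷ E ∷ q)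
  nE≡ rewrite nE-++ u {N ∷ E ∷ q} | nE-++ u {E ∷ E ∷ q} = sym (+-suc (nE u) (suc (nE q)))
  empty : ∀ x y → lenAt v x ≤ y → Q x y ≡ false
  empty x y = outside t
  padded : ∀ x n → lenAt v x ≤ n → lenAt w x ≡ n → padTo n (applyUpTo (Q x) (lenAt v x)) ≡ applyUpTo (Q x) (lenAt w x)
  padded x n l≤n refl = padTo-applyUpTo (Q x) l≤n (empty x)
  same : ∀ x → lenAt v x ≡ lenAt w x → applyUpTo (Q x) (lenAt v x) ≡ applyUpTo (Q x) (lenAt w x)
  same x = cong (applyUpTo (Q x))
  row : ∀ x → ribbonRow T r₀ r₁ c₁ x (applyUpTo (Q x) (lenAt v x)) ≡ applyUpTo (Q x) (lenAt w x)
  row x rewrite 1+r₁≡ | r₀≡ with locate (nN b) x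
  ... | before x<b rewrite ≡ᵇ-false (<⇒≢ x<b) | <ᵇ-false (<⇒≤ x<b) =
    same x (trans (lenAt-++ˡ b x x<b) (trans (cong (lenAt b x +_) nE≡) (sym (lenAt-++ˡ b x x<b))))
  ... | after zero rewrite +-identityʳ (nN b) | ≡ᵇ-refl (nN b) =
    padded (nN b) (suc c₁) (≤-trans (≤-reflexive (lenAt-++ʳ₀ b)) (m≤n⇒m≤1+n (lenAt≤nE (u ++ N ∷ E ∷ q) 0)))
      (trans (lenAt-++ʳ₀ b) (sym nE≡))
  ... | after (suc k) rewrite ≡ᵇ-false (m+1+n≢m (nN b) {k}) | <ᵇ-true (m<m+n (nN b) (z<s {k})) with locate (nN u) k
  ...   | before k<u rewrite ≤ᵇ-true (+-monoʳ-≤ (nN b) k<u) | +-suc (nN b) k | rowLen-toRaw v Q (nN b + k) =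
    padded (suc (nN b + k)) (suc (lenAt v (nN b + k))) (m≤n⇒m≤1+n (lenAt-antitone v (nN b + k))) (begin
      lenAt w (suc (nN b + k))              ≡⟨ cong (lenAt w) (+-suc (nN b) k) ⟨
      lenAt w (nN b + suc k)                ≡⟨ lenAt-++ʳ b (suc k) ⟩
      lenAt (u ++ E ∷ E ∷ q) k              ≡⟨ lenAt-++ˡ u k k<u ⟩
      lenAt u k + suc (suc (nE q))          ≡⟨ +-suc (lenAt u k) _ ⟩
      suc (lenAt u k + suc (nE q))          ≡⟨ cong suc (lenAt-++ˡ u k k<u) ⟨
      suc (lenAt (u ++ N ∷ E ∷ q) k)        ≡⟨ cong suc (lenAt-++ʳ b k) ⟨
      suc (lenAt v (nN b + k))              ∎)
      where open ≡-Reasoning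
  ...   | after m rewrite ≤ᵇ-false (+-monoʳ-< (nN b) (s≤s (m≤m+n (nN u) m))) =
    same (nN b + suc (nN u + m)) (begin
      lenAt v (nN b + suc (nN u + m))           ≡⟨ lenAt-++ʳ b _ ⟩
      lenAt (u ++ N ∷ E ∷ q) (suc (nN u + m))   ≡⟨ cong (lenAt (u ++ N ∷ E ∷ q)) (+-suc (nN u) m) ⟨
      lenAt (u ++ N ∷ E ∷ q) (nN u + suc m)     ≡⟨ lenAt-++ʳ u (suc m) ⟩
      lenAt q m                                 ≡⟨ lenAt-++ʳ u m ⟨
      lenAt (u ++ E ∷ E ∷ q) (nN u + m)         ≡⟨ lenAt-++ʳ b _ ⟨
      lenAt w (nN b + suc (nN u + m))           ∎)
      where open ≡-Reasoning

-- Inserting at the bottom edge of the special cell leaves no room for a ribbon.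
addRibbon-trivial : ∀ p q {Q} → 0 < nN p → TL (p ++ N ∷ E ∷ q) Q →
  addRibbon (toRaw (p ++ N ∷ E ∷ q) Q) (nN p) (nN p ∸ 1) (nE q) ≡ toRaw (p ++ N ∷ E ∷ q) Q
addRibbon-trivial p q {Q} 0<p t = trans (ribbonRows-applyUpTo T (nN p) (nN p ∸ 1) (nE q) 0 _ (nN v))
  (applyUpTo-cong (nN v) (λ x _ → row x))
  where
  v = p ++ N ∷ E ∷ q
  T = toRaw v Q
  1+r₁≡ : suc (nN p ∸ 1) ≡ nN p
  1+r₁≡ = suc-pred-> 0<p
  row : ∀ x → ribbonRow T (nN p) (nN p ∸ 1) (nE q) x (applyUpTo (Q x) (lenAt v x)) ≡ applyUpTo (Q x) (lenAt v x)
  row x rewrite 1+r₁≡ with locate (nN p) x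
  ... | before x<p rewrite ≡ᵇ-false (<⇒≢ x<p) | <ᵇ-false (<⇒≤ x<p) = refl
  ... | after zero rewrite +-identityʳ (nN p) | ≡ᵇ-refl (nN p) | lenAt-corner p (E ∷ q) =
    padTo-applyUpTo (Q (nN p)) ≤-refl (λ y l≤y → outside t (≤-trans (≤-reflexive (lenAt-corner p (E ∷ q))) l≤y))
  ... | after (suc k) rewrite ≡ᵇ-false (m+1+n≢m (nN p) {k}) | ≤ᵇ-false (m<m+n (nN p) (z<s {k})) | ∧-zeroʳ (nN p <ᵇ nN p + suc k) = refl

-- Insertpoint

insertpoint-rowEnd : ∀ T {j r s c₁} → lookupM (edges T) j ≡ just (rowEnd r) → specialIndex T ≡ just s →
  lookupM (edges T) s ≡ just (colBottom c₁) →
  insertpoint T j ≡ just (if s <ᵇ j then insertColumn T r else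
    addRibbon (insertColumn T r) r (colHeight T c₁ ∸ 1)
      (if (colHeight T c₁ ∸ 1 ≤ᵇ r) ∧ (rowLen T r ≤ᵇ c₁) then suc c₁ else c₁))
insertpoint-rowEnd T e₁ e₂ e₃ rewrite e₁ | e₂ | e₃ = refl

insertpoint-colBottom : ∀ T {j c s c₁} → lookupM (edges T) j ≡ just (colBottom c) → specialIndex T ≡ just s →
  lookupM (edges T) s ≡ just (colBottom c₁) →
  insertpoint T j ≡ just (if s <ᵇ j then insertRow T c else
    addRibbon (insertRow T c) (colHeight T c)
      (if colHeight T c ≤ᵇ colHeight T c₁ ∸ 1 then suc (colHeight T c₁ ∸ 1) else colHeight T c₁ ∸ 1) c₁)
insertpoint-colBottom T e₁ e₂ e₃ rewrite e₁ | e₂ | e₃ = refl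

if-true : ∀ {b} {x y : A} → b ≡ true → (if b then x else y) ≡ x
if-true refl = refl

if-false : ∀ {b} {x y : A} → b ≡ false → (if b then x else y) ≡ y
if-false refl = refl

specialIndex-≡ : ∀ {v b r P} → v ≡ b ++ E ∷ r → TL v P → Special P b r → specialIndex (toRaw v P) ≡ just (length r)
specialIndex-≡ refl = specialIndex-toRaw _ _

lookupM-edges-≡ : ∀ {v P} p e q → v ≡ p ++ e ∷ q → TL v P → lookupM (edges (toRaw v P)) (length q) ≡ just (edgeAt p e q)
lookupM-edges-≡ p e q refl = lookupM-edges p e q

insertpoint-below : ∀ p e q {P b r} → TL (p ++ e ∷ q) P → p ++ e ∷ q ≡ b ++ E ∷ r → Special P b r → length r < length q →
  insertpoint (toRaw (p ++ e ∷ q) P) (length q) ≡ just (toRaw (p ++ N ∷ E ∷ q) (insPt e (nN p) (nE q) P))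
insertpoint-below p E q {P} {b} {r} t eq sp r<q =
  trans (insertpoint-colBottom (toRaw (p ++ E ∷ q) P) (lookupM-edges p E q t) (specialIndex-≡ eq t sp) (lookupM-edges-≡ b E r eq t))
    (cong just (trans (if-true (<ᵇ-true r<q)) (insertRow-toRaw p q P)))
insertpoint-below p N q {P} {b} {r} t eq sp r<q =
  trans (insertpoint-rowEnd (toRaw (p ++ N ∷ q) P) (lookupM-edges p N q t) (specialIndex-≡ eq t sp) (lookupM-edges-≡ b E r eq t))
    (cong just (trans (if-true (<ᵇ-true r<q)) (insertColumn-toRaw p q P)))

insertpoint-special : ∀ p q {P} → TL (p ++ E ∷ q) P → Special P p q →
  insertpoint (toRaw (p ++ E ∷ q) P) (length q) ≡ just (toRaw (p ++ N ∷ E ∷ q) (insRow (nN p) (nE q) P))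
insertpoint-special p q {P} t sp =
  trans (insertpoint-colBottom T (lookupM-edges p E q t) (specialIndex-toRaw p q t sp) (lookupM-edges p E q t))
    (cong just (trans (if-false (<ᵇ-false (≤-refl {length q}))) result))
  where
  T = toRaw (p ++ E ∷ q) P
  result : addRibbon (insertRow T (nE q)) (colHeight T (nE q))
             (if colHeight T (nE q) ≤ᵇ colHeight T (nE q) ∸ 1 then suc (colHeight T (nE q) ∸ 1) else colHeight T (nE q) ∸ 1) (nE q)
           ≡ toRaw (p ++ N ∷ E ∷ q) (insRow (nN p) (nE q) P)
  result rewrite insertRow-toRaw p q P | colHeight-toRaw p q P | ≤ᵇ-false (bottom-row p t) =
    addRibbon-trivial p q (≤-trans z<s (bottom-row p t)) (TL-insRow p t)

insertpoint-plain : ∀ p e q {P} → TL (p ++ e ∷ q) P → NoHit P p (e ∷ q) →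
  insertpoint (toRaw (p ++ e ∷ q) P) (length q) ≡ just (toRaw (p ++ N ∷ E ∷ q) (insPt e (nN p) (nE q) P))
insertpoint-plain p e q {P} t nh with TL-special t
... | b , r , eq , sp with ++-split p b eq
...   | inj₁ (z , refl , refl) = ⊥-elim (true≢false (sp .hit) (nh b z refl))
...   | inj₂ ([] , refl , refl) = insertpoint-special p q t (subst (λ b → Special P b q) (++-identityʳ p) sp)
...   | inj₂ (_ ∷ s , refl , e≡) = insertpoint-below p e q t eq sp
          (subst (λ z → length r < length z) (sym (∷-injectiveʳ e≡)) (length-++-≤ʳ (E ∷ r) {s}))

insertpoint-ribbon : ∀ b u e q {P} → TL (b ++ E ∷ u ++ e ∷ q) P → Special P b (u ++ e ∷ q) →
  insertpoint (toRaw (b ++ E ∷ u ++ e ∷ q) P) (length q) ≡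
  just (toRaw (b ++ N ∷ u ++ E ∷ E ∷ q) (insPt e (nN (b ++ E ∷ u)) (nE q) P))
insertpoint-ribbon b u e q {P} t sp = by-step e t sp
  where
  p = b ++ E ∷ u
  j≤s : ∀ e → length q ≤ length (u ++ e ∷ q)
  j≤s e = ≤-trans (n≤1+n (length q)) (length-++-≤ʳ (e ∷ q) {u})
  assoc : ∀ w → p ++ w ≡ b ++ E ∷ u ++ w
  assoc = ++-assoc b (E ∷ u)
  by-step : ∀ e → TL (b ++ E ∷ u ++ e ∷ q) P → Special P b (u ++ e ∷ q) →
    insertpoint (toRaw (b ++ E ∷ u ++ e ∷ q) P) (length q) ≡
    just (toRaw (b ++ N ∷ u ++ E ∷ E ∷ q) (insPt e (nN p) (nE q) P))
  by-step E t sp = trans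
    (insertpoint-colBottom T (lookupM-edges-≡ p E q (sym (assoc _)) t)
      (specialIndex-toRaw b (u ++ E ∷ q) t sp) (lookupM-edges b E (u ++ E ∷ q) t))
    (cong just (trans (if-false (<ᵇ-false (j≤s E))) result))
    where
    T = toRaw (b ++ E ∷ u ++ E ∷ q) P
    Q = insRow (nN p) (nE q) P
    row≡ : insertRow T (nE q) ≡ toRaw (b ++ E ∷ u ++ N ∷ E ∷ q) Q
    row≡ = trans (cong (λ v → insertRow (toRaw v P) (nE q)) (sym (assoc (E ∷ q))))
             (trans (insertRow-toRaw p q P) (cong (λ v → toRaw v Q) (assoc (N ∷ E ∷ q))))
    height≡ : colHeight T (nE q) ≡ nN p
    height≡ = trans (cong (λ v → colHeight (toRaw v P) (nE q)) (sym (assoc (E ∷ q)))) (colHeight-toRaw p q P)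
    result : addRibbon (insertRow T (nE q)) (colHeight T (nE q))
      (if colHeight T (nE q) ≤ᵇ colHeight T (nE (u ++ E ∷ q)) ∸ 1 then suc (colHeight T (nE (u ++ E ∷ q)) ∸ 1)
        else colHeight T (nE (u ++ E ∷ q)) ∸ 1) (nE (u ++ E ∷ q)) ≡ toRaw (b ++ N ∷ u ++ E ∷ E ∷ q) Q
    -- The new row lies below the special point, whose row index stays the same.
    result rewrite row≡ | height≡ | colHeight-toRaw b (u ++ E ∷ q) P
                 | ≤ᵇ-false (<-≤-trans (bottom-row b t) (nN≤ b (E ∷ u))) | sym (nE-insertE u q) =
      addRibbon-toRaw b u q (TL-insPt-++ b u E t)
  by-step N t sp = trans
    (insertpoint-rowEnd T (lookupM-edges-≡ p N q (sym (assoc _)) t)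
      (specialIndex-toRaw b (u ++ N ∷ q) t sp) (lookupM-edges b E (u ++ N ∷ q) t))
    (cong just (trans (if-false (<ᵇ-false (j≤s N))) result))
    where
    T = toRaw (b ++ E ∷ u ++ N ∷ q) P
    Q = insCol (nE q) (nN p) P
    column≡ : insertColumn T (nN p) ≡ toRaw (b ++ E ∷ u ++ N ∷ E ∷ q) Q
    column≡ = trans (cong (λ v → insertColumn (toRaw v P) (nN p)) (sym (assoc (N ∷ q))))
                (trans (insertColumn-toRaw p q P) (cong (λ v → toRaw v Q) (assoc (N ∷ E ∷ q))))
    length≡ : rowLen T (nN p) ≡ nE q
    length≡ = trans (rowLen-toRaw (b ++ E ∷ u ++ N ∷ q) P (nN p)) (trans (cong (λ v → lenAt v (nN p)) (sym (assoc (N ∷ q)))) (lenAt-corner p q))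
    result : addRibbon (insertColumn T (nN p)) (nN p) (colHeight T (nE (u ++ N ∷ q)) ∸ 1)
      (if (colHeight T (nE (u ++ N ∷ q)) ∸ 1 ≤ᵇ nN p) ∧ (rowLen T (nN p) ≤ᵇ nE (u ++ N ∷ q))
        then suc (nE (u ++ N ∷ q)) else nE (u ++ N ∷ q)) ≡ toRaw (b ++ N ∷ u ++ E ∷ E ∷ q) Q
    -- The new column lies to the left of the special point, whose column index grows by one.
    result rewrite column≡ | length≡ | colHeight-toRaw b (u ++ N ∷ q) P
                 | ≤ᵇ-true (<⇒≤ (<-≤-trans (bottom-row b t) (nN≤ b (E ∷ u)))) | ≤ᵇ-true (nE≤ u (N ∷ q)) | sym (nE-insert u q) =
      addRibbon-toRaw b u q (TL-insPt-++ b u N t)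

insertpoint-toRaw : ∀ {v P j w Q} → Insertion v P j w Q → TL v P → insertpoint (toRaw v P) j ≡ just (toRaw w Q)
insertpoint-toRaw (plain p e q nh)    t = insertpoint-plain p e q t nh
insertpoint-toRaw (ribbon b u e q sp) t = insertpoint-ribbon b u e q t sp

-- Tree-like tableaux and their words

TL⇒IsTreeLike : ∀ {v P} → TL v P → IsTreeLike (toRaw v P)
TL⇒IsTreeLike {v} {P} t =
  ((λ i i<n → let j , e = t .rows i (subst (i <_) (toRaw-rows v P) i<n) in
              subst (0 <_) (sym (rowLen-toRaw v P i)) (≤-trans z<s (t .inside i j e)))
  , λ i → subst₂ _≤_ (sym (rowLen-toRaw v P (suc i))) (sym (rowLen-toRaw v P i)) (lenAt-antitone v i))
  , t′ .root , t′ .parent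
  , (λ i i<n → t′ .rows i (subst (i <_) (toRaw-rows v P) i<n))
  , (λ j j<n → t′ .cols j (subst (j <_) (trans (rowLen-toRaw v P 0) (TL-width t)) j<n))
  where t′ = TL-resp (≗₂-sym (pt-toRaw t)) t

-- After the end of a row come the bottoms of the columns that the next row does not reach. For the
-- last row the default length 0 gives all its columns.
wordOf : Raw → Word
wordOf []        = []
wordOf (row ∷ T) = N ∷ replicate (length row ∸ rowLen T 0) E ++ wordOf T

nN-replicateE : ∀ k v → nN (replicate k E ++ v) ≡ nN v
nN-replicateE zero    v = refl
nN-replicateE (suc k) v = nN-replicateE k v

nE-replicateE : ∀ k v → nE (replicate k E ++ v) ≡ k + nE v
nE-replicateE zero    v = refl
nE-replicateE (suc k) v = cong suc (nE-replicateE k v)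

lenAt-replicateE : ∀ k v x → lenAt (replicate k E ++ v) x ≡ lenAt v x
lenAt-replicateE zero    v x = refl
lenAt-replicateE (suc k) v x = lenAt-replicateE k v x

nN-wordOf : ∀ T → nN (wordOf T) ≡ numRows T
nN-wordOf []        = refl
nN-wordOf (row ∷ T) = cong suc (trans (nN-replicateE (length row ∸ rowLen T 0) (wordOf T)) (nN-wordOf T))

Antitone : Raw → Set
Antitone T = ∀ i → rowLen T (suc i) ≤ rowLen T i

nE-wordOf : ∀ T → Antitone T → nE (wordOf T) ≡ rowLen T 0
nE-wordOf []        _    = refl
nE-wordOf (row ∷ T) anti = trans (nE-replicateE (length row ∸ rowLen T 0) (wordOf T))
  (trans (cong (length row ∸ rowLen T 0 +_) (nE-wordOf T (anti ∘ suc))) (m∸n+n≡m (anti 0)))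

lenAt-wordOf : ∀ T → Antitone T → ∀ x → lenAt (wordOf T) x ≡ rowLen T x
lenAt-wordOf []        _    x       = refl
lenAt-wordOf (row ∷ T) anti zero    = nE-wordOf (row ∷ T) anti
lenAt-wordOf (row ∷ T) anti (suc x) =
  trans (lenAt-replicateE (length row ∸ rowLen T 0) (wordOf T) x) (lenAt-wordOf T (anti ∘ suc) x)

applyUpTo-lookupD : ∀ (xs : List A) d → applyUpTo (λ i → lookupD xs i d) (length xs) ≡ xs
applyUpTo-lookupD []       d = refl
applyUpTo-lookupD (x ∷ xs) d = cong (x ∷_) (applyUpTo-lookupD xs d)

toRaw-wordOf : ∀ T → Antitone T → toRaw (wordOf T) (pt T) ≡ T
toRaw-wordOf T anti = begin
  applyUpTo (λ x → applyUpTo (pt T x) (lenAt (wordOf T) x)) (nN (wordOf T))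
    ≡⟨ cong (applyUpTo _) (nN-wordOf T) ⟩
  applyUpTo (λ x → applyUpTo (pt T x) (lenAt (wordOf T) x)) (numRows T)
    ≡⟨ applyUpTo-cong (numRows T) (λ x _ → trans (cong (applyUpTo (pt T x)) (lenAt-wordOf T anti x)) (applyUpTo-lookupD (lookupD T x []) false)) ⟩
  applyUpTo (λ x → lookupD T x []) (numRows T)
    ≡⟨ applyUpTo-lookupD T [] ⟩
  T ∎
  where open ≡-Reasoning

IsTreeLike⇒TL : ∀ {T} → IsTreeLike T → TL (wordOf T) (pt T)
IsTreeLike⇒TL {T} ((_ , anti) , root , parent , rows , cols) = record
  { inside = λ x y e → subst (y <_) (sym (lenAt-wordOf T anti x)) (≰⇒> λ l → true≢false e (lookupD-beyond (lookupD T x []) false l))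
  ; root   = root
  ; parent = parent
  ; rows   = λ x x<n → rows x (subst (x <_) (nN-wordOf T) x<n)
  ; cols   = λ y y<n → cols y (subst (y <_) (nE-wordOf T anti) y<n)
  }

-- Size and number of crossings of a diagram

sum-map-applyUpTo : ∀ (f : A → ℕ) g n → sum (map f (applyUpTo g n)) ≡ sumTo n (f ∘ g)
sum-map-applyUpTo f g zero    = refl
sum-map-applyUpTo f g (suc n) = cong (f (g 0) +_) (sum-map-applyUpTo f (g ∘ suc) n)

size-toRaw : ∀ v P → size (toRaw v P) ≡ points v P
size-toRaw v P = trans (sum-map-applyUpTo _ _ (nN v)) (sumTo-cong (nN v) (λ x _ → countᵇ-applyUpTo _ (P x) (lenAt v x)))

countᵇ-cells : ∀ (p : ℕ × ℕ → Bool) T →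
  countᵇ p (cells T) ≡ sumTo (numRows T) (λ i → sumTo (rowLen T i) (λ j → indicator (p (i , j))))
countᵇ-cells p T = trans (countᵇ-concatMap p (λ i → map (i ,_) (upTo (rowLen T i))) (numRows T))
  (sumTo-cong (numRows T) (λ i _ → countᵇ-map-upTo p (i ,_) (rowLen T i)))

sumTo-toRaw : ∀ v P f → sumTo (numRows (toRaw v P)) (λ i → sumTo (rowLen (toRaw v P) i) (f i)) ≡ sumV v f
sumTo-toRaw v P f rewrite toRaw-rows v P = sumTo-cong (nN v) (λ i _ → cong (λ l → sumTo l (f i)) (rowLen-toRaw v P i))

cr-toRaw : ∀ {v P} → TL v P → cr (toRaw v P) ≡ crossings v P
cr-toRaw {v} {P} t = begin
  cr (toRaw v P)
    ≡⟨ countᵇ-cells _ (toRaw v P) ⟩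
  sumTo (numRows (toRaw v P)) (λ i → sumTo (rowLen (toRaw v P) i) (λ j → indicator (cross (pt (toRaw v P)) i j)))
    ≡⟨ sumTo-toRaw v P (λ i j → indicator (cross (pt (toRaw v P)) i j)) ⟩
  sumV v (λ x y → indicator (cross (pt (toRaw v P)) x y))
    ≡⟨ sumV-cong v (λ x y _ → cong indicator (cross-cong (pt-toRaw t) x y)) ⟩
  crossings v P ∎
  where open ≡-Reasoning

-- The numbers of columns are compared separately because row lengths do not reveal an `E` before
-- the first `N`.
word-ext : ∀ v w → nN v ≡ nN w → nE v ≡ nE w → (∀ x → lenAt v x ≡ lenAt w x) → v ≡ w
word-ext []      []      _ _ _ = refl
word-ext (N ∷ v) (N ∷ w) r c l = cong (N ∷_) (word-ext v w (suc-injective r) c (l ∘ suc))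
word-ext (E ∷ v) (E ∷ w) r c l = cong (E ∷_) (word-ext v w r (suc-injective c) l)
word-ext (N ∷ v) (E ∷ w) r c l = contradiction (≤-trans (≤-reflexive (trans (sym c) (l 0))) (lenAt≤nE w 0)) 1+n≰n
word-ext (E ∷ v) (N ∷ w) r c l = contradiction (≤-trans (≤-reflexive (trans c (sym (l 0)))) (lenAt≤nE v 0)) 1+n≰n
word-ext []      (N ∷ w) () _ _
word-ext []      (E ∷ w) _ () _
word-ext (N ∷ v) []      () _ _
word-ext (E ∷ v) []      _ () _

toRaw-injective : ∀ {v w P Q} → TL v P → TL w Q → toRaw v P ≡ toRaw w Q → v ≡ w × P ≗₂ Q
toRaw-injective {v} {w} {P} {Q} t t′ eq =
  word-ext v w
    (trans (sym (toRaw-rows v P)) (trans (cong numRows eq) (toRaw-rows w Q)))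
    (trans (sym (TL-width t)) (trans (len 0) (TL-width t′)))
    len ,
  λ x y → trans (sym (pt-toRaw t x y)) (trans (cong (λ T → pt T x y) eq) (pt-toRaw t′ x y))
  where
  len : ∀ x → lenAt v x ≡ lenAt w x
  len x = trans (sym (rowLen-toRaw v P x)) (trans (cong (λ T → rowLen T x) eq) (rowLen-toRaw w Q x))

-- Insertion histories

history-∷ʳ : ∀ xs a → 0 < length xs → history (xs ++ a ∷ []) ≡ (history xs >>= λ T → insertpoint T a)
history-∷ʳ (x ∷ xs) a _ = foldl-∷ʳ (λ m a → m >>= λ T → insertpoint T a) (just T₁) a xs

history-step : ∀ {as a b T} → history (reverse (a ∷ as)) ≡ just T → history (reverse (b ∷ a ∷ as)) ≡ insertpoint T b
history-step {as} {a} {b} {T} eq = begin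
  history (reverse (b ∷ a ∷ as))                             ≡⟨ cong history (unfold-reverse b (a ∷ as)) ⟩
  history (reverse (a ∷ as) ++ b ∷ [])                       ≡⟨ history-∷ʳ (reverse (a ∷ as)) b (subst (0 <_) (sym (length-reverse (a ∷ as))) z<s) ⟩
  (history (reverse (a ∷ as)) >>= λ T → insertpoint T b)     ≡⟨ cong (_>>= λ T → insertpoint T b) eq ⟩
  insertpoint T b                                            ∎
  where open ≡-Reasoning

-- The invariant of a history of `m` insertions, the initial cell included. Since `special≡` equates
-- the index of the special edge with the last code entry, the next ribbon length is a term of
-- `descents`.
record Reaches (m a : ℕ) (as : List ℕ) : Set where
  field
    word      : Word
    matrix    : Mat
    tableau   : TL word matrix
    reached   : history (reverse (a ∷ as)) ≡ just (toRaw word matrix)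
    length≡   : length word ≡ suc m
    special≡  : ∃₂ λ b r → word ≡ b ++ E ∷ r × length r ≡ a × Special matrix b r
    crossings≡ : crossings word matrix ≡ descents (a ∷ as)
    points≡   : points word matrix ≡ m

singlePoint : Mat
singlePoint x y = (x ≡ᵇ 0) ∧ (y ≡ᵇ 0)

TL-single : TL (N ∷ E ∷ []) singlePoint
TL-single = record
  { inside = λ { zero zero _ → z<s }
  ; root   = refl
  ; parent = λ { zero zero _ nr → contradiction (refl , refl) nr }
  ; rows   = λ { zero _ → 0 , refl ; (suc _) (s≤s ()) }
  ; cols   = λ { zero _ → 0 , refl ; (suc _) (s≤s ()) }
  }

reaches : ∀ {m a as} → Code m (a ∷ as) → Reaches m a as
reaches {as = []} (z≤n ∷ []) = record
  { word = N ∷ E ∷ []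
  ; matrix = singlePoint
  ; tableau = TL-single
  ; reached = refl
  ; length≡ = refl
  ; special≡ = N ∷ [] , [] , refl , refl , special refl λ { [] _ () ; (_ ∷ []) _ () ; (_ ∷ _ ∷ _) _ () }
  ; crossings≡ = refl
  ; points≡ = refl
  }
reaches {a = b} {a ∷ as} (_∷_ {m} b≤m c) = record
  { word = w
  ; matrix = Q
  ; tableau = TL-Insertion ins tableau
  ; reached = trans (history-step {as} {a} {b} reached) (insertpoint-toRaw ins tableau)
  ; length≡ = trans (length-Insertion ins) (cong suc length≡)
  ; special≡ = Special-Insertion ins tableau
  ; crossings≡ = let _ , _ , word≡ , len≡ , sp = special≡ in
      trans (crossings-Insertion ins tableau word≡ sp) (cong₂ (λ s k → (s ∸ b) + k) len≡ crossings≡)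
  ; points≡ = trans (points-Insertion ins tableau) (cong suc points≡)
  }
  where
  open Reaches (reaches c)
  insertion = Insertion-exists tableau b (subst (b <_) (sym length≡) (s≤s b≤m))
  w = proj₁ insertion
  Q = proj₁ (proj₂ insertion)
  ins = proj₂ (proj₂ insertion)

-- The induction runs on the length of the word, which undoing an insertion lowers by one; that the
-- length is the number of points plus one is recovered afterwards from `reaches`.
code-exists : ∀ m {v P} → TL v P → length v ≡ suc (suc m) → ∃ λ as → Code (suc m) as × history (reverse as) ≡ just (toRaw v P)
code-exists zero {N ∷ E ∷ []} {P} t _ = 0 ∷ [] , z≤n ∷ [] , cong (λ b → just ((b ∷ []) ∷ [])) (sym (t .root))
code-exists zero {N ∷ N ∷ []} t _ with () ← t .inside 0 0 (t .root)
code-exists zero {E ∷ _} t _ with _ , () , _ ← above-bottom [] t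
code-exists (suc m) {w} {Q} t len with Insertion-surjective t (subst (2 <_) (sym len) (s≤s (s≤s z<s)))
... | v , P , j , Q′ , t′ , ins , Q≗
  with len′ ← suc-injective (trans (sym (length-Insertion ins)) len)
  with code-exists m t′ len′
... | a ∷ as , c , eq = j ∷ a ∷ as , s≤s⁻¹ (subst (j <_) len′ (Insertion-index ins)) ∷ c ,
  trans (history-step {as} {a} {j} eq) (trans (insertpoint-toRaw ins t′) (cong just (toRaw-cong w (≗₂-sym Q≗))))

-- `reaches` rebuilds the last two stages of both histories as words and matrices. Equal diagrams
-- have equal words and matrices, so `Insertion-injective` gives the same last entry and the same
-- previous diagram.
code-unique : ∀ {m as bs T} → Code m as → Code m bs → history (reverse as) ≡ just T → history (reverse bs) ≡ just T → as ≡ bs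
code-unique [] [] _ _ = refl
code-unique (z≤n ∷ []) (z≤n ∷ []) _ _ = refl
code-unique {as = a ∷ a′ ∷ as} {b ∷ b′ ∷ bs} (a≤m ∷ c@(_ ∷ _)) (b≤m ∷ d@(_ ∷ _)) eq eq′ =
  cong₂ _∷_ a≡b (code-unique c d A.reached (trans B.reached (cong just (sym same))))
  where
  module A = Reaches (reaches c)
  module B = Reaches (reaches d)
  insA = Insertion-exists A.tableau a (subst (a <_) (sym A.length≡) (s≤s a≤m))
  insB = Insertion-exists B.tableau b (subst (b <_) (sym B.length≡) (s≤s b≤m))
  ia = proj₂ (proj₂ insA)
  ib = proj₂ (proj₂ insB)
  same-result : toRaw (proj₁ insA) (proj₁ (proj₂ insA)) ≡ toRaw (proj₁ insB) (proj₁ (proj₂ insB))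
  same-result = just-injective (begin
    just _                          ≡⟨ insertpoint-toRaw ia A.tableau ⟨
    insertpoint (toRaw A.word A.matrix) a ≡⟨ history-step {as} {a′} {a} A.reached ⟨
    history (reverse (a ∷ a′ ∷ as)) ≡⟨ trans eq (sym eq′) ⟩
    history (reverse (b ∷ b′ ∷ bs)) ≡⟨ history-step {bs} {b′} {b} B.reached ⟩
    insertpoint (toRaw B.word B.matrix) b ≡⟨ insertpoint-toRaw ib B.tableau ⟩
    just _                          ∎)
    where open ≡-Reasoning
  inj = let w≡ , Q≗ = toRaw-injective (TL-Insertion ia A.tableau) (TL-Insertion ib B.tableau) same-result in
        Insertion-injective ia ib A.tableau B.tableau w≡ Q≗
  a≡b = proj₁ (proj₂ inj)
  same : toRaw A.word A.matrix ≡ toRaw B.word B.matrix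
  same = trans (toRaw-cong A.word (proj₂ (proj₂ inj))) (cong (λ v → toRaw v B.matrix) (proj₁ inj))

TL-length : ∀ {v P} → TL v P → ∃ λ m → length v ≡ suc (suc m)
TL-length {[]}        t with () ← t .inside 0 0 (t .root)
TL-length {N ∷ []}    t with () ← t .inside 0 0 (t .root)
TL-length {E ∷ []}    t with () ← t .inside 0 0 (t .root)
TL-length {_ ∷ _ ∷ v} t = length v , refl

tableau⇒code : ∀ {n T} → IsTLT n T → ∃ λ as → Code n as × history (reverse as) ≡ just T
tableau⇒code {n} {T} (isTL@((_ , anti) , _) , size≡) with t ← IsTreeLike⇒TL {T} isTL with TL-length t
... | m , len with code-exists m t len
... | a ∷ as , c , eq = a ∷ as , subst (λ m → Code m (a ∷ as)) m≡n c , eqT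
  where
  open Reaches (reaches c)
  eqT : history (reverse (a ∷ as)) ≡ just T
  eqT = trans eq (cong just (toRaw-wordOf T anti))
  m≡n : suc m ≡ n
  m≡n = begin
    suc m                     ≡⟨ points≡ ⟨
    points word matrix        ≡⟨ size-toRaw word matrix ⟨
    size (toRaw word matrix)  ≡⟨ cong size (just-injective (trans (sym reached) eqT)) ⟩
    size T                    ≡⟨ size≡ ⟩
    n                         ∎
    where open ≡-Reasoning

code⇒tableau : ∀ {m as} → Code (suc m) as → ∃ λ T → IsTLT (suc m) T × history (reverse as) ≡ just T × cr T ≡ descents as
code⇒tableau c@(_∷_ {as = as} _ _) = toRaw word matrix ,
  (TL⇒IsTreeLike tableau , trans (size-toRaw word matrix) points≡) , reached ,
  trans (cr-toRaw tableau) crossings≡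
  where open Reaches (reaches c)

-- The bijection

toPerm : ℕ → List ℕ → List ℕ
toPerm n as = reverse (decodeAux as (range 1 (suc n)))

decode-reverse : ∀ n as → decode n (reverse as) ≡ toPerm n as
decode-reverse n as = cong (λ z → toPerm n z) (reverse-involutive as)

toPerm-IsPerm : ∀ {n as} → Code n as → IsPerm n (toPerm n as)
toPerm-IsPerm {n} c = ↭-trans (↭-reverse _) (decodeAux-↭ _ (range-length n) c)

toPerm-injective : ∀ {n as bs} → Code n as → Code n bs → toPerm n as ≡ toPerm n bs → as ≡ bs
toPerm-injective {n} c d eq = decodeAux-injective _ (range-length n) (range-Sorted n) c d (reverse-injective eq)

toPerm-surjective : ∀ {n σ} → IsPerm n σ → ∃ λ as → Code n as × σ ≡ toPerm n as
toPerm-surjective {n} {σ} perm =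
  let as , c , eq = decodeAux-surjective (reverse σ) _ (range-length n) (↭-trans (↭-reverse σ) perm) in
  as , c , trans (sym (reverse-involutive σ)) (cong reverse (sym eq))

occ231-toPerm : ∀ {n as} → Code n as → occ231 (toPerm n as) ≡ descents as
occ231-toPerm {n} {as} c = trans (occ231-reverse (decodeAux as (range 1 (suc n))))
  (occ231ʳ-decodeAux _ (range-length n) (range-Sorted n) c)

code⇒Φ₁ : ∀ {n T as} → Code n as → history (reverse as) ≡ just T → Φ₁ n T (toPerm n as)
code⇒Φ₁ {n} {as = as} c eq = reverse as , Code⇒ValidCode c , eq , sym (decode-reverse n as)

Φ₁⇒code : ∀ {n T σ} → Φ₁ n T σ → ∃ λ as → Code n as × history (reverse as) ≡ just T × σ ≡ toPerm n as
Φ₁⇒code {n} {T} (a , valid , eq , refl) = reverse a ,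
  ValidCode⇒Code (reverse a) (subst (ValidCode n) (sym (reverse-involutive a)) valid) ,
  trans (cong history (reverse-involutive a)) eq , refl

theorem4p2 : (n : ℕ) → 1 ≤ n →
    ((T : Raw) → IsTLT n T →
    ∃ λ σ → Φ₁ n T σ × IsPerm n σ × (∀ σ' → Φ₁ n T σ' → σ' ≡ σ))
    × ((σ : List ℕ) → IsPerm n σ →
    ∃ λ T → IsTLT n T × Φ₁ n T σ × (∀ T' → IsTLT n T' → Φ₁ n T' σ → T' ≡ T))
    × ((T : Raw) (σ : List ℕ) → IsTLT n T → Φ₁ n T σ → cr T ≡ occ231 σ)
theorem4p2 n@(suc _) _ = image , preimage , statistics
  where
  image : (T : Raw) → IsTLT n T → ∃ λ σ → Φ₁ n T σ × IsPerm n σ × (∀ σ' → Φ₁ n T σ' → σ' ≡ σ)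
  image T isTLT with tableau⇒code isTLT
  ... | as , c , eq = toPerm n as , code⇒Φ₁ c eq , toPerm-IsPerm c , unique
    where
    unique : ∀ σ' → Φ₁ n T σ' → σ' ≡ toPerm n as
    unique σ' φ with Φ₁⇒code φ
    ... | bs , d , eq′ , refl = cong (toPerm n) (code-unique d c eq′ eq)

  preimage : (σ : List ℕ) → IsPerm n σ → ∃ λ T → IsTLT n T × Φ₁ n T σ × (∀ T' → IsTLT n T' → Φ₁ n T' σ → T' ≡ T)
  preimage σ perm with toPerm-surjective perm
  ... | as , c , refl with code⇒tableau c
  ... | T , isTLT , eq , _ = T , isTLT , code⇒Φ₁ c eq , unique
    where
    unique : ∀ T' → IsTLT n T' → Φ₁ n T' (toPerm n as) → T' ≡ T
    unique T' _ φ with Φ₁⇒code φ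
    ... | bs , d , eq′ , σ≡ with refl ← toPerm-injective c d σ≡ = just-injective (trans (sym eq′) eq)

  statistics : (T : Raw) (σ : List ℕ) → IsTLT n T → Φ₁ n T σ → cr T ≡ occ231 σ
  statistics T σ _ φ with Φ₁⇒code φ
  -- The crossings are known for the diagram built from the code; it is `T`, because `history` has
  -- only one value at that code.
  ... | as , c , eq , refl with code⇒tableau c
  ... | T′ , _ , eq′ , cr≡ with refl ← just-injective (trans (sym eq) eq′) = trans cr≡ (sym (occ231-toPerm c))
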